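{- Let $n\ge 1$ and $w\in S_n$. Let $\theta_w$ denote the number of supports of the Schubert polynomial $\mathfrak{S}_w(x)$, i.e. the number of exponent vectors $\alpha\in\mathbb{Z}_{\ge0}^n$ such that the monomial $x^\alpha$ has nonzero coefficient in $\mathfrak{S}_w(x)$. Then \begin{align*} \theta_w\ \ge\ & 1+p_{132}(w)+p_{1432}(w)+p_{13254}(w)+3p_{14253}(w)+p_{14352}(w)+4p_{15243}(w)+p_{15324}(w)\\ &+2p_{15342}(w)+p_{15432}(w)+p_{24153}(w)+2p_{25143}(w)+p_{35142}(w). \end{align*}
   Context: Schubert polynomials are defined recursively: for the longest permutation $w_0=n\cdots21\in S_n$, $\mathfrak{S}_{w_0}(x)=x_1^{n-1}x_2^{n-2}\cdots x_{n-1}$; for $w\ne w_0$, choose $1\le i<n$ with $w(i)<w(i+1)$ and set $\mathfrak{S}_w(x)=\partial_i\mathfrak{S}_{ws_i}(x)$, where $ws_i$ is $w$ with the values $w(i),w(i+1)$ swapped and $\partial_i f=\frac{f-f|_{x_i\leftrightarrow x_{i+1}}}{x_i-x_{i+1}}$. For $u\in S_m$ with $m\le n$, a $u$ pattern in $w$ is a subsequence $w(i_1)\cdots w(i_m)$ with $i_1<\cdots<i_m$ having the same relative order as $u(1)\cdots u(m)$; $p_u(w)$ is the number of $u$ patterns in $w$. -}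

module Defs where

open import Data.Nat using (ℕ; zero; suc; _+_; _*_; _∸_; _<ᵇ_)
open import Data.Integer as ℤ using (ℤ; +_; -_)
open import Data.List using (List; []; _∷_; [_]; map; concatMap; upTo; downFrom; tabulate; deduplicate; length; zip; _++_; foldr)
open import Data.List.Properties using (≡-dec)
open import Data.Bool using (Bool; true; false; if_then_else_; _∧_; not)
open import Data.Product using (_×_; _,_; proj₁; proj₂)
open import Data.Maybe using (Maybe; just; nothing)
import Data.Maybe as Maybe
open import Data.Fin using (Fin; toℕ)
open import Data.Fin.Permutation using (Permutation′; _⟨$⟩ʳ_)
open import Relation.Nullary using (does)
import Data.Nat as ℕ

-- Polynomials in x_1..x_n with integer coefficients, represented as a formal
-- (unnormalised) sum of terms c·x^α, α an exponent list of length n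
-- (index 0 ↦ x_1, ..., index n-1 ↦ x_n).
Poly : Set
Poly = List (List ℕ × ℤ)

get : List ℕ → ℕ → ℕ
get []       _       = 0
get (a ∷ _)  zero    = a
get (_ ∷ as) (suc i) = get as i

set : List ℕ → ℕ → ℕ → List ℕ
set []       _       _ = []
set (_ ∷ as) zero    v = v ∷ as
set (a ∷ as) (suc i) v = a ∷ set as i v

-- Divided difference ∂ (acting on variables at 0-based positions i, i+1) of a
-- single term c·x^α, computed exactly:
--   (x_i^a x_{i+1}^b − x_i^b x_{i+1}^a)/(x_i − x_{i+1})
--   = Σ_{k<a−b} x_i^{b+k} x_{i+1}^{a−1−k}          if a > b
--   = − Σ_{k<b−a} x_i^{a+k} x_{i+1}^{b−1−k}        if a < b
--   = 0                                           if a = b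
ddTerm : ℕ → List ℕ × ℤ → Poly
ddTerm i (α , c) =
  if b <ᵇ a then map (λ k → (set (set α i (b + k)) (suc i) (a ∸ 1 ∸ k) , c)) (upTo (a ∸ b))
  else if a <ᵇ b then map (λ k → (set (set α i (a + k)) (suc i) (b ∸ 1 ∸ k) , - c)) (upTo (b ∸ a))
  else []
  where
  a = get α i
  b = get α (suc i)

∂ : ℕ → Poly → Poly
∂ i f = concatMap (ddTerm i) f

-- swap the entries at positions i, i+1 (0-based) of a one-line permutation:
-- this is w s_i
swapAdj : List ℕ → ℕ → List ℕ
swapAdj (a ∷ b ∷ r) zero    = b ∷ a ∷ r
swapAdj (a ∷ r)     (suc i) = a ∷ swapAdj r i
swapAdj w           _       = w

firstAscent : List ℕ → Maybe ℕ
firstAscent (a ∷ b ∷ r) = if a <ᵇ b then just 0 else Maybe.map suc (firstAscent (b ∷ r))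
firstAscent _           = nothing

-- Schubert polynomial by the recursive definition, always choosing the first
-- ascent i.  A permutation with no ascent is w₀, where S_{w₀} = x^(n-1,...,1,0).
-- The fuel argument only ensures termination; each step increases the number
-- of inversions by one, so n*n+1 steps always suffice.
schubertFuel : ℕ → (n : ℕ) → List ℕ → Poly
schubertFuel zero     n w = []
schubertFuel (suc f)  n w with firstAscent w
... | nothing = [ (downFrom n , + 1) ]
... | just i  = ∂ i (schubertFuel f n (swapAdj w i))

oneLine : {n : ℕ} → Permutation′ n → List ℕ
oneLine w = tabulate (λ i → suc (toℕ (w ⟨$⟩ʳ i)))

Schubert : {n : ℕ} → Permutation′ n → Poly
Schubert {n} w = schubertFuel (suc (n * n)) n (oneLine w)

coeff : List ℕ → Poly → ℤ
coeff α []              = + 0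
coeff α ((β , c) ∷ f)   = (if does (≡-dec ℕ._≟_ α β) then c else + 0) ℤ.+ coeff α f

countTrue : {A : Set} → (A → Bool) → List A → ℕ
countTrue p = foldr (λ x r → if p x then suc r else r) 0

numSupports : Poly → ℕ
numSupports f =
  countTrue (λ α → not (does (coeff α f ℤ.≟ + 0)))
            (deduplicate (≡-dec ℕ._≟_) (map proj₁ f))

θ : {n : ℕ} → Permutation′ n → ℕ
θ w = numSupports (Schubert w)

choose : ℕ → List ℕ → List (List ℕ)
choose zero    _        = [ [] ]
choose (suc k) []       = []
choose (suc k) (x ∷ xs) = map (x ∷_) (choose k xs) ++ choose (suc k) xs

sameOrder : List ℕ → List ℕ → Bool
sameOrder []       []       = true
sameOrder (a ∷ as) (b ∷ bs) =
  foldr (λ p r → (does ((a <ᵇ proj₁ p) Data.Bool.≟ (b <ᵇ proj₂ p))) ∧ r) true (zip as bs)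
  ∧ sameOrder as bs
sameOrder _        _        = false

patternCount : List ℕ → List ℕ → ℕ
patternCount u w = countTrue (sameOrder u) (choose (length u) w)

p : {n : ℕ} → List ℕ → Permutation′ n → ℕ
p u w = patternCount u (oneLine w)

-- Expanding one column of a pipe dream at a time, 𝔖_w becomes a sum F(w) of monomials with coefficient 1: for each column
-- the product of the factors 1 + x_a s_a, with s_a in the nilCoxeter algebra, is compatible with ∂_i by the Leibniz rule
-- and the braid relation.  So nothing cancels, and it suffices to exhibit pipe dreams.
--
-- Let D_c = {r < c : w_r > w_c} be the columns of the Rothe diagram.  For all sets C_c ≤ D_c (componentwise, with |C_c| = |D_c|)
-- the exponent Σ_c 1_{C_c} occurs.  Indeed the first row of a pipe dream can be chosen as follows: run through the values in
-- decreasing order; a column whose C_c has gained the first row must cross the last column f left in place, which removes f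
-- from D_c.  If this destroys C_c ≤ D_c, then C_c and C_f can exchange initial segments, which moves the gain to f.
--
-- Replacing j by i in s columns and l by k in t columns, with either i = k < j < l or i < j < k < l, yields the exponents
-- code(w) + s(e_i − e_j) + t(e_k − e_l).  They are pairwise distinct, and naming the last column used for each of the two
-- moves indexes them by pattern occurrences; 132 is the case of a single move.

module Submission where

open import Defs
open import Data.Nat using (ℕ; zero; suc; _+_; _*_; _∸_; _≤_; _<_; _≥_; _<ᵇ_; _≡ᵇ_; _≤ᵇ_; z≤n; s≤s; _≤?_; _≟_)
import Data.Nat as ℕ
import Data.Nat.Properties as ℕₚ
import Data.Nat.Tactic.RingSolver as ℕ-Ring
open import Data.Nat.ListAction using (sum)
open import Data.Integer as ℤ using (ℤ; -_) renaming (+_ to pos)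
import Data.Integer.Properties as ℤₚ
import Data.Integer.Tactic.RingSolver as ℤ-Ring
import Data.Fin.Properties as Finₚ
open import Data.Fin.Permutation using (Permutation′; _⟨$⟩ʳ_; _⟨$⟩ˡ_; inverseˡ)
open import Data.List using (List; []; _∷_; [_]; map; concatMap; upTo; applyUpTo; downFrom; length; _++_; replicate; deduplicate; filterᵇ)
open import Data.List.Properties using (++-assoc; ++-identityʳ; length-replicate; length-++; length-map; length-downFrom; length-tabulate; map-++; map-∘; map-id; map-cong; ∷-injectiveˡ; ∷-injectiveʳ; ≡-dec)
open import Data.List.Membership.Propositional using (_∈_; _∉_)
open import Data.List.Membership.Propositional.Properties using (∈-map⁺; ∈-map⁻; ∈-++⁺ˡ; ∈-++⁺ʳ; ∈-++⁻; ∈-∃++; ∈-tabulate⁻; ∈-deduplicate⁺; ∈-filter⁺)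
open import Data.List.Membership.DecPropositional _≟_ using (_∈?_)
open import Data.List.Relation.Unary.Any using (here; there)
open import Data.List.Relation.Unary.All as All using (All; []; _∷_)
import Data.List.Relation.Unary.All.Properties as All
open import Data.List.Relation.Unary.AllPairs as AllPairs using (AllPairs; []; _∷_)
import Data.List.Relation.Unary.AllPairs.Properties as AllPairs
open import Data.List.Relation.Unary.Linked using (Linked; []; [-]; _∷_)
open import Data.List.Relation.Unary.Linked.Properties using (Linked⇒AllPairs)
open import Data.List.Relation.Unary.Unique.Propositional using (Unique)
import Data.List.Relation.Unary.Unique.Propositional.Properties as Unique
open import Data.List.Relation.Binary.Permutation.Propositional using (_↭_; ↭-refl; ↭-sym; ↭-trans; prep; swap) renaming (refl to ↭refl)
open import Data.List.Relation.Binary.Permutation.Propositional.Properties using (∈-resp-↭; ↭-length; ↭-map-inv; ↭-empty-inv; drop-∷; ++⁺ˡ; ∷↭∷ʳ; shift)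
open import Data.Maybe using (Maybe; just; nothing)
import Data.Maybe as Maybe
open import Data.Bool using (Bool; true; false; if_then_else_; _∧_; not; T; T?)
import Data.Bool as Bool
open import Data.Bool.Properties using (∧-zeroʳ; ∧-identityʳ; T-≡)
open import Data.Product using (_×_; _,_; proj₁; proj₂; ∃)
open import Data.Sum using (_⊎_; inj₁; inj₂)
open import Data.Unit using (⊤; tt)
open import Data.Empty using (⊥; ⊥-elim)
open import Function using (_∘_; id; Equivalence)
open import Relation.Nullary using (¬_; yes; no; does)
open import Relation.Nullary.Decidable using (dec-true; dec-false)
open import Relation.Binary.Definitions using (tri<; tri≈; tri>)
open import Relation.Binary.PropositionalEquality using (_≡_; _≢_; _≗_; refl; sym; trans; cong; cong₂; subst; subst₂; module ≡-Reasoning)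

-- Polynomials as functionals on functions of the exponent

-- The algebra runs down columns, whereas fillings are built along rows. In a product over one
-- column `∂` is local: two adjacent rows interact and all others commute with it. The exchange
-- argument needs rows instead, because it settles the first entries of all columns together.
-- `rowStep` joins the two readings: a row acts on the inverse permutation as a column acts on the
-- permutation, so a row `Pass` can be threaded through the column passes. This is why `Pass` and
-- `Pipe` allow arbitrary letters, with an order given by a list. Polynomials are unnormalised sums,
-- so they are compared by testing them against all functions of the exponent. Divided differences
-- act on the test functions, and identities of polynomials become identities of integers. Two moves
-- into the same row are the delicate case in the count: a column containing both j and l could
-- serve either move. Reserving such columns for l makes the moves independent, and this decides
-- which columns may be named and so which patterns are counted. The coefficients of the five-letter
-- patterns come from comparing ten patterns with six conditions under all truth values of the
-- pairwise comparisons.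

⟨_,_⟩ : Poly → (List ℕ → ℤ) → ℤ
⟨ []          , φ ⟩ = pos 0
⟨ (α , c) ∷ f , φ ⟩ = c ℤ.* φ α ℤ.+ ⟨ f , φ ⟩

infix 4 _≈_
-- A record, so that `f` and `g` can be inferred from a proof; the pairing itself is not injective
-- for unification.
record _≈_ (f g : Poly) : Set where
  constructor mk
  field at : ∀ φ → ⟨ f , φ ⟩ ≡ ⟨ g , φ ⟩
open _≈_ public

≈-refl : ∀ {f} → f ≈ f
≈-refl .at φ = refl

≈-sym : ∀ {f g} → f ≈ g → g ≈ f
≈-sym e .at φ = sym (e .at φ)

≈-trans : ∀ {f g h} → f ≈ g → g ≈ h → f ≈ h
≈-trans e e′ .at φ = trans (e .at φ) (e′ .at φ)

≡⇒≈ : ∀ {f g} → f ≡ g → f ≈ g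
≡⇒≈ refl = ≈-refl

pair-++ : ∀ f g φ → ⟨ f ++ g , φ ⟩ ≡ ⟨ f , φ ⟩ ℤ.+ ⟨ g , φ ⟩
pair-++ []            g φ = sym (ℤₚ.+-identityˡ _)
pair-++ ((α , c) ∷ f) g φ = trans (cong (λ z → c ℤ.* φ α ℤ.+ z) (pair-++ f g φ)) (sym (ℤₚ.+-assoc (c ℤ.* φ α) ⟨ f , φ ⟩ ⟨ g , φ ⟩))

++-cong : ∀ {f f′ g g′} → f ≈ f′ → g ≈ g′ → f ++ g ≈ f′ ++ g′
++-cong {f} {f′} {g} {g′} e e′ .at φ = trans (pair-++ f g φ) (trans (cong₂ ℤ._+_ (e .at φ) (e′ .at φ)) (sym (pair-++ f′ g′ φ)))

pair-cong : ∀ (P : List ℕ → Set) f {φ ψ} → All (λ t → P (proj₁ t)) f → (∀ α → P α → φ α ≡ ψ α) → ⟨ f , φ ⟩ ≡ ⟨ f , ψ ⟩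
pair-cong P []            []       e = refl
pair-cong P ((α , c) ∷ f) (p ∷ ps) e = cong₂ (λ a b → c ℤ.* a ℤ.+ b) (e α p) (pair-cong P f ps e)

pair-ext : ∀ f {φ ψ} → φ ≗ ψ → ⟨ f , φ ⟩ ≡ ⟨ f , ψ ⟩
pair-ext []            e = refl
pair-ext ((α , c) ∷ f) e = cong₂ (λ a b → c ℤ.* a ℤ.+ b) (e α) (pair-ext f e)

pair-+ : ∀ f φ ψ → ⟨ f , (λ α → φ α ℤ.+ ψ α) ⟩ ≡ ⟨ f , φ ⟩ ℤ.+ ⟨ f , ψ ⟩
pair-+ []            φ ψ = refl
pair-+ ((α , c) ∷ f) φ ψ = trans (cong (λ z → c ℤ.* (φ α ℤ.+ ψ α) ℤ.+ z) (pair-+ f φ ψ)) (lem c (φ α) (ψ α) ⟨ f , φ ⟩ ⟨ f , ψ ⟩)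
  where
  lem : ∀ c a b x y → c ℤ.* (a ℤ.+ b) ℤ.+ (x ℤ.+ y) ≡ (c ℤ.* a ℤ.+ x) ℤ.+ (c ℤ.* b ℤ.+ y)
  lem = ℤ-Ring.solve-∀

pair-neg : ∀ f φ → ⟨ f , (λ α → - φ α) ⟩ ≡ - ⟨ f , φ ⟩
pair-neg []            φ = refl
pair-neg ((α , c) ∷ f) φ = trans (cong (λ z → c ℤ.* - φ α ℤ.+ z) (pair-neg f φ)) (lem c (φ α) ⟨ f , φ ⟩)
  where
  lem : ∀ c a x → c ℤ.* - a ℤ.+ - x ≡ - (c ℤ.* a ℤ.+ x)
  lem = ℤ-Ring.solve-∀

-- Divided differences

-- The adjoint of `∂ i`: by linearity it is determined by its values on single monomials.
∂* : ℕ → (List ℕ → ℤ) → List ℕ → ℤ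
∂* i φ α = ⟨ ddTerm i (α , pos 1) , φ ⟩

scale-map : ∀ (h : ℕ → List ℕ) c d ks φ → ⟨ map (λ k → (h k , c ℤ.* d)) ks , φ ⟩ ≡ c ℤ.* ⟨ map (λ k → (h k , d)) ks , φ ⟩
scale-map h c d []       φ = sym (ℤₚ.*-zeroʳ c)
scale-map h c d (k ∷ ks) φ = trans (cong (λ z → c ℤ.* d ℤ.* φ (h k) ℤ.+ z) (scale-map h c d ks φ)) (lem c d (φ (h k)) _)
  where
  lem : ∀ c d a x → c ℤ.* d ℤ.* a ℤ.+ c ℤ.* x ≡ c ℤ.* (d ℤ.* a ℤ.+ x)
  lem = ℤ-Ring.solve-∀

ddTerm-scale : ∀ i α c φ → ⟨ ddTerm i (α , c) , φ ⟩ ≡ c ℤ.* ∂* i φ α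
ddTerm-scale i α c φ with get α (suc i) <ᵇ get α i
... | true = trans (cong (λ d → ⟨ map (λ k → (_ , d)) (upTo (get α i ∸ get α (suc i))) , φ ⟩) (sym (ℤₚ.*-identityʳ c)))
  (scale-map _ c (pos 1) (upTo (get α i ∸ get α (suc i))) φ)
... | false with get α i <ᵇ get α (suc i)
...   | true = trans (cong (λ d → ⟨ map (λ k → (_ , d)) (upTo (get α (suc i) ∸ get α i)) , φ ⟩) (lem c))
  (scale-map _ c (- (pos 1)) (upTo (get α (suc i) ∸ get α i)) φ)
  where
  lem : ∀ c → - c ≡ c ℤ.* - (pos 1)
  lem = ℤ-Ring.solve-∀
...   | false = sym (ℤₚ.*-zeroʳ c)

pair-∂ : ∀ i f φ → ⟨ ∂ i f , φ ⟩ ≡ ⟨ f , ∂* i φ ⟩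
pair-∂ i []            φ = refl
pair-∂ i ((α , c) ∷ f) φ = trans (pair-++ (ddTerm i (α , c)) (∂ i f) φ) (cong₂ ℤ._+_ (ddTerm-scale i α c φ) (pair-∂ i f φ))

∂-cong : ∀ i {f g} → f ≈ g → ∂ i f ≈ ∂ i g
∂-cong i {f} {g} e .at φ = trans (pair-∂ i f φ) (trans (e .at (∂* i φ)) (sym (pair-∂ i g φ)))

∂-++ : ∀ i f g → ∂ i (f ++ g) ≈ ∂ i f ++ ∂ i g
∂-++ i f g .at φ = trans (pair-∂ i (f ++ g) φ) (trans (pair-++ f g _) (trans (sym (cong₂ ℤ._+_ (pair-∂ i f φ) (pair-∂ i g φ)))
  (sym (pair-++ (∂ i f) (∂ i g) φ))))

-- Σ_{k<m} ψ (p+k) (q+m-1-k)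
hs : (ℕ → ℕ → ℤ) → ℕ → ℕ → ℕ → ℤ
hs ψ zero    p q = pos 0
hs ψ (suc m) p q = ψ p (m + q) ℤ.+ hs ψ m (suc p) q

hs-last : ∀ ψ m p q → hs ψ (suc m) p q ≡ ψ (m + p) q ℤ.+ hs ψ m p (suc q)
hs-last ψ zero    p q = refl
hs-last ψ (suc m) p q = begin
  ψ p (suc m + q) ℤ.+ hs ψ (suc m) (suc p) q
    ≡⟨ cong (ℤ._+_ (ψ p (suc m + q))) (hs-last ψ m (suc p) q) ⟩
  ψ p (suc m + q) ℤ.+ (ψ (m + suc p) q ℤ.+ hs ψ m (suc p) (suc q))
    ≡⟨ lem (ψ p (suc m + q)) (ψ (m + suc p) q) (hs ψ m (suc p) (suc q)) ⟩
  ψ (m + suc p) q ℤ.+ (ψ p (suc m + q) ℤ.+ hs ψ m (suc p) (suc q))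
    ≡⟨ cong₂ (λ a b → ψ a q ℤ.+ (ψ p b ℤ.+ hs ψ m (suc p) (suc q))) (ℕₚ.+-suc m p) (sym (ℕₚ.+-suc m q)) ⟩
  ψ (suc m + p) q ℤ.+ (ψ p (m + suc q) ℤ.+ hs ψ m (suc p) (suc q)) ∎
  where
  open ≡-Reasoning
  lem : ∀ a b c → a ℤ.+ (b ℤ.+ c) ≡ b ℤ.+ (a ℤ.+ c)
  lem = ℤ-Ring.solve-∀

hs-sucʳ : ∀ ψ m p q → hs (λ a b → ψ a (suc b)) m p q ≡ hs ψ m p (suc q)
hs-sucʳ ψ zero    p q = refl
hs-sucʳ ψ (suc m) p q = cong₂ ℤ._+_ (cong (ψ p) (sym (ℕₚ.+-suc m q))) (hs-sucʳ ψ m (suc p) q)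

hs-sucˡ : ∀ ψ m p q → hs (λ a b → ψ (suc a) b) m p q ≡ hs ψ m (suc p) q
hs-sucˡ ψ zero    p q = refl
hs-sucˡ ψ (suc m) p q = cong (ℤ._+_ (ψ (suc p) (m + q))) (hs-sucˡ ψ m (suc p) q)

-- The divided difference of the monomial with exponents a, b, tested against `ψ`. The last clause
-- takes out the symmetric factor xy, which commutes with the divided difference.
dd2 : (ℕ → ℕ → ℤ) → ℕ → ℕ → ℤ
dd2 ψ zero    b       = - hs ψ b 0 0
dd2 ψ (suc a) zero    = hs ψ (suc a) 0 0
dd2 ψ (suc a) (suc b) = dd2 (λ p q → ψ (suc p) (suc q)) a b

-- The enumeration `g` is arbitrary because unfolding `upTo` composes it with `suc` at every step.
pair-applyUpTo : ∀ (h : ℕ → List ℕ) d φ ψ m p q (g : ℕ → ℕ) →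
  (∀ k → k < m → φ (h (g k)) ≡ ψ (k + p) (m ∸ suc k + q)) →
  ⟨ map (λ k → (h k , d)) (applyUpTo g m) , φ ⟩ ≡ d ℤ.* hs ψ m p q
pair-applyUpTo h d φ ψ zero    p q g e = sym (ℤₚ.*-zeroʳ d)
pair-applyUpTo h d φ ψ (suc m) p q g e = trans
  (cong₂ (λ a b → d ℤ.* a ℤ.+ b) (e 0 (s≤s z≤n))
    (pair-applyUpTo h d φ ψ m (suc p) q (g ∘ suc) λ k k<m → trans (e (suc k) (s≤s k<m))
      (cong (λ a → ψ a (m ∸ suc k + q)) (sym (ℕₚ.+-suc k p)))))
  (sym (ℤₚ.*-distribˡ-+ d (ψ p (m + q)) (hs ψ m (suc p) q)))

<ᵇ-true : ∀ {a b} → a < b → (a <ᵇ b) ≡ true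
<ᵇ-true {a} {b} lt with a <ᵇ b in eq
... | true  = refl
... | false = ⊥-elim (subst T eq (ℕₚ.<⇒<ᵇ lt))

<ᵇ-false : ∀ {a b} → ¬ a < b → (a <ᵇ b) ≡ false
<ᵇ-false {a} {b} nlt with a <ᵇ b in eq
... | true  = ⊥-elim (nlt (ℕₚ.<ᵇ⇒< a b (subst T (sym eq) _)))
... | false = refl

<ᵇ⇒ : ∀ {a b} → (a <ᵇ b) ≡ true → a < b
<ᵇ⇒ {a} {b} e = ℕₚ.<ᵇ⇒< a b (subst T (sym e) _)

dd2-> : ∀ ψ m b → dd2 ψ (suc m + b) b ≡ hs ψ (suc m) b b
dd2-> ψ m zero    = trans (cong (λ x → dd2 ψ x 0) (ℕₚ.+-identityʳ (suc m))) refl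
dd2-> ψ m (suc b) = trans (cong (λ x → dd2 ψ x (suc b)) (ℕₚ.+-suc (suc m) b))
  (trans (dd2-> _ m b) (trans (hs-sucˡ (λ a b → ψ a (suc b)) (suc m) b b) (hs-sucʳ ψ (suc m) (suc b) b)))

dd2-≤ : ∀ ψ m a → dd2 ψ a (m + a) ≡ - hs ψ m a a
dd2-≤ ψ m zero    = cong (λ x → - hs ψ x 0 0) (ℕₚ.+-identityʳ m)
dd2-≤ ψ m (suc a) = trans (cong (dd2 ψ (suc a)) (ℕₚ.+-suc m a))
  (trans (dd2-≤ _ m a) (cong -_ (trans (hs-sucˡ (λ a b → ψ a (suc b)) m a a) (hs-sucʳ ψ m (suc a) a))))

data Cmp : ℕ → ℕ → Set where
  exceeds : ∀ m b → Cmp (suc m + b) b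
  atMost  : ∀ m a → Cmp a (m + a)

cmp : ∀ a b → Cmp a b
cmp a b with ℕₚ.<-≤-connex b a
... | inj₁ b<a = subst (λ x → Cmp x b) (trans (sym (ℕₚ.+-suc (a ∸ suc b) b)) (ℕₚ.m∸n+n≡m b<a)) (exceeds (a ∸ suc b) b)
... | inj₂ a≤b = subst (Cmp a) (ℕₚ.m∸n+n≡m a≤b) (atMost (b ∸ a) a)

∂*-zero : ∀ φ x y r → ∂* 0 φ (x ∷ y ∷ r) ≡ dd2 (λ p q → φ (p ∷ q ∷ r)) x y
∂*-zero φ x y r with cmp x y
... | exceeds m .y rewrite <ᵇ-true {y} {suc m + y} (ℕₚ.m<n+m y (s≤s z≤n)) | ℕₚ.m+n∸n≡m (suc m) y = trans
   (pair-applyUpTo (λ k → (y + k) ∷ ((m + y) ∸ k) ∷ r) (pos 1) φ (λ p q → φ (p ∷ q ∷ r)) (suc m) y y id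
     (λ k k≤m → cong₂ (λ a b → φ (a ∷ b ∷ r)) (ℕₚ.+-comm y k) (ℕₚ.+-∸-comm y (ℕₚ.≤-pred k≤m))))
   (trans (ℤₚ.*-identityˡ _) (sym (dd2-> _ m y)))
... | atMost zero .x rewrite <ᵇ-false {x} {x} (ℕₚ.<-irrefl refl) = sym (dd2-≤ _ 0 x)
... | atMost (suc m) .x rewrite <ᵇ-false {suc m + x} {x} (ℕₚ.≤⇒≯ (ℕₚ.m≤n+m x (suc m))) | <ᵇ-true {x} {suc m + x}
  (ℕₚ.m<n+m x (s≤s z≤n)) | ℕₚ.m+n∸n≡m (suc m) x = trans
   (pair-applyUpTo (λ k → (x + k) ∷ ((m + x) ∸ k) ∷ r) (- (pos 1)) φ (λ p q → φ (p ∷ q ∷ r)) (suc m) x x id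
     (λ k k≤m → cong₂ (λ a b → φ (a ∷ b ∷ r)) (ℕₚ.+-comm x k) (ℕₚ.+-∸-comm x (ℕₚ.≤-pred k≤m))))
   (trans (ℤₚ.-1*i≡-i _) (sym (dd2-≤ _ (suc m) x)))

map-cons-ddTerm : ∀ (h : ℕ → List ℕ) x d ks φ → ⟨ map (λ k → (x ∷ h k , d)) ks , φ ⟩ ≡ ⟨ map (λ k → (h k , d)) ks , φ ∘ (x ∷_) ⟩
map-cons-ddTerm h x d []       φ = refl
map-cons-ddTerm h x d (k ∷ ks) φ = cong (λ z → d ℤ.* φ (x ∷ h k) ℤ.+ z) (map-cons-ddTerm h x d ks φ)

∂*-suc : ∀ i φ x α → ∂* (suc i) φ (x ∷ α) ≡ ∂* i (φ ∘ (x ∷_)) α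
∂*-suc i φ x α with get α (suc i) <ᵇ get α i
... | true = map-cons-ddTerm _ x (pos 1) (upTo (get α i ∸ get α (suc i))) φ
... | false with get α i <ᵇ get α (suc i)
...   | true  = map-cons-ddTerm _ x (- (pos 1)) (upTo (get α (suc i) ∸ get α i)) φ
...   | false = refl

-- Multiplication by a variable and the Leibniz rules

inc : ℕ → List ℕ → List ℕ
inc k α = set α k (suc (get α k))

-- The rule ∂(x f) = f + y ∂f on a monomial f; on test functions, a `suc` in an argument is
-- multiplication by that variable. Both sides are homogeneous sums that differ by one term at an
-- end, and the sign depends on which exponent is larger.
dd2-leibnizˡ : ∀ ψ a b → dd2 ψ (suc a) b ≡ ψ a b ℤ.+ dd2 (λ p q → ψ p (suc q)) a b
dd2-leibnizˡ ψ a b with cmp a b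
... | exceeds m .b = begin
  dd2 ψ (suc (suc m) + b) b                    ≡⟨ dd2-> ψ (suc m) b ⟩
  hs ψ (suc (suc m)) b b                       ≡⟨ hs-last ψ (suc m) b b ⟩
  ψ (suc m + b) b ℤ.+ hs ψ (suc m) b (suc b)   ≡⟨ cong (ℤ._+_ (ψ (suc m + b) b))
    (sym (trans (dd2-> (λ p q → ψ p (suc q)) m b) (hs-sucʳ ψ (suc m) b b))) ⟩
  ψ (suc m + b) b ℤ.+ dd2 (λ p q → ψ p (suc q)) (suc m + b) b ∎
  where open ≡-Reasoning
... | atMost zero .a = trans (dd2-> ψ 0 a) (cong (ℤ._+_ (ψ a a)) (sym (dd2-≤ (λ p q → ψ p (suc q)) 0 a)))
... | atMost (suc m) .a = begin
  dd2 ψ (suc a) (suc m + a)                    ≡⟨ cong (dd2 ψ (suc a)) (sym (ℕₚ.+-suc m a)) ⟩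
  dd2 ψ (suc a) (m + suc a)                    ≡⟨ dd2-≤ ψ m (suc a) ⟩
  - hs ψ m (suc a) (suc a)                     ≡⟨ lem (ψ a (m + suc a)) (hs ψ m (suc a) (suc a)) ⟩
  ψ a (m + suc a) ℤ.+ - hs ψ (suc m) a (suc a) ≡⟨ cong₂ (λ x y → ψ a x ℤ.+ - y) (ℕₚ.+-suc m a) (sym (hs-sucʳ ψ (suc m) a a)) ⟩
  ψ a (suc m + a) ℤ.+ - hs (λ p q → ψ p (suc q)) (suc m) a a ≡⟨ cong (ℤ._+_ (ψ a (suc m + a)))
    (sym (dd2-≤ (λ p q → ψ p (suc q)) (suc m) a)) ⟩
  ψ a (suc m + a) ℤ.+ dd2 (λ p q → ψ p (suc q)) a (suc m + a) ∎
  where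
  open ≡-Reasoning
  lem : ∀ x y → - y ≡ x ℤ.+ - (x ℤ.+ y)
  lem = ℤ-Ring.solve-∀

dd2-leibnizʳ : ∀ ψ a b → dd2 ψ a (suc b) ≡ - ψ a b ℤ.+ dd2 (λ p q → ψ (suc p) q) a b
dd2-leibnizʳ ψ a b with cmp a b
... | exceeds m .b = begin
  dd2 ψ (suc m + b) (suc b)  ≡⟨ aux m ⟩
  hs ψ m (suc b) (suc b)     ≡⟨ lem (ψ (m + suc b) b) (hs ψ m (suc b) (suc b)) ⟩
  - ψ (m + suc b) b ℤ.+ (ψ (m + suc b) b ℤ.+ hs ψ m (suc b) (suc b)) ≡⟨ cong₂ (λ x y → - ψ x b ℤ.+ y) (ℕₚ.+-suc m b)
    (sym (hs-last ψ m (suc b) b)) ⟩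
  - ψ (suc m + b) b ℤ.+ hs ψ (suc m) (suc b) b ≡⟨ cong (ℤ._+_ (- ψ (suc m + b) b))
    (sym (trans (dd2-> (λ p q → ψ (suc p) q) m b) (hs-sucˡ ψ (suc m) b b))) ⟩
  - ψ (suc m + b) b ℤ.+ dd2 (λ p q → ψ (suc p) q) (suc m + b) b ∎
  where
  open ≡-Reasoning
  lem : ∀ x y → y ≡ - x ℤ.+ (x ℤ.+ y)
  lem = ℤ-Ring.solve-∀
  aux : ∀ m → dd2 ψ (suc m + b) (suc b) ≡ hs ψ m (suc b) (suc b)
  aux zero     = dd2-≤ ψ 0 (suc b)
  aux (suc m′) = trans (cong (λ x → dd2 ψ x (suc b)) (sym (ℕₚ.+-suc (suc m′) b))) (dd2-> ψ m′ (suc b))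
... | atMost m .a = begin
  dd2 ψ a (suc m + a)   ≡⟨ dd2-≤ ψ (suc m) a ⟩
  - (ψ a (m + a) ℤ.+ hs ψ m (suc a) a)  ≡⟨ ℤₚ.neg-distrib-+ (ψ a (m + a)) _ ⟩
  - ψ a (m + a) ℤ.+ - hs ψ m (suc a) a  ≡⟨ cong (ℤ._+_ (- ψ a (m + a)))
    (sym (trans (dd2-≤ (λ p q → ψ (suc p) q) m a) (cong -_ (hs-sucˡ ψ m a a)))) ⟩
  - ψ a (m + a) ℤ.+ dd2 (λ p q → ψ (suc p) q) a (m + a) ∎
  where open ≡-Reasoning

∂*-leibnizˡ : ∀ i φ α → suc i < length α → ∂* i φ (inc i α) ≡ φ α ℤ.+ ∂* i (φ ∘ inc (suc i)) α
∂*-leibnizˡ zero    φ (x ∷ y ∷ r) lt = trans (∂*-zero φ (suc x) y r)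
  (trans (dd2-leibnizˡ _ x y) (cong (ℤ._+_ (φ (x ∷ y ∷ r))) (sym (∂*-zero (φ ∘ inc 1) x y r))))
∂*-leibnizˡ zero    φ (x ∷ []) (s≤s ())
∂*-leibnizˡ (suc i) φ (x ∷ α) (s≤s lt) = trans (∂*-suc i φ x (inc i α)) (trans (∂*-leibnizˡ i (φ ∘ (x ∷_)) α lt)
  (cong (ℤ._+_ (φ (x ∷ α))) (sym (∂*-suc i (φ ∘ inc (suc (suc i))) x α))))

∂*-leibnizʳ : ∀ i φ α → suc i < length α → ∂* i φ (inc (suc i) α) ≡ - φ α ℤ.+ ∂* i (φ ∘ inc i) α
∂*-leibnizʳ zero    φ (x ∷ y ∷ r) lt = trans (∂*-zero φ x (suc y) r)
  (trans (dd2-leibnizʳ _ x y) (cong (ℤ._+_ (- φ (x ∷ y ∷ r))) (sym (∂*-zero (φ ∘ inc 0) x y r))))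
∂*-leibnizʳ zero    φ (x ∷ []) (s≤s ())
∂*-leibnizʳ (suc i) φ (x ∷ α) (s≤s lt) = trans (∂*-suc i φ x (inc (suc i) α)) (trans (∂*-leibnizʳ i (φ ∘ (x ∷_)) α lt)
  (cong (ℤ._+_ (- φ (x ∷ α))) (sym (∂*-suc i (φ ∘ inc (suc i)) x α))))

∂*-inc : ∀ i k φ α → suc i < length α → k < i ⊎ suc i < k → ∂* i φ (inc k α) ≡ ∂* i (φ ∘ inc k) α
∂*-inc zero    (suc zero)    φ (x ∷ y ∷ r) lt (inj₂ (s≤s ()))
∂*-inc zero    (suc (suc k)) φ (x ∷ y ∷ r) lt _ = trans (∂*-zero φ x y (inc k r)) (sym (∂*-zero (φ ∘ inc (suc (suc k))) x y r))
∂*-inc zero    zero φ (x ∷ y ∷ r) lt (inj₁ ())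
∂*-inc zero    zero φ (x ∷ y ∷ r) lt (inj₂ ())
∂*-inc zero    k φ (x ∷ []) (s≤s ()) _
∂*-inc (suc i) zero    φ (x ∷ α) (s≤s lt) _ = trans (∂*-suc i φ (suc x) α) (sym (∂*-suc i (φ ∘ inc 0) x α))
∂*-inc (suc i) (suc k) φ (x ∷ α) (s≤s lt) d = trans (∂*-suc i φ x (inc k α)) (trans (∂*-inc i k (φ ∘ (x ∷_)) α lt (down d))
  (sym (∂*-suc i (φ ∘ inc (suc k)) x α)))
  where
  down : suc k < suc i ⊎ suc (suc i) < suc k → k < i ⊎ suc i < k
  down (inj₁ (s≤s p)) = inj₁ p
  down (inj₂ (s≤s p)) = inj₂ p

length-inc : ∀ k α → length (inc k α) ≡ length α
length-inc k α = go k α (suc (get α k))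
  where
  go : ∀ k α v → length (set α k v) ≡ length α
  go k       []      v = refl
  go zero    (x ∷ α) v = refl
  go (suc k) (x ∷ α) v = cong suc (go k α v)

inc-comm : ∀ j k α → inc j (inc k α) ≡ inc k (inc j α)
inc-comm zero    zero    α       = refl
inc-comm j       k       []      = refl
inc-comm zero    (suc k) (x ∷ α) = refl
inc-comm (suc j) zero    (x ∷ α) = refl
inc-comm (suc j) (suc k) (x ∷ α) = cong (x ∷_) (inc-comm j k α)

X : ℕ → Poly → Poly
X k = map (λ t → (inc k (proj₁ t) , proj₂ t))

pair-X : ∀ k f φ → ⟨ X k f , φ ⟩ ≡ ⟨ f , φ ∘ inc k ⟩
pair-X k []            φ = refl
pair-X k ((α , c) ∷ f) φ = cong (λ z → c ℤ.* φ (inc k α) ℤ.+ z) (pair-X k f φ)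

X-cong : ∀ k {f g} → f ≈ g → X k f ≈ X k g
X-cong k {f} {g} e .at φ = trans (pair-X k f φ) (trans (e .at _) (sym (pair-X k g φ)))

X-++ : ∀ k f g → X k (f ++ g) ≈ X k f ++ X k g
X-++ k f g .at φ = trans (pair-X k (f ++ g) φ) (trans (pair-++ f g _) (trans (sym (cong₂ ℤ._+_ (pair-X k f φ) (pair-X k g φ)))
  (sym (pair-++ (X k f) (X k g) φ))))

-- `inc k` does nothing beyond the end of an exponent list, so the Leibniz rules hold only when
-- every exponent reaches the variables concerned.
HasLen : ℕ → Poly → Set
HasLen N f = All (λ t → length (proj₁ t) ≡ N) f

X-HasLen : ∀ {N} k {f} → HasLen N f → HasLen N (X k f)
X-HasLen k []       = []
X-HasLen k (_∷_ {x = α , _} p ps) = trans (length-inc k α) p ∷ X-HasLen k ps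

module _ {N i : ℕ} (i<N : suc i < N) {f : Poly} (hl : HasLen N f) where
  private
    lt : ∀ (α : List ℕ) → length α ≡ N → suc i < length α
    lt α e = subst (suc i <_) (sym e) i<N

  ∂-leibnizˡ : ∀ φ → ⟨ ∂ i (X i f) , φ ⟩ ≡ ⟨ f , φ ⟩ ℤ.+ ⟨ ∂ i f , φ ∘ inc (suc i) ⟩
  ∂-leibnizˡ φ = trans (pair-∂ i (X i f) φ)
    (trans (pair-X i f _) (trans (pair-cong (λ α → length α ≡ N) f hl (λ α e → ∂*-leibnizˡ i φ α (lt α e)))
    (trans (pair-+ f φ _) (cong (ℤ._+_ ⟨ f , φ ⟩) (sym (pair-∂ i f _))))))

  ∂-leibnizʳ : ∀ φ → ⟨ ∂ i (X (suc i) f) , φ ⟩ ≡ - ⟨ f , φ ⟩ ℤ.+ ⟨ ∂ i f , φ ∘ inc i ⟩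
  ∂-leibnizʳ φ = trans (pair-∂ i (X (suc i) f) φ)
    (trans (pair-X (suc i) f _) (trans (pair-cong (λ α → length α ≡ N) f hl (λ α e → ∂*-leibnizʳ i φ α (lt α e)))
    (trans (pair-+ f (λ α → - φ α) _) (cong₂ ℤ._+_ (pair-neg f φ) (sym (pair-∂ i f _))))))

  ∂-X : ∀ k → k < i ⊎ suc i < k → ∂ i (X k f) ≈ X k (∂ i f)
  ∂-X k d .at φ = trans (pair-∂ i (X k f) φ)
    (trans (pair-X k f _) (trans (pair-cong (λ α → length α ≡ N) f hl (λ α e → ∂*-inc i k φ α (lt α e) d))
    (trans (sym (pair-∂ i f _)) (sym (pair-X k (∂ i f) φ)))))

-- Expansion along columns

-- Right multiplication by s_i in the nilCoxeter algebra, acting on functions of w.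
D : ℕ → (List ℕ → Poly) → List ℕ → Poly
D zero    Φ (a ∷ b ∷ r) = if b <ᵇ a then Φ (b ∷ a ∷ r) else []
D zero    Φ _           = []
D (suc i) Φ (a ∷ r)     = D i (λ r′ → Φ (a ∷ r′)) r
D (suc i) Φ []          = []

-- The factor 1 + x_k s of row k: the two leading entries stay, or they are crossed at the cost of
-- x_k.
bump : ℕ → (List ℕ → Poly) → ℕ → List ℕ → Poly
bump k Φ a r = Φ (a ∷ r) ++ X k (D 0 Φ (a ∷ r))

-- Each entry is absorbed into `Φ` before the rest is read, so the bottom row acts on the word first
-- and the top row last.
pass : ℕ → (List ℕ → Poly) → List ℕ → Poly
pass k Φ []      = Φ []
pass k Φ (a ∷ r) = pass (suc k) (bump k Φ a) r

strip : ℕ → (List ℕ → Poly) → List ℕ → Poly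
strip c Φ []      = []
strip c Φ (a ∷ r) = if a ≡ᵇ c then Φ r else []

-- `N` is the number of variables, `m` the number of columns left and `c` the least remaining value.
-- A column contributes only when it carries `c` to the front, where `c` is deleted.
F : ℕ → ℕ → ℕ → List ℕ → Poly
F N zero    c []      = [ (replicate N 0 , pos 1) ]
F N zero    c (_ ∷ _) = []
F N (suc m) c w       = pass 0 (strip c (F N m (suc c))) w

D-cong : ∀ i {Φ Ψ} w → (∀ z → Φ z ≈ Ψ z) → D i Φ w ≈ D i Ψ w
D-cong zero    []          e = ≈-refl
D-cong zero    (a ∷ [])    e = ≈-refl
D-cong zero    (a ∷ b ∷ r) e with b <ᵇ a
... | true  = e (b ∷ a ∷ r)
... | false = ≈-refl
D-cong (suc i) []          e = ≈-refl
D-cong (suc i) (a ∷ r)     e = D-cong i r (e ∘ (a ∷_))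

bump-cong : ∀ k {Φ Ψ} a r → (∀ z → Φ z ≈ Ψ z) → bump k Φ a r ≈ bump k Ψ a r
bump-cong k a r e = ++-cong (e (a ∷ r)) (X-cong k (D-cong 0 (a ∷ r) e))

pass-cong : ∀ k {Φ Ψ} w → (∀ z → Φ z ≈ Ψ z) → pass k Φ w ≈ pass k Ψ w
pass-cong k []      e = e []
pass-cong k (a ∷ r) e = pass-cong (suc k) r (λ z → bump-cong k a z e)

pass-[] : ∀ k w → pass k (λ _ → []) w ≈ []
pass-[] k []      = ≈-refl
pass-[] k (a ∷ r) = ≈-trans (pass-cong (suc k) r lem) (pass-[] (suc k) r)
  where
  lem : ∀ z → bump k (λ _ → []) a z ≈ []
  lem []      = ≈-refl
  lem (b ∷ z) with b <ᵇ a
  ... | true  = ≈-refl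
  ... | false = ≈-refl

D-All : ∀ {P : List ℕ × ℤ → Set} i {Φ} w → (∀ z → All P (Φ z)) → All P (D i Φ w)
D-All zero    []          h = []
D-All zero    (a ∷ [])    h = []
D-All zero    (a ∷ b ∷ r) h with b <ᵇ a
... | true  = h (b ∷ a ∷ r)
... | false = []
D-All (suc i) []          h = []
D-All (suc i) (a ∷ r)     h = D-All i r (h ∘ (a ∷_))

Monic : ℕ → Poly → Set
Monic N = All (λ t → length (proj₁ t) ≡ N × proj₂ t ≡ pos 1)

Monic⇒HasLen : ∀ {N f} → Monic N f → HasLen N f
Monic⇒HasLen = All.map proj₁

X-Monic : ∀ {N} k {f} → Monic N f → Monic N (X k f)
X-Monic k []       = []
X-Monic k (_∷_ {x = α , _} (p , q) ps) = (trans (length-inc k α) p , q) ∷ X-Monic k ps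

bump-Monic : ∀ {N} k {Φ} a r → (∀ z → Monic N (Φ z)) → Monic N (bump k Φ a r)
bump-Monic k a r h = All.++⁺ (h (a ∷ r)) (X-Monic k (D-All 0 (a ∷ r) h))

pass-Monic : ∀ {N} k {Φ} w → (∀ z → Monic N (Φ z)) → Monic N (pass k Φ w)
pass-Monic k []      h = h []
pass-Monic k (a ∷ r) h = pass-Monic (suc k) r (λ z → bump-Monic k a z h)

strip-Monic : ∀ {N} c {Φ} w → (∀ z → Monic N (Φ z)) → Monic N (strip c Φ w)
strip-Monic c []      h = []
strip-Monic c (a ∷ r) h with a ≡ᵇ c
... | true  = h r
... | false = []

F-Monic : ∀ N m c w → Monic N (F N m c w)
F-Monic N zero    c []      = (length-replicate N , refl) ∷ []
F-Monic N zero    c (_ ∷ _) = []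
F-Monic N (suc m) c w       = pass-Monic 0 w (λ z → strip-Monic c z (F-Monic N m (suc c)))

-- The rows from `k` on multiply only by variables beyond x_{i+1}, which are constants for `∂ i`.
pass-∂ : ∀ {N} i k {Φ} w → suc i < N → suc i < k → (∀ z → Monic N (Φ z)) → ∂ i (pass k Φ w) ≈ pass k (∂ i ∘ Φ) w
pass-∂ i k {Φ} [] i<N i<k h = ≈-refl {∂ i (Φ [])}
pass-∂ i k {Φ} (a ∷ r) i<N i<k h = ≈-trans
  (pass-∂ i (suc k) r i<N (ℕₚ.m≤n⇒m≤1+n i<k) (λ z → bump-Monic k a z h)) (pass-cong (suc k) r lem)
  where
  lem′ : ∀ z → ∂ i (X k (D 0 Φ (a ∷ z))) ≈ X k (D 0 (∂ i ∘ Φ) (a ∷ z))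
  lem′ []      = ≈-refl
  lem′ (b ∷ z) with b <ᵇ a
  ... | true  = ∂-X i<N (Monic⇒HasLen (h (b ∷ a ∷ z))) k (inj₂ i<k)
  ... | false = ≈-refl
  lem : ∀ z → ∂ i (bump k Φ a z) ≈ bump k (∂ i ∘ Φ) a z
  lem z = ≈-trans (∂-++ i (Φ (a ∷ z)) (X k (D 0 Φ (a ∷ z)))) (++-cong ≈-refl (lem′ z))

D-bump : ∀ i k Φ Ψ z → D i (λ r → Φ r ++ X k (Ψ r)) z ≡ D i Φ z ++ X k (D i Ψ z)
D-bump zero    k Φ Ψ []          = refl
D-bump zero    k Φ Ψ (a ∷ [])    = refl
D-bump zero    k Φ Ψ (a ∷ b ∷ r) with b <ᵇ a
... | true  = refl
... | false = refl
D-bump (suc i) k Φ Ψ []      = refl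
D-bump (suc i) k Φ Ψ (a ∷ r) = D-bump i k _ _ r

D-if : ∀ i (b : Bool) Φ z → (if b then D i Φ z else []) ≡ D i (λ r → if b then Φ r else []) z
D-if i true  Φ z = refl
D-if zero    false Φ []          = refl
D-if zero    false Φ (a ∷ [])    = refl
D-if zero    false Φ (a ∷ b ∷ r) with b <ᵇ a
... | true  = refl
... | false = refl
D-if (suc i) false Φ []          = refl
D-if (suc i) false Φ (a ∷ r)     = D-if i false (λ y → Φ (a ∷ y)) r

-- The rows k and k+1 of one column: by the Leibniz rule, nilpotency and the braid relation, ∂_k of the sum over w is the sum over w s_k.
module TwoRows {N k : ℕ} (k<N : suc k < N) (Φ : List ℕ → Poly) (h : ∀ z → Monic N (Φ z)) (hyp : ∀ z → ∂ k (Φ z) ≈ D 1 Φ z) where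

  Two : ℕ → ℕ → List ℕ → Poly
  Two a b = bump (suc k) (bump k Φ a) b

  ite : Bool → ℤ → ℤ
  ite b x = if b then x else pos 0

  pair-if : ∀ b f φ → ⟨ (if b then f else []) , φ ⟩ ≡ ite b ⟨ f , φ ⟩
  pair-if true  f φ = refl
  pair-if false f φ = refl

  algebra₀ : ∀ p x → (pos 0 ℤ.+ ite p (x ℤ.+ pos 0)) ℤ.+ pos 0 ≡ ite p ((x ℤ.+ pos 0) ℤ.+ pos 0)
  algebra₀ true  x = lem x
    where
    lem : ∀ x → (pos 0 ℤ.+ (x ℤ.+ pos 0)) ℤ.+ pos 0 ≡ (x ℤ.+ pos 0) ℤ.+ pos 0
    lem = ℤ-Ring.solve-∀
  algebra₀ false x = refl

  -- Here `p`, `q`, `s` stand for b < a, c < b, c < a with a, b, c consecutive entries. The terms x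
  -- cancel between the two Leibniz rules; the term u, the full reversal, is reached from both
  -- sides, which is the braid relation. The identity holds for every choice of truth values, so
  -- transitivity need not be invoked.
  algebra : ∀ p q s x y z u →
    (ite q x ℤ.+ ite p (y ℤ.+ ite s z)) ℤ.+ ite q (- x ℤ.+ ite s (ite p u)) ≡
    ite p ((y ℤ.+ pos 0) ℤ.+ ite s (z ℤ.+ ite q u))
  algebra true  true  true  = lem
    where
    lem : ∀ x y z u → (x ℤ.+ (y ℤ.+ z)) ℤ.+ (- x ℤ.+ u) ≡ (y ℤ.+ pos 0) ℤ.+ (z ℤ.+ u)
    lem = ℤ-Ring.solve-∀
  algebra true  true  false = lem
    where
    lem : ∀ x y z u → (x ℤ.+ (y ℤ.+ pos 0)) ℤ.+ (- x ℤ.+ pos 0) ≡ (y ℤ.+ pos 0) ℤ.+ pos 0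
    lem = ℤ-Ring.solve-∀
  algebra true  false true  = lem
    where
    lem : ∀ x y z u → (pos 0 ℤ.+ (y ℤ.+ z)) ℤ.+ pos 0 ≡ (y ℤ.+ pos 0) ℤ.+ (z ℤ.+ pos 0)
    lem = ℤ-Ring.solve-∀
  algebra true  false false = lem
    where
    lem : ∀ x y z u → (pos 0 ℤ.+ (y ℤ.+ pos 0)) ℤ.+ pos 0 ≡ (y ℤ.+ pos 0) ℤ.+ pos 0
    lem = ℤ-Ring.solve-∀
  algebra false true  true  = lem
    where
    lem : ∀ x y z u → (x ℤ.+ pos 0) ℤ.+ (- x ℤ.+ pos 0) ≡ pos 0
    lem = ℤ-Ring.solve-∀
  algebra false true  false = lem
    where
    lem : ∀ x y z u → (x ℤ.+ pos 0) ℤ.+ (- x ℤ.+ pos 0) ≡ pos 0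
    lem = ℤ-Ring.solve-∀
  algebra false false s x y z u = refl

  -- Nilpotency: entries that have just been crossed form an ascent, and crossing them again gives
  -- zero.
  ∂∅ : ∀ a b c r → (b <ᵇ c) ≡ true → ∀ φ → ⟨ ∂ k (Φ (a ∷ b ∷ c ∷ r)) , φ ⟩ ≡ pos 0
  ∂∅ a b c r e φ = trans (hyp (a ∷ b ∷ c ∷ r) .at φ) (cong (λ x → ⟨ (if x then Φ (a ∷ c ∷ b ∷ r) else []) , φ ⟩)
    (<ᵇ-false (ℕₚ.<⇒≯ (<ᵇ⇒ {b} {c} e))))

  ∂Φ : ∀ a b c r φ → ⟨ ∂ k (Φ (a ∷ b ∷ c ∷ r)) , φ ⟩ ≡ ite (c <ᵇ b) ⟨ Φ (a ∷ c ∷ b ∷ r) , φ ⟩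
  ∂Φ a b c r φ = trans (hyp (a ∷ b ∷ c ∷ r) .at φ) (pair-if (c <ᵇ b) (Φ (a ∷ c ∷ b ∷ r)) φ)

  ∂XΦ : ∀ a b c r φ → ⟨ ∂ k (X k (D 0 Φ (a ∷ b ∷ c ∷ r))) , φ ⟩ ≡
        ite (b <ᵇ a) (⟨ Φ (b ∷ a ∷ c ∷ r) , φ ⟩ ℤ.+ ite (c <ᵇ a) ⟨ Φ (b ∷ c ∷ a ∷ r) , φ ∘ inc (suc k) ⟩)
  ∂XΦ a b c r φ with b <ᵇ a
  ... | true  = trans (∂-leibnizˡ k<N (Monic⇒HasLen (h (b ∷ a ∷ c ∷ r))) φ) (cong (ℤ._+_ ⟨ Φ (b ∷ a ∷ c ∷ r) , φ ⟩) (∂Φ b a c r _))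
  ... | false = refl

  -- The product x_k x_{k+1} is symmetric, so the corrections from the two Leibniz rules cancel.
  ∂XX : ∀ {f} → HasLen N f → ∀ φ → ⟨ ∂ k (X (suc k) (X k f)) , φ ⟩ ≡ ⟨ ∂ k f , φ ∘ inc (suc k) ∘ inc k ⟩
  ∂XX {f} l φ = begin
    ⟨ ∂ k (X (suc k) (X k f)) , φ ⟩
      ≡⟨ ∂-leibnizʳ k<N (X-HasLen k l) φ ⟩
    - ⟨ X k f , φ ⟩ ℤ.+ ⟨ ∂ k (X k f) , φ ∘ inc k ⟩
      ≡⟨ cong₂ (λ x y → - x ℤ.+ y) (pair-X k f φ) (∂-leibnizˡ k<N l _) ⟩
    - ⟨ f , φ ∘ inc k ⟩ ℤ.+ (⟨ f , φ ∘ inc k ⟩ ℤ.+ ⟨ ∂ k f , φ ∘ inc k ∘ inc (suc k) ⟩)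
      ≡⟨ lem ⟨ f , φ ∘ inc k ⟩ _ ⟩
    ⟨ ∂ k f , φ ∘ inc k ∘ inc (suc k) ⟩
      ≡⟨ pair-ext (∂ k f) (λ α → cong φ (inc-comm k (suc k) α)) ⟩
    ⟨ ∂ k f , φ ∘ inc (suc k) ∘ inc k ⟩ ∎
    where
    open ≡-Reasoning
    lem : ∀ x y → - x ℤ.+ (x ℤ.+ y) ≡ y
    lem = ℤ-Ring.solve-∀

  ∂XXΦ : ∀ a b c r φ → ⟨ ∂ k (X (suc k) (X k (D 0 Φ (a ∷ c ∷ b ∷ r)))) , φ ⟩ ≡
         ite (c <ᵇ a) (ite (b <ᵇ a) ⟨ Φ (c ∷ b ∷ a ∷ r) , φ ∘ inc (suc k) ∘ inc k ⟩)
  ∂XXΦ a b c r φ with c <ᵇ a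
  ... | true  = trans (∂XX (Monic⇒HasLen (h (c ∷ a ∷ b ∷ r))) φ) (∂Φ c a b r _)
  ... | false = refl

  ∂X′ : ∀ a b c r φ → ⟨ ∂ k (X (suc k) (D 0 (bump k Φ a) (b ∷ c ∷ r))) , φ ⟩ ≡
        ite (c <ᵇ b) (- ⟨ Φ (a ∷ c ∷ b ∷ r) , φ ⟩ ℤ.+ ite (c <ᵇ a) (ite (b <ᵇ a) ⟨ Φ (c ∷ b ∷ a ∷ r) , φ ∘ inc (suc k) ∘ inc k ⟩))
  ∂X′ a b c r φ with c <ᵇ b in eq
  ... | false = refl
  ... | true  = begin
    ⟨ ∂ k (X (suc k) (f ++ X k g)) , φ ⟩
      ≡⟨ ∂-cong k (X-++ (suc k) f (X k g)) .at φ ⟩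
    ⟨ ∂ k (X (suc k) f ++ X (suc k) (X k g)) , φ ⟩
      ≡⟨ trans (∂-++ k (X (suc k) f) _ .at φ) (pair-++ (∂ k (X (suc k) f)) _ φ) ⟩
    ⟨ ∂ k (X (suc k) f) , φ ⟩ ℤ.+ ⟨ ∂ k (X (suc k) (X k g)) , φ ⟩
      ≡⟨ cong₂ ℤ._+_ (trans (∂-leibnizʳ k<N (Monic⇒HasLen (h (a ∷ c ∷ b ∷ r))) φ)
        (trans (cong (ℤ._+_ (- ⟨ f , φ ⟩)) (∂∅ a c b r eq _)) (ℤₚ.+-identityʳ (- ⟨ f , φ ⟩)))) (∂XXΦ a b c r φ) ⟩
    _ ∎
    where
    open ≡-Reasoning
    f = Φ (a ∷ c ∷ b ∷ r)
    g = D 0 Φ (a ∷ c ∷ b ∷ r)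

  pair-bump : ∀ k Φ a r φ → ⟨ bump k Φ a r , φ ⟩ ≡ ⟨ Φ (a ∷ r) , φ ⟩ ℤ.+ ⟨ D 0 Φ (a ∷ r) , φ ∘ inc k ⟩
  pair-bump k Φ a r φ = trans (pair-++ (Φ (a ∷ r)) _ φ) (cong (ℤ._+_ ⟨ Φ (a ∷ r) , φ ⟩) (pair-X k (D 0 Φ (a ∷ r)) φ))

  D∅ : ∀ a b r → (b <ᵇ a) ≡ true → ∀ φ → ⟨ D 0 Φ (b ∷ a ∷ r) , φ ⟩ ≡ pos 0
  D∅ a b r e φ = cong (λ x → ⟨ (if x then Φ (a ∷ b ∷ r) else []) , φ ⟩) (<ᵇ-false (ℕₚ.<⇒≯ (<ᵇ⇒ {b} {a} e)))

  two : ∀ a b z → ∂ k (Two a b z) ≈ (if b <ᵇ a then Two b a z else [])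
  two a b [] .at φ = begin
    ⟨ ∂ k (bump k Φ a (b ∷ []) ++ []) , φ ⟩
      ≡⟨ trans (∂-++ k (bump k Φ a (b ∷ [])) [] .at φ) (pair-++ (∂ k (bump k Φ a (b ∷ []))) [] φ) ⟩
    ⟨ ∂ k (bump k Φ a (b ∷ [])) , φ ⟩ ℤ.+ pos 0
      ≡⟨ cong (λ x → x ℤ.+ pos 0) (trans (∂-++ k (Φ (a ∷ b ∷ [])) _ .at φ) (pair-++ (∂ k (Φ (a ∷ b ∷ []))) _ φ)) ⟩
    (⟨ ∂ k (Φ (a ∷ b ∷ [])) , φ ⟩ ℤ.+ ⟨ ∂ k (X k (D 0 Φ (a ∷ b ∷ []))) , φ ⟩) ℤ.+ pos 0
      ≡⟨ cong₂ (λ x y → (x ℤ.+ y) ℤ.+ pos 0) (hyp (a ∷ b ∷ []) .at φ) ∂X₀ ⟩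
    (pos 0 ℤ.+ ite (b <ᵇ a) (⟨ Φ (b ∷ a ∷ []) , φ ⟩ ℤ.+ pos 0)) ℤ.+ pos 0
      ≡⟨ algebra₀ (b <ᵇ a) ⟨ Φ (b ∷ a ∷ []) , φ ⟩ ⟩
    ite (b <ᵇ a) ((⟨ Φ (b ∷ a ∷ []) , φ ⟩ ℤ.+ pos 0) ℤ.+ pos 0)
      ≡⟨ sym final ⟩
    ⟨ (if b <ᵇ a then Two b a [] else []) , φ ⟩ ∎
    where
    open ≡-Reasoning
    ∂X₀ : ⟨ ∂ k (X k (D 0 Φ (a ∷ b ∷ []))) , φ ⟩ ≡ ite (b <ᵇ a) (⟨ Φ (b ∷ a ∷ []) , φ ⟩ ℤ.+ pos 0)
    ∂X₀ with b <ᵇ a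
    ... | false = refl
    ... | true  = trans (∂-leibnizˡ k<N (Monic⇒HasLen (h (b ∷ a ∷ []))) φ)
      (cong (ℤ._+_ ⟨ Φ (b ∷ a ∷ []) , φ ⟩) (hyp (b ∷ a ∷ []) .at _))
    final : ⟨ (if b <ᵇ a then Two b a [] else []) , φ ⟩ ≡ ite (b <ᵇ a) ((⟨ Φ (b ∷ a ∷ []) , φ ⟩ ℤ.+ pos 0) ℤ.+ pos 0)
    final with b <ᵇ a in eq
    ... | false = refl
    ... | true  = trans (pair-++ (bump k Φ b (a ∷ [])) [] φ)
      (cong (λ x → x ℤ.+ pos 0) (trans (pair-bump k Φ b (a ∷ []) φ) (cong (ℤ._+_ ⟨ Φ (b ∷ a ∷ []) , φ ⟩) (D∅ a b [] eq _))))
  two a b (c ∷ r) .at φ = begin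
    ⟨ ∂ k (bump k Φ a (b ∷ c ∷ r) ++ X (suc k) (D 0 (bump k Φ a) (b ∷ c ∷ r))) , φ ⟩
      ≡⟨ trans (∂-++ k (bump k Φ a (b ∷ c ∷ r)) _ .at φ) (pair-++ (∂ k (bump k Φ a (b ∷ c ∷ r))) _ φ) ⟩
    ⟨ ∂ k (bump k Φ a (b ∷ c ∷ r)) , φ ⟩ ℤ.+ ⟨ ∂ k (X (suc k) (D 0 (bump k Φ a) (b ∷ c ∷ r))) , φ ⟩
      ≡⟨ cong₂ ℤ._+_ (trans (∂-++ k (Φ (a ∷ b ∷ c ∷ r)) _ .at φ) (trans (pair-++ (∂ k (Φ (a ∷ b ∷ c ∷ r))) _ φ)
        (cong₂ ℤ._+_ (∂Φ a b c r φ) (∂XΦ a b c r φ)))) (∂X′ a b c r φ) ⟩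
    _ ≡⟨ algebra (b <ᵇ a) (c <ᵇ b) (c <ᵇ a) ⟨ Φ (a ∷ c ∷ b ∷ r) , φ ⟩ ⟨ Φ (b ∷ a ∷ c ∷ r) , φ ⟩
      ⟨ Φ (b ∷ c ∷ a ∷ r) , φ ∘ inc (suc k) ⟩ ⟨ Φ (c ∷ b ∷ a ∷ r) , φ ∘ inc (suc k) ∘ inc k ⟩ ⟩
    _ ≡⟨ sym final ⟩
    ⟨ (if b <ᵇ a then Two b a (c ∷ r) else []) , φ ⟩ ∎
    where
    open ≡-Reasoning
    inner : ⟨ D 0 (bump k Φ b) (a ∷ c ∷ r) , φ ∘ inc (suc k) ⟩ ≡
            ite (c <ᵇ a) (⟨ Φ (b ∷ c ∷ a ∷ r) , φ ∘ inc (suc k) ⟩ ℤ.+ ite (c <ᵇ b) ⟨ Φ (c ∷ b ∷ a ∷ r) , φ ∘ inc (suc k) ∘ inc k ⟩)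
    inner with c <ᵇ a
    ... | false = refl
    ... | true  = trans (pair-bump k Φ b (c ∷ a ∷ r) _) (cong (ℤ._+_ ⟨ Φ (b ∷ c ∷ a ∷ r) , φ ∘ inc (suc k) ⟩)
      (pair-if (c <ᵇ b) (Φ (c ∷ b ∷ a ∷ r)) _))
    final : ⟨ (if b <ᵇ a then Two b a (c ∷ r) else []) , φ ⟩ ≡
            ite (b <ᵇ a) ((⟨ Φ (b ∷ a ∷ c ∷ r) , φ ⟩ ℤ.+ pos 0) ℤ.+ ite (c <ᵇ a)
              (⟨ Φ (b ∷ c ∷ a ∷ r) , φ ∘ inc (suc k) ⟩ ℤ.+ ite (c <ᵇ b) ⟨ Φ (c ∷ b ∷ a ∷ r) , φ ∘ inc (suc k) ∘ inc k ⟩))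
    final with b <ᵇ a in eq
    ... | false = refl
    ... | true  = trans (pair-bump (suc k) (bump k Φ b) a (c ∷ r) φ)
      (cong₂ ℤ._+_ (trans (pair-bump k Φ b (a ∷ c ∷ r) φ) (cong (ℤ._+_ ⟨ Φ (b ∷ a ∷ c ∷ r) , φ ⟩) (D∅ a b (c ∷ r) eq _))) inner)

-- `k` rows are already absorbed into `Φ`, so row i + k is the i-th of the rest. The hypothesis has
-- `D (suc i)` because the argument of `Φ` still begins with the entry to be stripped, which shifts
-- positions by one. Induction absorbs rows until the two interacting ones stand in front.
∂-pass : ∀ {N} i k {Φ} w → suc (i + k) < N → (∀ z → Monic N (Φ z)) →
         (∀ z → ∂ (i + k) (Φ z) ≈ D (suc i) Φ z) → ∂ (i + k) (pass k Φ w) ≈ D i (pass k Φ) w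
∂-pass zero    k []  k<N h hyp = hyp []
∂-pass (suc i) k []  k<N h hyp = hyp []
∂-pass zero    k {Φ} (a ∷ []) k<N h hyp = ≈-trans (∂-++ k (Φ (a ∷ [])) []) (++-cong (hyp (a ∷ [])) ≈-refl)
∂-pass zero    k {Φ} (a ∷ b ∷ r) k<N h hyp =
  ≈-trans (pass-∂ k (suc (suc k)) r k<N ℕₚ.≤-refl (λ z → bump-Monic (suc k) b z (λ y → bump-Monic k a y h)))
  (≈-trans (pass-cong (suc (suc k)) r (TwoRows.two k<N Φ h hyp a b)) lem)
  where
  lem : pass (2 + k) (λ z → if b <ᵇ a then TwoRows.Two k<N Φ h hyp b a z else []) r ≈ (if b <ᵇ a then pass k Φ (b ∷ a ∷ r) else [])
  lem with b <ᵇ a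
  ... | true  = ≈-refl
  ... | false = pass-[] (2 + k) r
∂-pass {N} (suc i) k {Φ} (a ∷ r) k<N h hyp = subst (λ j → ∂ j (pass (suc k) (bump k Φ a) r) ≈ D i (pass (suc k) (bump k Φ a))
  r) (ℕₚ.+-suc i k)
  (∂-pass i (suc k) r (subst (λ j → suc j < N) (sym (ℕₚ.+-suc i k)) k<N) (λ z → bump-Monic k a z h)
    (λ z → subst (λ j → ∂ j (bump k Φ a z) ≈ D (suc i) (bump k Φ a) z) (sym (ℕₚ.+-suc i k)) (step z)))
  where
  inner : ∀ z → ∂ (suc i + k) (X k (D 0 Φ (a ∷ z))) ≈ X k (D (suc i) (λ y → D 0 Φ (a ∷ y)) z)
  inner []      = ≈-refl
  inner (b ∷ z) = ≈-trans lem (X-cong k (≡⇒≈ (D-if i (b <ᵇ a) (λ y → Φ (b ∷ a ∷ y)) z)))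
    where
    lem : ∂ (suc i + k) (X k (if b <ᵇ a then Φ (b ∷ a ∷ z) else [])) ≈ X k (if b <ᵇ a then D i (λ y → Φ (b ∷ a ∷ y)) z else [])
    lem with b <ᵇ a
    ... | true  = ≈-trans (∂-X k<N (Monic⇒HasLen (h (b ∷ a ∷ z))) k (inj₁ (s≤s (ℕₚ.m≤n+m k i)))) (X-cong k (hyp (b ∷ a ∷ z)))
    ... | false = ≈-refl
  step : ∀ z → ∂ (suc i + k) (bump k Φ a z) ≈ D (suc i) (bump k Φ a) z
  step z = ≈-trans (∂-++ (suc i + k) (Φ (a ∷ z)) _) (≈-trans (++-cong (hyp (a ∷ z)) (inner z))
    (≡⇒≈ (sym (D-bump (suc i) k (λ y → Φ (a ∷ y)) (λ y → D 0 Φ (a ∷ y)) z))))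

one-∂ : ∀ N i → suc i < N → ∂ i [ (replicate N 0 , pos 1) ] ≈ []
one-∂ (suc (suc N)) zero    lt .at φ = refl
one-∂ (suc N) (suc i) (s≤s lt) .at φ = trans (pair-∂ (suc i) [ (replicate (suc N) 0 , pos 1) ] φ)
  (trans (cong (λ x → pos 1 ℤ.* x ℤ.+ pos 0) (∂*-suc i φ 0 (replicate N 0)))
  (trans (sym (pair-∂ i [ (replicate N 0 , pos 1) ] (φ ∘ (0 ∷_)))) (one-∂ N i lt .at (φ ∘ (0 ∷_)))))

D-F-zero : ∀ N i c w → D i (F N 0 c) w ≡ []
D-F-zero N zero    c []          = refl
D-F-zero N zero    c (a ∷ [])    = refl
D-F-zero N zero    c (a ∷ b ∷ r) with b <ᵇ a
... | true  = refl
... | false = refl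
D-F-zero N (suc i) c []          = refl
D-F-zero N (suc i) c (a ∷ r)     = trans (go i r) refl
  where
  go : ∀ i r → D i (λ _ → []) r ≡ []
  go zero    []          = refl
  go zero    (a ∷ [])    = refl
  go zero    (a ∷ b ∷ r) with b <ᵇ a
  ... | true  = refl
  ... | false = refl
  go (suc i) []          = refl
  go (suc i) (a ∷ r)     = go i r

-- The expansion obeys the Schubert recursion: a column passes `∂ i` on to the remaining columns,
-- and without columns only a constant is left, which `∂ i` kills.
∂-F : ∀ N m c i w → suc i < N → ∂ i (F N m c w) ≈ D i (F N m c) w
∂-F N zero    c i []      lt = ≈-trans (one-∂ N i lt) (≡⇒≈ (sym (D-F-zero N i c [])))
∂-F N zero    c i (a ∷ w) lt = ≡⇒≈ (sym (D-F-zero N i c (a ∷ w)))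
∂-F N (suc m) c i w lt = subst (λ j → ∂ j (pass 0 (strip c (F N m (suc c))) w) ≈ D i (pass 0 (strip c (F N m (suc c)))) w)
  (ℕₚ.+-identityʳ i)
  (∂-pass i 0 w (subst (λ j → suc j < N) (sym (ℕₚ.+-identityʳ i)) lt) (λ z → strip-Monic c z (F-Monic N m (suc c)))
    (λ z → subst (λ j → ∂ j (strip c (F N m (suc c)) z) ≈ D (suc i) (strip c (F N m (suc c))) z) (sym (ℕₚ.+-identityʳ i)) (step z)))
  where
  step : ∀ z → ∂ i (strip c (F N m (suc c)) z) ≈ D (suc i) (strip c (F N m (suc c))) z
  step []      = ≈-refl
  step (a ∷ r) = ≈-trans lem (≡⇒≈ (D-if i (a ≡ᵇ c) (F N m (suc c)) r))
    where
    lem : ∂ i (if a ≡ᵇ c then F N m (suc c) r else []) ≈ (if a ≡ᵇ c then D i (F N m (suc c)) r else [])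
    lem with a ≡ᵇ c
    ... | true  = ∂-F N m (suc c) i r lt
    ... | false = ≈-refl

-- Pipe dreams

module Passes where

  private variable
    A B : Set
    R R′ : A → A → Set
    a b c : A
    xs ys zs r o z z′ : List A
    ε β : List ℕ

  data Before {A : Set} : List A → A → A → Set where
    here  : b ∈ xs → Before (a ∷ xs) a b
    there : Before xs a b → Before (c ∷ xs) a b

  Before-∈ˡ : Before xs a b → a ∈ xs
  Before-∈ˡ (here _)  = here refl
  Before-∈ˡ (there p) = there (Before-∈ˡ p)

  Before-∈ʳ : Before xs a b → b ∈ xs
  Before-∈ʳ (here p)  = there p
  Before-∈ʳ (there p) = there (Before-∈ʳ p)

  ∉-head : Unique (a ∷ xs) → a ∉ xs
  ∉-head (p ∷ _) a∈xs = All.lookup p a∈xs refl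

  Before-asym : Unique xs → Before xs a b → Before xs b a → ⊥
  Before-asym u       (here p)  (here q)  = ∉-head u p
  Before-asym u       (here p)  (there q) = ∉-head u (Before-∈ʳ q)
  Before-asym u       (there p) (here q)  = ∉-head u (Before-∈ʳ p)
  Before-asym (_ ∷ u) (there p) (there q) = Before-asym u p q

  Before-map : ∀ (f : A → B) → Before xs a b → Before (map f xs) (f a) (f b)
  Before-map f (here p)  = here (∈-map⁺ f p)
  Before-map f (there p) = there (Before-map f p)

  -- One column of a pipe dream, read from bottom to top: R a b permits a crossing of the adjacent entries a b, recorded by a 1.
  data Pass {A : Set} (R : A → A → Set) : List A → List ℕ → List A → Set where
    nil  : Pass R [] [] []
    keep : Pass R r ε z → Pass R (a ∷ r) (0 ∷ ε) (a ∷ z)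
    swap : Pass R r ε (b ∷ z) → R a b → Pass R (a ∷ r) (1 ∷ ε) (b ∷ a ∷ z)

  Pass-∈⁺ : Pass R xs ε ys → c ∈ xs → c ∈ ys
  Pass-∈⁺ (keep p)   (here e)   = here e
  Pass-∈⁺ (keep p)   (there c∈) = there (Pass-∈⁺ p c∈)
  Pass-∈⁺ (swap p _) (here e)   = there (here e)
  Pass-∈⁺ (swap p _) (there c∈) with Pass-∈⁺ p c∈
  ... | here e   = here e
  ... | there c∈′ = there (there c∈′)

  Pass-∈⁻ : Pass R xs ε ys → c ∈ ys → c ∈ xs
  Pass-∈⁻ (keep p)   (here e)           = here e
  Pass-∈⁻ (keep p)   (there c∈)         = there (Pass-∈⁻ p c∈)
  Pass-∈⁻ (swap p _) (here e)           = there (Pass-∈⁻ p (here e))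
  Pass-∈⁻ (swap p _) (there (here e))   = here e
  Pass-∈⁻ (swap p _) (there (there c∈)) = there (Pass-∈⁻ p (there c∈))

  ≢All : (∀ {c : A} → c ∈ ys → c ∈ xs) → All (a ≢_) xs → All (a ≢_) ys
  ≢All h p = All.tabulate (λ c∈ → All.lookup p (h c∈))

  Pass-Unique : Pass R xs ε ys → Unique xs → Unique ys
  Pass-Unique nil        u       = []
  Pass-Unique (keep p)   (n ∷ u) = ≢All (Pass-∈⁻ p) n ∷ Pass-Unique p u
  Pass-Unique (swap p _) (n ∷ u) with Pass-Unique p u
  ... | n′ ∷ u′ = ((λ e → All.lookup n (Pass-∈⁻ p (here refl)) (sym e)) ∷ n′) ∷ ≢All (λ c∈ → Pass-∈⁻ p (there c∈)) n ∷ u′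

  Pass-length : Pass R xs ε ys → length xs ≡ length ys
  Pass-length nil        = refl
  Pass-length (keep p)   = cong suc (Pass-length p)
  Pass-length (swap p _) = cong suc (Pass-length p)

  Pass-map : (∀ {a b} → R a b → R′ a b) → Pass R xs ε ys → Pass R′ xs ε ys
  Pass-map h nil        = nil
  Pass-map h (keep p)   = keep (Pass-map h p)
  Pass-map h (swap p r) = swap (Pass-map h p) (h r)

  Pass-list-map : ∀ (f : A → B) {R : A → A → Set} {R′ : B → B → Set} → (∀ {a b} → R a b → R′ (f a) (f b)) → Pass R xs ε ys →
    Pass R′ (map f xs) ε (map f ys)
  Pass-list-map f h nil        = nil
  Pass-list-map f h (keep p)   = keep (Pass-list-map f h p)
  Pass-list-map f h (swap p r) = swap (Pass-list-map f h p) (h r)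

  -- A crossed pair is in one order before the pass and in the opposite order afterwards. Recording
  -- both facts allows the crossing relation to be replaced by the order taken from another list.
  Pass-restrict : Pass R xs ε ys → Pass (λ a b → R a b × Before xs a b × Before ys b a) xs ε ys
  Pass-restrict nil      = nil
  Pass-restrict (keep p) = keep (Pass-map (λ (r , p , q) → r , there p , there q) (Pass-restrict p))
  Pass-restrict {ys = b ∷ a ∷ ys} (swap p r) =
    swap (Pass-map (λ (r , p , q) → r , there p , ins q) (Pass-restrict p)) (r , here (Pass-∈⁻ p (here refl)) , here (here refl))
    where
    ins : ∀ {c d} → Before (b ∷ ys) c d → Before (b ∷ a ∷ ys) c d
    ins (here q)  = here (there q)
    ins (there q) = there (there q)

  Pass-Before⁻ : Pass R xs ε ys → Before ys a b → Before xs a b ⊎ (R b a × Before xs b a)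
  Pass-Before⁻ (keep p)   (here q)  = inj₁ (here (Pass-∈⁻ p q))
  Pass-Before⁻ (keep p)   (there q) with Pass-Before⁻ p q
  ... | inj₁ q′       = inj₁ (there q′)
  ... | inj₂ (r , q′) = inj₂ (r , there q′)
  Pass-Before⁻ (swap p r) (here (here refl)) = inj₂ (r , here (Pass-∈⁻ p (here refl)))
  Pass-Before⁻ (swap p r) (here (there q)) with Pass-Before⁻ p (here q)
  ... | inj₁ q′       = inj₁ (there q′)
  ... | inj₂ (r , q′) = inj₂ (r , there q′)
  Pass-Before⁻ (swap p r) (there (here q)) = inj₁ (here (Pass-∈⁻ p (there q)))
  Pass-Before⁻ (swap p r) (there (there q)) with Pass-Before⁻ p (there q)
  ... | inj₁ q′       = inj₁ (there q′)
  ... | inj₂ (r , q′) = inj₂ (r , there q′)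

  Pass-Before⁺ : Pass R xs ε ys → Before xs a b → Before ys a b ⊎ R a b
  Pass-Before⁺ (keep p)   (here q)  = inj₁ (here (Pass-∈⁺ p q))
  Pass-Before⁺ (keep p)   (there q) with Pass-Before⁺ p q
  ... | inj₁ q′ = inj₁ (there q′)
  ... | inj₂ r  = inj₂ r
  Pass-Before⁺ (swap p r) (here q) with Pass-∈⁺ p q
  ... | here refl = inj₂ r
  ... | there q′  = inj₁ (there (here q′))
  Pass-Before⁺ (swap p r) (there q) with Pass-Before⁺ p q
  ... | inj₁ (here q′)  = inj₁ (here (there q′))
  ... | inj₁ (there q′) = inj₁ (there (there q′))
  ... | inj₂ r′ = inj₂ r′

  infixr 5 _⊕_
  -- The result always has the length of the second list: a column meets only the upper rows, and
  -- the rows below keep their weight.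
  _⊕_ : List ℕ → List ℕ → List ℕ
  []      ⊕ β       = β
  (e ∷ ε) ⊕ []      = []
  (e ∷ ε) ⊕ (b ∷ β) = (e + b) ∷ ε ⊕ β

  -- Weights of the pipe dreams of the permutation z, whose values are ordered as in the first list.
  data Pipe {A : Set} : List A → List A → List ℕ → Set where
    -- `M` empty rows: the weight keeps its length while the word loses an entry with every column.
    done : ∀ M → Pipe [] [] (replicate M 0)
    col  : Pass (λ a b → Before (c ∷ o) b a) z ε (c ∷ z′) → Pipe o z′ β → Pipe (c ∷ o) z (ε ⊕ β)

  Pipe-map : ∀ (f : A → B) → Pipe o z β → Pipe (map f o) (map f z) β
  Pipe-map f (done M)  = done M
  Pipe-map f (col p s) = col (Pass-list-map f (Before-map f) p) (Pipe-map f s)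

  private
    tail-Before : ∀ {a b c : A} → a ≢ c → Before (c ∷ xs) a b → Before xs a b
    tail-Before n (here _)  = ⊥-elim (n refl)
    tail-Before n (there p) = p

    tail-∈ : a ≢ c → a ∈ c ∷ xs → a ∈ xs
    tail-∈ n (here e)  = ⊥-elim (n e)
    tail-∈ n (there p) = p

  -- Adding a first row to a pipe dream: row passes and column passes commute.
  rowStep : ∀ {g : A} {o′} → Unique o → Unique (g ∷ z) →
            Pass (λ q f → Before (g ∷ z) f q) o ε (g ∷ o′) → Pipe o′ z β → Pipe o (g ∷ z) (sum ε ∷ β)
  rowStep uo uz (keep nil) (done M) = col {β = replicate (suc M) 0} (keep nil) (done (suc M))
  rowStep {o = g ∷ ô} {z = z} uo@(_ ∷ uô) uz (keep {ε = ε} p) (col {c = c} {o = o″} {ε = ε′} {z′ = z′} {β = β′} q s) =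
    -- `g` is already the least letter. Its column repeats the crossings of the column of `c` one
    -- row lower, and `c` becomes the letter sought by the rest of the row.
    col {ε = 0 ∷ ε′} (keep column) (rowStep uô (Pass-Unique q (uz′ uz)) row s)
    where
    uz′ : Unique (g ∷ z) → Unique z
    uz′ (_ ∷ u) = u
    g∉ : g ∉ ô
    g∉ = ∉-head uo
    column : Pass (λ a b → Before (g ∷ ô) b a) z ε′ (c ∷ z′)
    column = Pass-map conv (Pass-restrict q)
      where
      conv : ∀ {a b} → Before (c ∷ o″) b a × Before z a b × Before (c ∷ z′) b a → Before (g ∷ ô) b a
      conv (r , bz , _) with Pass-Before⁻ p r
      ... | inj₁ x       = there x
      ... | inj₂ (x , _) = ⊥-elim (Before-asym uz (there bz) x)
    row : Pass (λ q f → Before (c ∷ z′) f q) ô ε (c ∷ o″)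
    row = Pass-map conv (Pass-restrict p)
      where
      conv : ∀ {a b} → Before (g ∷ z) b a × Before ô a b × Before (c ∷ o″) b a → Before (c ∷ z′) b a
      -- The column cannot have crossed this pair, since that would require the order opposite to
      -- the one in which the row leaves it.
      conv (r , bo , bo′) with Pass-Before⁺ q (tail-Before (λ e → g∉ (subst (_∈ ô) e (Before-∈ʳ bo))) r)
      ... | inj₁ x = x
      ... | inj₂ x = ⊥-elim (Before-asym (Pass-Unique p uô) bo′ x)
  rowStep {o = c ∷ ô} {z = z} {g = g} uo@(_ ∷ uô) uz@(_ ∷ uz₀) (swap {ε = ε} p r) (col {o = o″} {ε = ε′} {z′ = z′} {β = β′} q s) =
    -- The row crosses `c`, hence the column of `c` crosses `g` in the first row; `g` stays in front
    -- for the remaining columns.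
    col {ε = 1 ∷ ε′} (swap column (here (Pass-∈⁻ p (here refl)))) (rowStep uô uz′ row s)
    where
    c∉ : c ∉ ô
    c∉ = ∉-head uo
    uz′ : Unique (g ∷ z′)
    uz′ with uz | Pass-Unique q uz₀
    ... | n ∷ _ | _ ∷ u = ≢All (λ x → Pass-∈⁻ q (there x)) n ∷ u
    column : Pass (λ a b → Before (c ∷ ô) b a) z ε′ (c ∷ z′)
    column = Pass-map conv (Pass-restrict q)
      where
      conv : ∀ {a b} → Before (c ∷ o″) b a × Before z a b × Before (c ∷ z′) b a → Before (c ∷ ô) b a
      conv (here x , _) = here (Pass-∈⁻ p (there x))
      conv (there r , bz , _) with Pass-Before⁻ p (there r)
      ... | inj₁ x       = there x
      ... | inj₂ (x , _) = ⊥-elim (Before-asym uz (there bz) x)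
    row : Pass (λ q f → Before (g ∷ z′) f q) ô ε (g ∷ o″)
    row = Pass-map conv (Pass-restrict p)
      where
      ≢c : ∀ {x} → x ∈ ô → x ≢ c
      ≢c x∈ e = c∉ (subst (_∈ ô) e x∈)
      conv : ∀ {a b} → Before (g ∷ z) b a × Before ô a b × Before (g ∷ o″) b a → Before (g ∷ z′) b a
      conv (here a∈z , bo , _) = here (tail-∈ (≢c (Before-∈ˡ bo)) (Pass-∈⁺ q a∈z))
      conv (there bz , bo , bo′) with Pass-Before⁺ q bz
      ... | inj₁ x = there (tail-Before (≢c (Before-∈ʳ bo)) x)
      ... | inj₂ x = ⊥-elim (Before-asym (Pass-Unique p uô) bo′ (there (tail-Before (≢c (Before-∈ˡ bo)) x)))

open Passes

-- Fillings of the Rothe diagram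

bit : Bool → ℕ
bit true  = 1
bit false = 0

bit≤1 : ∀ b → bit b ≤ 1
bit≤1 true  = s≤s z≤n
bit≤1 false = z≤n

Col : Set
Col = ℕ → Bool

-- On the m rows from x on, every initial segment contains at least as many elements of C (plus s) as of D,
-- with equality at the end: for s = 0 this is the componentwise comparison C ≤ D of equinumerous sets.
Dom : ℕ → ℕ → ℕ → Col → Col → Set
Dom s x zero    C D = s ≡ 0
Dom s x (suc m) C D = ∃ λ s′ → s + bit (C x) ≡ bit (D x) + s′ × Dom s′ (suc x) m C D

Dom-cong : ∀ {s x} m {C C′ D D′} → (∀ r → x ≤ r → C r ≡ C′ r) → (∀ r → x ≤ r → D r ≡ D′ r) → Dom s x m C D → Dom s x m C′ D′
Dom-cong zero    eC eD d = d
Dom-cong {s} {x} (suc m) eC eD (s′ , e , d) = s′ , subst₂ (λ c d → s + bit c ≡ bit d + s′) (eC x ℕₚ.≤-refl) (eD x ℕₚ.≤-refl) e ,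
  Dom-cong m (λ r p → eC r (ℕₚ.<⇒≤ p)) (λ r p → eD r (ℕₚ.<⇒≤ p)) d

Dom-pos : ∀ {s x} m {C D} → Dom (suc s) x m C D → (∀ r → x ≤ r → D r ≡ false) → ⊥
Dom-pos {x = x} (suc m) (s′ , e , d) z rewrite z x ℕₚ.≤-refl with s′ | e
... | suc _ | _ = Dom-pos m d (λ r p → z r (ℕₚ.<⇒≤ p))

Dom-zero : ∀ {x} m {C D} → Dom 0 x m C D → (∀ r → x ≤ r → D r ≡ false) → ∀ r → x ≤ r → r < x + m → C r ≡ false
Dom-zero {x} zero    d z r x≤r r< = ⊥-elim (ℕₚ.<⇒≱ r< (subst (_≤ r) (sym (ℕₚ.+-identityʳ x)) x≤r))
Dom-zero {x} (suc m) {C} (s′ , e , d) z r x≤r r< rewrite z x ℕₚ.≤-refl with C x in eq | s′ | e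
... | true  | suc _ | _ = ⊥-elim (Dom-pos m d (λ r p → z r (ℕₚ.<⇒≤ p)))
... | false | zero  | _ with ℕₚ.m≤n⇒m<n∨m≡n x≤r
...   | inj₁ x<r  = Dom-zero m d (λ r p → z r (ℕₚ.<⇒≤ p)) r x<r (subst (r <_) (ℕₚ.+-suc x m) r<)
...   | inj₂ refl = eq

Dom-false : ∀ {x m C D} → D x ≡ false → Dom 0 x (suc m) C D → Dom (bit (C x)) (suc x) m C D
Dom-false e (s′ , e′ , d) rewrite e | e′ = d

Dom-true : ∀ {x m C D} → D x ≡ true → Dom 0 x (suc m) C D → C x ≡ true × Dom 0 (suc x) m C D
Dom-true {x} {C = C} e (s′ , e′ , d) rewrite e with C x | s′ | e′
... | true  | zero | _ = refl , d

mix : ℕ → Col → Col → Col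
mix p C C′ r = if r <ᵇ suc p then C r else C′ r

mix-≤ : ∀ {p r} C C′ → r ≤ p → mix p C C′ r ≡ C r
mix-≤ {p} {r} C C′ r≤p rewrite <ᵇ-true {r} {suc p} (s≤s r≤p) = refl

mix-> : ∀ {p r} C C′ → p < r → mix p C C′ r ≡ C′ r
mix-> {p} {r} C C′ p<r rewrite <ᵇ-false {r} {suc p} (ℕₚ.<⇒≱ (s≤s p<r)) = refl

≡ᵇ-refl : ∀ n → (n ≡ᵇ n) ≡ true
≡ᵇ-refl zero    = refl
≡ᵇ-refl (suc n) = ≡ᵇ-refl n

≡ᵇ-false : ∀ {m n} → m ≢ n → (m ≡ᵇ n) ≡ false
≡ᵇ-false {m} {n} ne with m ≡ᵇ n in eq
... | true  = ⊥-elim (ne (ℕₚ.≡ᵇ⇒≡ m n (subst T (sym eq) tt)))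
... | false = refl

without : ℕ → Col → Col
without f D r = D r ∧ not (r ≡ᵇ f)

without-≢ : ∀ {f r} D → r ≢ f → without f D r ≡ D r
without-≢ {f} {r} D ne rewrite ≡ᵇ-false ne = ∧-identityʳ (D r)

without-≡ : ∀ f D → without f D f ≡ false
without-≡ f D rewrite ≡ᵇ-refl f = ∧-zeroʳ (D f)

-- Either the surplus of the column q is absorbed by removing f from D, or q and f can trade initial segments
-- so that the surplus moves to f: the first row where the partial sums of C′ overtake those of C is a place to cut.
exch : ∀ m x s s′ {q f C C′ D D′} → x ≤ f → x ≤ q → q ≢ f → s′ ≤ s →
       (∀ r → r < f → r < q → D r ≡ D′ r) → (∀ r → q ≤ r → D r ≡ false) → (f < q → D f ≡ true) →
       Dom (suc s) x m C D → Dom s′ x m C′ D′ →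
       (f < q × Dom s x m C (without f D)) ⊎
       ∃ λ p → x ≤ p × Dom s′ x m (mix p C′ C) D × Dom (suc s) x m (mix p C C′) D′
exch zero    x s s′ x≤f x≤q q≢f s′≤s agree Dq Df () _
exch (suc m) x s s′ {q} {f} {C} {C′} {D} {D′} x≤f x≤q q≢f s′≤s agree Dq Df (s₁ , e₁ , d₁) (s₂ , e₂ , d₂)
  with ℕₚ.m≤n⇒m<n∨m≡n x≤q
-- From row q on `D` is empty, so a surplus still present there could never be used up.
... | inj₂ refl = ⊥-elim (Dom-pos (suc m) {C} {D} (s₁ , e₁ , d₁) Dq)
... | inj₁ x<q with ℕₚ.m≤n⇒m<n∨m≡n x≤f
-- One unit less at the start and one element less demanded in row f leave the same balance after
-- row f.
...   | inj₂ refl = inj₁ (x<q , s₁ , trans (ℕₚ.suc-injective (trans e₁ (cong (λ b → bit b + s₁) (Df x<q))))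
  (sym (cong (λ b → bit b + s₁) (without-≡ x D))) ,
                     Dom-cong m (λ _ _ → refl) (λ r p → sym (without-≢ D (ℕₚ.>⇒≢ p))) d₁)
...   | inj₁ x<f with s′ + bit (C′ x) ≤? s + bit (C x)
...     | yes le = further s₁ e₁ d₁
  where
  e₂′ : s′ + bit (C′ x) ≡ bit (D x) + s₂
  e₂′ = trans e₂ (cong (λ b → bit b + s₂) (sym (agree x x<f x<q)))
  further : ∀ s₁ → suc s + bit (C x) ≡ bit (D x) + s₁ → Dom s₁ (suc x) m C D → _
  further zero e₁ d₁ = ⊥-elim (ℕₚ.<⇒≱ (s≤s le) (ℕₚ.≤-trans (ℕₚ.≤-reflexive (trans e₁ (ℕₚ.+-identityʳ _)))
    (ℕₚ.≤-trans (ℕₚ.m≤m+n _ s₂) (ℕₚ.≤-reflexive (sym e₂′)))))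
  further (suc s₁) e₁ d₁ with exch m (suc x) s₁ s₂ x<f x<q q≢f (ℕₚ.+-cancelˡ-≤ (bit (D x)) s₂ s₁ (subst₂ _≤_ e₂′ e₁′ le))
    agree Dq Df d₁ d₂
    where
    e₁′ : s + bit (C x) ≡ bit (D x) + s₁
    e₁′ = ℕₚ.suc-injective (trans e₁ (ℕₚ.+-suc (bit (D x)) s₁))
  ... | inj₁ (f<q , d) = inj₁ (f<q , s₁ , trans (ℕₚ.suc-injective (trans e₁ (ℕₚ.+-suc (bit (D x)) s₁)))
    (cong (λ b → bit b + s₁) (sym (without-≢ D (ℕₚ.<⇒≢ x<f)))) , d)
  ... | inj₂ (p , x<p , d , d′) = inj₂ (p , ℕₚ.<⇒≤ x<p ,
        (s₂ , trans (cong (λ b → s′ + bit b) (mix-≤ C′ C (ℕₚ.<⇒≤ x<p))) e₂′ , d) ,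
        (suc s₁ , trans (cong (λ b → suc s + bit b) (mix-≤ C C′ (ℕₚ.<⇒≤ x<p)))
          (trans e₁ (cong (λ b → bit b + suc s₁) (agree x x<f x<q))) , d′))
-- As `s′` is at most `s`, overtaking in a single row happens by the smallest possible amount. The
-- balances of both columns then agree after row x, and their lower parts may be exchanged.
...     | no nle = inj₂ (x , ℕₚ.≤-refl ,
        (s₂ , trans (cong (λ b → s′ + bit b) (mix-≤ {x} C′ C ℕₚ.≤-refl)) (trans e₂ (cong (λ b → bit b + s₂) (sym agr))) ,
          Dom-cong m (λ r p → sym (mix-> C′ C p)) (λ _ _ → refl) (subst (λ t → Dom t (suc x) m C D) s₁≡s₂ d₁)) ,
        (s₁ , trans (cong (λ b → suc s + bit b) (mix-≤ {x} C C′ ℕₚ.≤-refl)) (trans e₁ (cong (λ b → bit b + s₁) agr)) ,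
          Dom-cong m (λ r p → sym (mix-> C C′ p)) (λ _ _ → refl) (subst (λ t → Dom t (suc x) m C′ D′) (sym s₁≡s₂) d₂)))
  where
  agr : D x ≡ D′ x
  agr = agree x x<f x<q
  equal : suc (s + bit (C x)) ≡ s′ + bit (C′ x)
  equal = ℕₚ.≤-antisym (ℕₚ.≰⇒> nle) (ℕₚ.≤-trans (ℕₚ.+-mono-≤ s′≤s (bit≤1 (C′ x))) (ℕₚ.≤-trans (ℕₚ.≤-reflexive (ℕₚ.+-comm s 1))
    (s≤s (ℕₚ.m≤m+n s _))))
  s₁≡s₂ : s₁ ≡ s₂
  s₁≡s₂ = ℕₚ.+-cancelˡ-≡ (bit (D x)) s₁ s₂ (trans (sym e₁) (trans equal (trans e₂ (cong (λ b → bit b + s₂) (sym agr)))))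

mem : ℕ → List ℕ → Bool
mem r l = does (r ∈? l)

mem-true : ∀ {r l} → r ∈ l → mem r l ≡ true
mem-true {r} {l} = dec-true (r ∈? l)

mem-false : ∀ {r l} → r ∉ l → mem r l ≡ false
mem-false {r} {l} = dec-false (r ∈? l)

mem-cong : ∀ {r l l′} → (r ∈ l → r ∈ l′) → (r ∈ l′ → r ∈ l) → mem r l ≡ mem r l′
mem-cong {r} {l} {l′} h h′ with r ∈? l
... | yes p = sym (mem-true (h p))
... | no np = sym (mem-false (np ∘ h′))

-- The column q of the Rothe diagram, when the values exceeding that at q sit in the positions rest.
diag : ℕ → List ℕ → Col
diag q rest r = (r <ᵇ q) ∧ mem r rest

diag-cong : ∀ {q l l′ r} → (r < q → r ∈ l → r ∈ l′) → (r < q → r ∈ l′ → r ∈ l) → diag q l r ≡ diag q l′ r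
diag-cong {q} {l} {l′} {r} h h′ with r <ᵇ q in eq
... | true  = mem-cong (h (<ᵇ⇒ eq)) (h′ (<ᵇ⇒ eq))
... | false = refl

diag-≥ : ∀ {q l r} → q ≤ r → diag q l r ≡ false
diag-≥ {q} {l} {r} q≤r rewrite <ᵇ-false {r} {q} (ℕₚ.≤⇒≯ q≤r) = refl

diag-∈ : ∀ {q l r} → r < q → r ∈ l → diag q l r ≡ true
diag-∈ {q} {l} {r} r<q r∈ rewrite <ᵇ-true r<q = mem-true r∈

diag-∉ : ∀ {q l r} → r ∉ l → diag q l r ≡ false
diag-∉ {q} {l} {r} r∉ rewrite mem-false r∉ = ∧-zeroʳ (r <ᵇ q)

-- Lists of columns and the choice of the first row

Item : Set
Item = ℕ × Col

labels : List Item → List ℕ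
labels = map proj₁

-- Columns are listed by increasing value, so the labels of the tail are the positions of larger
-- values. `σ` is the surplus that a column brings from a row already treated.
Adm : (Col → ℕ) → ℕ → ℕ → List Item → Set
Adm σ x m []            = ⊤
Adm σ x m ((q , C) ∷ L) = Dom (σ C) x m C (diag q (labels L)) × Adm σ x m L

tot : List Item → ℕ → ℕ
tot []            r = 0
tot ((q , C) ∷ L) r = bit (C r) + tot L r

Less : Item → Item → Set
Less (q , _) (f , _) = f < q

Pass-tot : ∀ {L ε L′} → Pass Less L ε L′ → ∀ r → tot L r ≡ tot L′ r
Pass-tot nil r = refl
Pass-tot (keep {a = q , C} p) r = cong (bit (C r) +_) (Pass-tot p r)
Pass-tot (swap {b = f , C′} {z = z} {a = q , C} p _) r = trans (cong (bit (C r) +_) (Pass-tot p r))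
  (lem (bit (C r)) (bit (C′ r)) (tot z r))
  where
  lem : ∀ a b c → a + (b + c) ≡ b + (a + c)
  lem = ℕ-Ring.solve-∀

tot-++ : ∀ L L′ r → tot (L ++ L′) r ≡ tot L r + tot L′ r
tot-++ []            L′ r = refl
tot-++ ((q , C) ∷ L) L′ r = trans (cong (bit (C r) +_) (tot-++ L L′ r)) (sym (ℕₚ.+-assoc (bit (C r)) (tot L r) (tot L′ r)))

labels-replace : ∀ A {f C C′} B → labels (A ++ (f , C) ∷ B) ≡ labels (A ++ (f , C′) ∷ B)
labels-replace []      B = refl
labels-replace (a ∷ A) B = cong (proj₁ a ∷_) (labels-replace A B)

Adm-at : ∀ {σ x m} A {f C B} → Adm σ x m (A ++ (f , C) ∷ B) → Dom (σ C) x m C (diag f (labels B))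
Adm-at []      (d , _) = d
Adm-at (a ∷ A) (_ , d) = Adm-at A d

Adm-replace : ∀ {σ x m} A {f C C′ B} → Dom (σ C′) x m C′ (diag f (labels B)) → Adm σ x m (A ++ (f , C) ∷ B) → Adm σ x m
  (A ++ (f , C′) ∷ B)
Adm-replace []            d (_ , l) = d , l
Adm-replace {σ} {x} {m} ((q , C₀) ∷ A) {B = B} d (c , l) = subst (λ ls → Dom (σ C₀) x m C₀ (diag q ls)) (labels-replace A B) c
  , Adm-replace A d l

-- The entry that ends in front has crossed everything that stood before it, hence only larger
-- labels.
Pass-head : ∀ {L ε f C L′} → Pass Less L ε ((f , C) ∷ L′) → ∃ λ A → ∃ λ B → L ≡ A ++ (f , C) ∷ B × All (λ a → f < proj₁ a) A
Pass-head (keep p) = [] , _ , refl , []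
Pass-head (swap p r) with Pass-head p
... | A , B , refl , h = _ ∷ A , B , refl , r ∷ h

module Row (g m : ℕ) where

  private
    h : ℕ
    h = suc g

    σ : Col → ℕ
    σ C = bit (C g)

  -- The front entry is the last column left in place, and only columns without an element in row g
  -- are left in place.
  HeadFalse : List Item → Set
  HeadFalse []            = ⊤
  HeadFalse ((f , C) ∷ _) = C g ≡ false

  -- `L₁` arises from `L` by trades between columns. They preserve the number of elements in every
  -- row, hence the exponent.
  record Result (L : List Item) : Set where
    field
      L₁ L₂  : List Item
      marks      : List ℕ
      labels₁ : labels L₁ ≡ labels L
      tot₁   : ∀ r → tot L₁ r ≡ tot L r
      adm₁   : Adm σ h m L₁
      pass₁  : Pass Less L₁ marks L₂
      adm₂   : Adm (λ _ → 0) h m L₂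
      weight : sum marks ≡ tot L g
      head₂  : HeadFalse L₂

    passL : Pass (λ q f → f < q) (labels L) marks (labels L₂)
    passL = subst (λ ls → Pass (λ q f → f < q) ls marks (labels L₂)) labels₁ (Pass-list-map proj₁ (λ r → r) pass₁)

  keepRow : ∀ {q C L} → C g ≡ false → Dom 0 h m C (diag q (labels L)) → Result L → Result ((q , C) ∷ L)
  keepRow {q} {C} {L} Cg d R = record
    { L₁ = (q , C) ∷ L₁ ; L₂ = (q , C) ∷ L₂ ; marks = 0 ∷ marks
    ; labels₁ = cong (q ∷_) labels₁
    ; tot₁ = λ r → cong (bit (C r) +_) (tot₁ r)
    ; adm₁ = subst (λ b → Dom (bit b) h m C (diag q (labels L₁))) (sym Cg)
      (subst (λ ls → Dom 0 h m C (diag q ls)) (sym labels₁) d) , adm₁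
    ; pass₁ = keep pass₁
    ; adm₂ = Dom-cong m (λ _ _ → refl) (λ r _ → diag-cong {q} (λ _ → Pass-∈⁺ passL) (λ _ → Pass-∈⁻ passL)) d , adm₂
    ; weight = trans weight (cong (λ b → bit b + tot L g) (sym Cg))
    ; head₂ = Cg }
    where open Result R

  -- If q trades its surplus with f, the rest is processed once more, and q is then left in place.
  row : ∀ ls → Unique ls → All (g <_) ls → ∀ L → labels L ≡ ls → Adm σ h m L → Result L
  row []       u l []            e a = record { L₁ = [] ; L₂ = [] ; marks = [] ; labels₁ = refl ; tot₁ = λ _ → refl ; adm₁ =
    tt ; pass₁ = nil ; adm₂ = tt ; weight = refl ; head₂ = tt }
  -- The recursion is on the labels: a trade alters columns but not labels, so the repeated call
  -- after a trade is still structural.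
  row (q ∷ ls) (n ∷ u) (g<q ∷ l) ((.q , C) ∷ L) refl (d , a) = split (C g) refl
    where
    R : Result L
    R = row ls u l L refl a
    split : ∀ b → C g ≡ b → Result ((q , C) ∷ L)
    split false Cg = keepRow Cg (subst (λ b → Dom (bit b) h m C (diag q (labels L))) Cg d) R
    split true  Cg = go (Result.L₂ R) refl
      where
      open Result R
      d₁ : Dom 1 h m C (diag q (labels L))
      d₁ = subst (λ b → Dom (bit b) h m C (diag q (labels L))) Cg d
      go : ∀ L₂′ → L₂ ≡ L₂′ → Result ((q , C) ∷ L)
      -- Without further columns the diagram of q is empty, so there can be no surplus.
      go [] eq with L₁ | pass₁ | labels₁
      ... | []    | _  | lab = ⊥-elim (Dom-pos m d₁ (λ r _ → diag-∉ {q} (subst (r ∉_) lab λ ())))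
      ... | _ ∷ _ | ps | _ with subst (Pass Less _ _) eq ps
      ...   | ()
      go ((f , C′) ∷ L₂″) eq = at-f (Pass-head pass′)
        where
        pass′ : Pass Less L₁ marks ((f , C′) ∷ L₂″)
        pass′ = subst (Pass Less L₁ marks) eq pass₁
        passL′ : Pass (λ q f → f < q) (labels L) marks (f ∷ labels L₂″)
        passL′ = subst (λ z → Pass (λ q f → f < q) (labels L) marks (labels z)) eq passL
        C′g : C′ g ≡ false
        C′g = subst HeadFalse eq head₂
        adm₂′ : Adm (λ _ → 0) h m ((f , C′) ∷ L₂″)
        adm₂′ = subst (Adm (λ _ → 0) h m) eq adm₂
        f∈ : f ∈ labels L
        f∈ = Pass-∈⁻ passL′ (here refl)
        q≢f : q ≢ f
        q≢f e = All.lookup n f∈ e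
        f∉ : f ∉ labels L₂″
        f∉ = ∉-head (Pass-Unique passL′ u)
        at-f : ∃ (λ A → ∃ λ B → L₁ ≡ A ++ (f , C′) ∷ B × All (λ a → f < proj₁ a) A) → Result ((q , C) ∷ L)
        at-f (A , B , eqL , f<A) = finish (exch m h 0 0 {q} {f} (All.lookup l f∈) g<q q≢f z≤n agree
          (λ r → diag-≥ {q} {labels L}) (λ f<q → diag-∈ f<q f∈) d₁ d′)
          where
          labelsL : labels L ≡ labels A ++ f ∷ labels B
          labelsL = trans (sym labels₁) (trans (cong labels eqL) (map-++ proj₁ A _))
          d′ : Dom 0 h m C′ (diag f (labels B))
          d′ = subst (λ b → Dom (bit b) h m C′ (diag f (labels B))) C′g (Adm-at A (subst (Adm σ h m) eqL adm₁))
          ∉A : ∀ {r} A → All (λ a → f < proj₁ a) A → r < f → r ∉ labels A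
          ∉A (_ ∷ A) (f<a ∷ _) r<f (here refl) = ℕₚ.<-asym r<f f<a
          ∉A (_ ∷ A) (_ ∷ f<A) r<f (there r∈)  = ∉A A f<A r<f r∈
          -- The labels in `A` exceed f, so they contribute nothing above row f, where the diagrams
          -- of q and f therefore coincide.
          agree : ∀ r → r < f → r < q → diag q (labels L) r ≡ diag f (labels B) r
          agree r r<f r<q = trans (cong (_∧ mem r (labels L)) (<ᵇ-true r<q))
            (trans (mem-cong into (λ r∈ → subst (r ∈_) (sym labelsL) (∈-++⁺ʳ (labels A) (there r∈))))
            (cong (_∧ mem r (labels B)) (sym (<ᵇ-true r<f))))
            where
            into : r ∈ labels L → r ∈ labels B
            into r∈ with ∈-++⁻ (labels A) (subst (r ∈_) labelsL r∈)
            ... | inj₁ r∈A         = ⊥-elim (∉A A f<A r<f r∈A)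
            ... | inj₂ (here refl) = ⊥-elim (ℕₚ.<-irrefl refl r<f)
            ... | inj₂ (there r∈B) = r∈B
          finish : (f < q × Dom 0 h m C (without f (diag q (labels L)))) ⊎
                   (∃ λ p → h ≤ p × Dom 0 h m (mix p C′ C) (diag q (labels L)) × Dom 1 h m (mix p C C′) (diag f (labels B))) →
                   Result ((q , C) ∷ L)
          finish (inj₁ (f<q , d₂)) = record
            { L₁ = (q , C) ∷ L₁ ; L₂ = (f , C′) ∷ (q , C) ∷ L₂″ ; marks = 1 ∷ marks
            ; labels₁ = cong (q ∷_) labels₁
            ; tot₁ = λ r → cong (bit (C r) +_) (tot₁ r)
            ; adm₁ = subst (λ ls → Dom (bit (C g)) h m C (diag q ls)) (sym labels₁) d , adm₁
            ; pass₁ = swap pass′ f<q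
            -- After the crossing q follows f in the list. Because f < q, the diagram of f does not
            -- change, while that of q loses just f.
            ; adm₂ = Dom-cong m (λ _ _ → refl) (λ r _ → diag-cong {f} {labels L₂″} {q ∷ labels L₂″} (λ _ → there)
              (λ r<f → λ { (here refl) → ⊥-elim (ℕₚ.<-asym r<f f<q) ; (there r∈) → r∈ })) (proj₁ adm₂′)
                   , Dom-cong m (λ _ _ → refl) (λ r _ → removed r) d₂
                   , proj₂ adm₂′
            ; weight = trans (cong suc weight) (cong (λ b → bit b + tot L g) (sym Cg))
            ; head₂ = C′g }
            where
            removed : ∀ r → without f (diag q (labels L)) r ≡ diag q (labels L₂″) r
            removed r with r ≟ f
            ... | yes refl = trans (without-≡ f (diag q (labels L))) (sym (diag-∉ {q} f∉))
            ... | no r≢f   = trans (without-≢ (diag q (labels L)) r≢f) (diag-cong {q} (λ _ r∈ → tail (Pass-∈⁺ passL′ r∈))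
              (λ _ r∈ → Pass-∈⁻ passL′ (there r∈)))
              where
              tail : r ∈ f ∷ labels L₂″ → r ∈ labels L₂″
              tail (here e)  = ⊥-elim (r≢f e)
              tail (there p) = p
          finish (inj₂ (p , h≤p , d₂ , d₃)) = adjust (keepRow {q} {mix p C′ C} {M} (trans (mix-≤ C′ C g≤p) C′g)
            (subst (λ ls → Dom 0 h m (mix p C′ C) (diag q ls)) (sym labelsM) d₂) (row ls u l M labelsM admM))
            where
            g≤p : g ≤ p
            g≤p = ℕₚ.<⇒≤ h≤p
            M : List Item
            M = A ++ (f , mix p C C′) ∷ B
            labelsM : labels M ≡ labels L
            labelsM = trans (labels-replace A B) (trans (cong labels (sym eqL)) labels₁)
            admM : Adm σ h m M
            admM = Adm-replace A (subst (λ b → Dom (bit b) h m (mix p C C′) (diag f (labels B)))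
              (sym (trans (mix-≤ C C′ g≤p) Cg)) d₃) (subst (Adm σ h m) eqL adm₁)
            totM : ∀ r → bit (mix p C′ C r) + tot M r ≡ bit (C r) + tot L r
            totM r = begin
              bit (mix p C′ C r) + tot M r
                ≡⟨ cong (bit (mix p C′ C r) +_) (tot-++ A _ r) ⟩
              bit (mix p C′ C r) + (tot A r + (bit (mix p C C′ r) + tot B r))
                ≡⟨ swapped ⟩
              bit (C r) + (tot A r + (bit (C′ r) + tot B r))
                ≡⟨ cong (bit (C r) +_) (trans (sym (tot-++ A _ r)) (trans (cong (λ z → tot z r) (sym eqL)) (tot₁ r))) ⟩
              bit (C r) + tot L r ∎
              where
              open ≡-Reasoning
              lem : ∀ a b c d → a + (b + (c + d)) ≡ c + (b + (a + d))
              lem = ℕ-Ring.solve-∀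
              swapped : bit (mix p C′ C r) + (tot A r + (bit (mix p C C′ r) + tot B r)) ≡ bit (C r) +
                (tot A r + (bit (C′ r) + tot B r))
              swapped with r <ᵇ suc p
              ... | true  = lem (bit (C′ r)) (tot A r) (bit (C r)) (tot B r)
              ... | false = refl
            adjust : Result ((q , mix p C′ C) ∷ M) → Result ((q , C) ∷ L)
            adjust S = record
              { L₁ = S.L₁ ; L₂ = S.L₂ ; marks = S.marks
              ; labels₁ = trans S.labels₁ (cong (q ∷_) labelsM)
              ; tot₁ = λ r → trans (S.tot₁ r) (totM r)
              ; adm₁ = S.adm₁ ; pass₁ = S.pass₁ ; adm₂ = S.adm₂
              ; weight = trans S.weight (totM g) ; head₂ = S.head₂ }
              where module S = Result S

-- Intervals, and fillings turned into pipe dreams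

range : ℕ → ℕ → List ℕ
range g zero    = []
range g (suc m) = g ∷ range (suc g) m

∈-range⁻ : ∀ {g m r} → r ∈ range g m → g ≤ r × r < g + m
∈-range⁻ {g} {suc m} (here refl) = ℕₚ.≤-refl , ℕₚ.m<m+n g (s≤s z≤n)
∈-range⁻ {g} {suc m} (there r∈) with ∈-range⁻ r∈
... | g<r , r< = ℕₚ.<⇒≤ g<r , ℕₚ.≤-trans r< (ℕₚ.≤-reflexive (sym (ℕₚ.+-suc g m)))

∈-range⁺ : ∀ {g} m {r} → g ≤ r → r < g + m → r ∈ range g m
∈-range⁺ {g} zero    g≤r r< = ⊥-elim (ℕₚ.<⇒≱ r< (ℕₚ.≤-trans (ℕₚ.≤-reflexive (ℕₚ.+-identityʳ g)) g≤r))
∈-range⁺ {g} (suc m) {r} g≤r r< with ℕₚ.m≤n⇒m<n∨m≡n g≤r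
... | inj₁ g<r  = there (∈-range⁺ m g<r (subst (r <_) (ℕₚ.+-suc g m) r<))
... | inj₂ refl = here refl

range-Unique : ∀ g m → Unique (range g m)
range-Unique g zero    = []
range-Unique g (suc m) = All.tabulate (λ r∈ → ℕₚ.<⇒≢ (proj₁ (∈-range⁻ r∈))) ∷ range-Unique (suc g) m

range-Before : ∀ {g} m {f q} → f ∈ range g m → q ∈ range g m → f < q → Before (range g m) f q
range-Before (suc m) (here refl) (here refl) f<q = ⊥-elim (ℕₚ.<-irrefl refl f<q)
range-Before (suc m) (here refl) (there q∈)  f<q = here q∈
range-Before (suc m) (there f∈)  (here refl) f<q = ⊥-elim (ℕₚ.<-asym f<q (proj₁ (∈-range⁻ f∈)))
range-Before (suc m) (there f∈)  (there q∈)  f<q = there (range-Before m f∈ q∈ f<q)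

map-range-cong : ∀ {φ ψ : ℕ → ℕ} {g} m → (∀ r → g ≤ r → r < g + m → φ r ≡ ψ r) → map φ (range g m) ≡ map ψ (range g m)
map-range-cong {g = g} zero    e = refl
map-range-cong {g = g} (suc m) e = cong₂ _∷_ (e g ℕₚ.≤-refl (ℕₚ.m<m+n g (s≤s z≤n)))
  (map-range-cong m (λ r g<r r< → e r (ℕₚ.<⇒≤ g<r) (subst (r <_) (sym (ℕₚ.+-suc g m)) r<)))

record Reduced (g m : ℕ) (O : List Item) : Set where
  field
    O′     : List Item
    marks      : List ℕ
    passO  : Pass (λ q f → f < q) (labels O) marks (g ∷ labels O′)
    weight : sum marks ≡ tot O g
    adm    : Adm (λ _ → 0) (suc g) m O′
    total  : ∀ r → suc g ≤ r → r < suc g + m → tot O′ r ≡ tot O r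

-- A column of smaller value than column g has row g in its diagram; with no surplus this forces g
-- into the filling, so all these columns are crossed. Column g itself is empty from row g on. A
-- choice remains only among the larger values, where `Row.row` makes it.
reduce : ∀ g m O₁ {C O₂} → Unique (labels (O₁ ++ (g , C) ∷ O₂)) → All (g ≤_) (labels (O₁ ++ (g , C) ∷ O₂)) →
         Adm (λ _ → 0) g (suc m) (O₁ ++ (g , C) ∷ O₂) → Reduced g m (O₁ ++ (g , C) ∷ O₂)
reduce g m [] {C} {O₂} (n ∷ u) (_ ∷ l) (d , a) = record
  { O′ = R.L₂ ; marks = 0 ∷ R.marks
  ; passO = keep R.passL
  ; weight = trans R.weight (cong (λ b → bit b + tot O₂ g) (sym (empty g ℕₚ.≤-refl (ℕₚ.m<m+n g (s≤s z≤n)))))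
  ; adm = R.adm₂
  ; total = λ r g<r r< → trans (sym (Pass-tot R.pass₁ r))
    (trans (R.tot₁ r) (cong (λ b → bit b + tot O₂ r) (sym (empty r (ℕₚ.<⇒≤ g<r) (subst (r <_) (sym (ℕₚ.+-suc g m)) r<))))) }
  where
  lift : ∀ L → g ∉ labels L → Adm (λ _ → 0) g (suc m) L → Adm (λ C → bit (C g)) (suc g) m L
  lift []      g∉ a       = tt
  lift ((q , _) ∷ L) g∉ (d , a) = Dom-false (diag-∉ {q} (g∉ ∘ there)) d , lift L (g∉ ∘ there) a
  strict : ∀ {ls} → All (g ≢_) ls → All (g ≤_) ls → All (g <_) ls
  strict []       []       = []
  strict (n ∷ ns) (l ∷ ls) = ℕₚ.≤∧≢⇒< l n ∷ strict ns ls
  module R = Row.Result (Row.row g m (labels O₂) u (strict n l) O₂ refl (lift O₂ (λ g∈ → All.lookup n g∈ refl) a))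
  empty : ∀ r → g ≤ r → r < g + suc m → C r ≡ false
  empty = Dom-zero (suc m) d (λ r g≤r → diag-≥ {g} {labels O₂} g≤r)
reduce g m ((q , C₀) ∷ O₁) {C} {O₂} (n ∷ u) (g≤q ∷ l) (d , a) = record
  { O′ = (q , C₀) ∷ R.O′ ; marks = 1 ∷ R.marks
  ; passO = swap R.passO g<q
  ; weight = trans (cong suc R.weight) (cong (λ b → bit b + tot O g) (sym (proj₁ d′)))
  ; adm = Dom-cong m (λ _ _ → refl) same (proj₂ d′) , R.adm
  ; total = λ r g<r r< → cong (bit (C₀ r) +_) (R.total r g<r r<) }
  where
  O : List Item
  O = O₁ ++ (g , C) ∷ O₂
  g∈ : g ∈ labels O
  g∈ = subst (g ∈_) (sym (map-++ proj₁ O₁ _)) (∈-++⁺ʳ (labels O₁) (here refl))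
  g<q : g < q
  g<q = ℕₚ.≤∧≢⇒< g≤q (λ e → All.lookup n g∈ (sym e))
  module R = Reduced (reduce g m O₁ u l a)
  d′ : C₀ g ≡ true × Dom 0 (suc g) m C₀ (diag q (labels O))
  d′ = Dom-true (diag-∈ g<q g∈) d
  same : ∀ r → suc g ≤ r → diag q (labels O) r ≡ diag q (labels R.O′) r
  same r g<r = diag-cong {q} (λ _ r∈ → tail (Pass-∈⁺ R.passO r∈)) (λ _ r∈ → Pass-∈⁻ R.passO (there r∈))
    where
    tail : r ∈ g ∷ labels R.O′ → r ∈ labels R.O′
    tail (here refl) = ⊥-elim (ℕₚ.<-irrefl refl g<r)
    tail (there r∈)  = r∈

∈-labels : ∀ {g} O → g ∈ labels O → ∃ λ O₁ → ∃ λ C → ∃ λ O₂ → O ≡ O₁ ++ (g , C) ∷ O₂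
∈-labels ((q , C) ∷ O) (here refl) = [] , C , O , refl
∈-labels (a ∷ O) (there g∈) with ∈-labels O g∈
... | O₁ , C , O₂ , refl = a ∷ O₁ , C , O₂ , refl

-- The letters are positions and `labels O` orders them by value. The word is then an interval, from
-- whose front one row after another is removed.
fillings-Pipe : ∀ m g O → Unique (labels O) → (∀ {q} → q ∈ labels O → q ∈ range g m) → (∀ {q} → q ∈ range g m → q ∈ labels O) →
                Adm (λ _ → 0) g m O → Pipe (labels O) (range g m) (map (tot O) (range g m))
fillings-Pipe zero    g []      u l s a = done 0
fillings-Pipe zero    g (_ ∷ _) u l s a with l (here refl)
... | ()
fillings-Pipe (suc m) g O u l s a with ∈-labels O (s (here refl))
... | O₁ , C , O₂ , refl = subst₂ (λ t β → Pipe (labels O) (g ∷ range (suc g) m) (t ∷ β)) R.weight (map-range-cong m R.total)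
  (rowStep u (range-Unique g (suc m)) passO′ (fillings-Pipe m (suc g) R.O′ u′ l′ s′ R.adm))
  where
  module R = Reduced (reduce g m O₁ u (All.tabulate (λ q∈ → proj₁ (∈-range⁻ (l q∈)))) a)
  passO′ : Pass (λ q f → Before (g ∷ range (suc g) m) f q) (labels O) R.marks (g ∷ labels R.O′)
  passO′ = Pass-map (λ (lt , b , _) → range-Before (suc m) (l (Before-∈ʳ b)) (l (Before-∈ˡ b)) lt) (Pass-restrict R.passO)
  uO′ : Unique (g ∷ labels R.O′)
  uO′ = Pass-Unique R.passO u
  u′ : Unique (labels R.O′)
  u′ with uO′
  ... | _ ∷ u″ = u″
  l′ : ∀ {q} → q ∈ labels R.O′ → q ∈ range (suc g) m
  l′ q∈ with l (Pass-∈⁻ R.passO (there q∈))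
  ... | here refl = ⊥-elim (∉-head uO′ q∈)
  ... | there q∈′ = q∈′
  s′ : ∀ {q} → q ∈ range (suc g) m → q ∈ labels R.O′
  s′ q∈ with Pass-∈⁺ R.passO (s (there q∈))
  ... | here refl = ⊥-elim (ℕₚ.<-irrefl refl (proj₁ (∈-range⁻ q∈)))
  ... | there q∈′ = q∈′

-- The Schubert polynomial as a sum over pipe dreams

pass-X : ∀ j k {Φ} w → pass k (X j ∘ Φ) w ≈ X j (pass k Φ w)
pass-X j k []          = ≈-refl
pass-X j k {Φ} (a ∷ r) = ≈-trans (pass-cong (suc k) r lem) (pass-X j (suc k) r)
  where
  XX : ∀ f → X k (X j f) ≈ X j (X k f)
  XX f .at φ = trans (trans (pair-X k (X j f) φ) (pair-X j f _)) (trans (pair-ext f (λ α → cong φ (inc-comm k j α)))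
    (sym (trans (pair-X j (X k f) φ) (pair-X k f _))))
  lem′ : ∀ z → X k (D 0 (X j ∘ Φ) (a ∷ z)) ≈ X j (X k (D 0 Φ (a ∷ z)))
  lem′ []      = ≈-refl
  lem′ (b ∷ z) with b <ᵇ a
  ... | true  = XX (Φ (b ∷ a ∷ z))
  ... | false = ≈-refl
  lem : ∀ z → bump k (X j ∘ Φ) a z ≈ X j (bump k Φ a z)
  lem z = ≈-trans (++-cong ≈-refl (lem′ z)) (≈-sym (X-++ j (Φ (a ∷ z)) (X k (D 0 Φ (a ∷ z)))))

Xs : ℕ → ℕ → Poly → Poly
Xs k zero    f = f
Xs k (suc m) f = X k (Xs (suc k) m f)

Xs-cong : ∀ k m {f g} → f ≈ g → Xs k m f ≈ Xs k m g
Xs-cong k zero    e = e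
Xs-cong k (suc m) e = X-cong k (Xs-cong (suc k) m e)

-- The least letter `c` stands last and must reach the front, so it has to cross every other entry:
-- a single term survives.
pass-strip : ∀ k c Ψ xs → All (c <_) xs → pass k (strip c Ψ) (xs ++ [ c ]) ≈ Xs k (length xs) (Ψ xs)
pass-strip k c Ψ []       _ rewrite ≡ᵇ-refl c = ≡⇒≈ (++-identityʳ (Ψ []))
pass-strip k c Ψ (x ∷ xs) (c<x ∷ l) = ≈-trans (pass-cong (suc k) (xs ++ [ c ]) lem)
  (≈-trans (pass-X k (suc k) (xs ++ [ c ])) (X-cong k (pass-strip (suc k) c (Ψ ∘ (x ∷_)) xs l)))
  where
  lem : ∀ z → bump k (strip c Ψ) x z ≈ X k (strip c (Ψ ∘ (x ∷_)) z)
  lem z rewrite ≡ᵇ-false (ℕₚ.>⇒≢ c<x) = ≡⇒≈ (cong (X k) (lem′ z))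
    where
    lem′ : ∀ z → D 0 (strip c Ψ) (x ∷ z) ≡ strip c (Ψ ∘ (x ∷_)) z
    lem′ []      = refl
    lem′ (b ∷ z) with b ≡ᵇ c in eq
    ... | false with b <ᵇ x
    ...   | true  = refl
    ...   | false = refl
    lem′ (b ∷ z) | true with ℕₚ.≡ᵇ⇒≡ b c (subst T (sym eq) _)
    ...   | refl rewrite <ᵇ-true c<x = refl

down : ℕ → ℕ → List ℕ
down c zero    = []
down c (suc m) = (c + m) ∷ down c m

down-∷ʳ : ∀ c m → down c (suc m) ≡ down (suc c) m ++ [ c ]
down-∷ʳ c zero    = cong (_∷ []) (ℕₚ.+-identityʳ c)
down-∷ʳ c (suc m) = cong₂ _∷_ (ℕₚ.+-suc c m) (down-∷ʳ c m)

down-> : ∀ c m → All (c <_) (down (suc c) m)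
down-> c zero    = []
down-> c (suc m) = s≤s (ℕₚ.m≤m+n c m) ∷ down-> c m

length-down : ∀ c m → length (down c m) ≡ m
length-down c zero    = refl
length-down c (suc m) = cong suc (length-down c m)

incs : ℕ → ℕ → List ℕ → List ℕ
incs k zero    α = α
incs k (suc m) α = inc k (incs (suc k) m α)

incs-suc : ∀ k m x α → incs (suc k) m (x ∷ α) ≡ x ∷ incs k m α
incs-suc k zero    x α = refl
incs-suc k (suc m) x α = cong (inc (suc k)) (incs-suc (suc k) m x α)

incs-map : ∀ l z → incs 0 (length l) (l ++ z) ≡ map suc l ++ z
incs-map []      z = refl
incs-map (x ∷ l) z = trans (cong (inc 0) (incs-suc 0 (length l) x (l ++ z))) (cong (suc x ∷_) (incs-map l z))

downFrom-suc : ∀ m z → map suc (downFrom m) ++ 0 ∷ z ≡ downFrom (suc m) ++ z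
downFrom-suc zero    z = refl
downFrom-suc (suc m) z = cong (suc m ∷_) (downFrom-suc m z)

Xs-monomial : ∀ k m α c → Xs k m [ (α , c) ] ≡ [ (incs k m α , c) ]
Xs-monomial k zero    α c = refl
Xs-monomial k (suc m) α c = cong (X k) (Xs-monomial (suc k) m α c)

-- The starting monomial of the Schubert recursion. `j` counts the variables in excess of the
-- remaining columns, since their total number stays fixed while columns are removed.
F-down : ∀ m c j → F (m + j) m c (down c m) ≈ [ (downFrom m ++ replicate j 0 , pos 1) ]
F-down zero    c j = ≈-refl
F-down (suc m) c j = ≈-trans (≡⇒≈ (cong (pass 0 (strip c (F (suc m + j) m (suc c)))) (down-∷ʳ c m)))
  (≈-trans (pass-strip 0 c (F (suc m + j) m (suc c)) (down (suc c) m) (down-> c m))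
  (≈-trans (≡⇒≈ (cong (λ l → Xs 0 l (F (suc m + j) m (suc c) (down (suc c) m))) (length-down (suc c) m)))
  (≈-trans (Xs-cong 0 m (subst (λ N → F N m (suc c) (down (suc c) m) ≈ [ (downFrom m ++ replicate (suc j) 0 , pos 1) ])
    (ℕₚ.+-suc m j) (F-down m (suc c) (suc j))))
  (≡⇒≈ (trans (Xs-monomial 0 m _ _) (cong (λ α → [ (α , pos 1) ])
    (trans (subst (λ l → incs 0 l (downFrom m ++ 0 ∷ replicate j 0) ≡ map suc (downFrom m) ++ 0 ∷ replicate j 0)
      (length-downFrom m) (incs-map (downFrom m) (0 ∷ replicate j 0)))
      (downFrom-suc m (replicate j 0)))))))))

-- Agreement with the recursive definition

data AscentView : List ℕ → Maybe ℕ → Set where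
  none : ∀ {w} → Linked _≥_ w → AscentView w nothing
  some : ∀ xs {a b} ys → a < b → AscentView (xs ++ a ∷ b ∷ ys) (just (length xs))

ascentView : ∀ w → AscentView w (firstAscent w)
ascentView []          = none []
ascentView (a ∷ [])    = none [-]
ascentView (a ∷ b ∷ r) = step (a <ᵇ b) refl (ascentView (b ∷ r))
  where
  cons : ∀ {w mi} → (a <ᵇ b) ≡ false → AscentView w mi → w ≡ b ∷ r → AscentView (a ∷ w) (Maybe.map suc mi)
  cons eq (none l) refl = none (ℕₚ.≮⇒≥ (λ lt → false≢true (trans (sym eq) (<ᵇ-true lt))) ∷ l)
    where
    false≢true : false ≢ true
    false≢true ()
  cons eq (some xs ys lt) _ = some (a ∷ xs) ys lt
  step : ∀ t → (a <ᵇ b) ≡ t → AscentView (b ∷ r) (firstAscent (b ∷ r)) → AscentView (a ∷ b ∷ r)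
    (if t then just 0 else Maybe.map suc (firstAscent (b ∷ r)))
  step true  eq v = some [] r (<ᵇ⇒ eq)
  step false eq v = cons eq v refl

swapAdj-at : ∀ xs a b ys → swapAdj (xs ++ a ∷ b ∷ ys) (length xs) ≡ xs ++ b ∷ a ∷ ys
swapAdj-at []       a b ys = refl
swapAdj-at (x ∷ xs) a b ys = trans (step (xs ++ a ∷ b ∷ ys)) (cong (x ∷_) (swapAdj-at xs a b ys))
  where
  step : ∀ r → swapAdj (x ∷ r) (suc (length xs)) ≡ x ∷ swapAdj r (length xs)
  step []      = refl
  step (_ ∷ _) = refl

D-at : ∀ xs {a b} ys Φ → a < b → D (length xs) Φ (xs ++ b ∷ a ∷ ys) ≡ Φ (xs ++ a ∷ b ∷ ys)
D-at []       ys Φ lt rewrite <ᵇ-true lt = refl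
D-at (x ∷ xs) ys Φ lt = D-at xs ys (λ r → Φ (x ∷ r)) lt

above : ℕ → List ℕ → ℕ
above a []      = 0
above a (b ∷ r) = bit (a <ᵇ b) + above a r

-- The number of non-inversions is exactly the number of divided differences still to come, so it
-- measures the fuel required.
asc : List ℕ → ℕ
asc []      = 0
asc (a ∷ r) = above a r + asc r

above-≤ : ∀ a r → above a r ≤ length r
above-≤ a []      = z≤n
above-≤ a (b ∷ r) = ℕₚ.+-mono-≤ (bit≤1 (a <ᵇ b)) (above-≤ a r)

asc-≤ : ∀ w → asc w ≤ length w * length w
asc-≤ []      = z≤n
asc-≤ (a ∷ r) = ℕₚ.≤-trans (ℕₚ.+-mono-≤ (above-≤ a r) (asc-≤ r))
  (ℕₚ.+-mono-≤ (ℕₚ.n≤1+n (length r)) (ℕₚ.*-monoʳ-≤ (length r) (ℕₚ.n≤1+n (length r))))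

above-swap : ∀ c xs a b ys → above c (xs ++ a ∷ b ∷ ys) ≡ above c (xs ++ b ∷ a ∷ ys)
above-swap c []       a b ys = x+[y+z] (bit (c <ᵇ a)) (bit (c <ᵇ b)) (above c ys)
  where
  x+[y+z] : ∀ x y z → x + (y + z) ≡ y + (x + z)
  x+[y+z] x y z = trans (sym (ℕₚ.+-assoc x y z)) (trans (cong (_+ z) (ℕₚ.+-comm x y)) (ℕₚ.+-assoc y x z))
above-swap c (x ∷ xs) a b ys = cong (bit (c <ᵇ x) +_) (above-swap c xs a b ys)

asc-swap : ∀ xs {a b} ys → a < b → suc (asc (xs ++ b ∷ a ∷ ys)) ≡ asc (xs ++ a ∷ b ∷ ys)
asc-swap [] {a} {b} ys lt rewrite <ᵇ-true lt | <ᵇ-false {b} {a} (ℕₚ.<⇒≯ lt) = cong suc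
  (trans (sym (ℕₚ.+-assoc (above b ys) (above a ys) (asc ys))) (trans (cong (_+ asc ys) (ℕₚ.+-comm (above b ys) (above a ys)))
    (ℕₚ.+-assoc (above a ys) (above b ys) (asc ys))))
asc-swap (x ∷ xs) {a} {b} ys lt = trans (sym (ℕₚ.+-suc _ _)) (cong₂ _+_ (above-swap x xs b a ys) (asc-swap xs ys lt))

range-∷ʳ : ∀ c m → range c (suc m) ≡ range c m ++ [ c + m ]
range-∷ʳ c zero    = cong (_∷ []) (sym (ℕₚ.+-identityʳ c))
range-∷ʳ c (suc m) = cong (c ∷_) (trans (range-∷ʳ (suc c) m) (cong (λ x → range (suc c) m ++ [ x ]) (sym (ℕₚ.+-suc c m))))

length-range : ∀ c m → length (range c m) ≡ m
length-range c zero    = refl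
length-range c (suc m) = cong suc (length-range (suc c) m)

decreasing : ∀ m c w → Linked _≥_ w → w ↭ range c m → w ≡ down c m
decreasing zero    c w       l p = ↭-empty-inv p
decreasing (suc m) c []      l p with ∈-resp-↭ (↭-sym p) (here refl)
... | ()
decreasing (suc m) c (a ∷ r) l p with Linked⇒AllPairs (λ x≥y y≥z → ℕₚ.≤-trans y≥z x≥y) l
... | a≥ ∷ _ = cong₂ _∷_ a≡ (decreasing m c r (tail l) (drop-∷ (subst (λ x → x ∷ r ↭ c + m ∷ range c m) a≡ p′)))
  where
  tail : ∀ {a r} → Linked _≥_ (a ∷ r) → Linked _≥_ r
  tail [-]     = []
  tail (_ ∷ l) = l
  p′ : a ∷ r ↭ c + m ∷ range c m
  p′ = ↭-trans p (subst (_↭ c + m ∷ range c m) (sym (range-∷ʳ c m)) (↭-sym (∷↭∷ʳ (c + m) (range c m))))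
  a≡ : a ≡ c + m
  a≡ with ∈-resp-↭ (↭-sym p′) (here refl) | ∈-resp-↭ p (here refl)
  ... | here e   | _  = sym e
  ... | there x∈ | a∈ = ℕₚ.≤-antisym (ℕₚ.≤-pred (ℕₚ.≤-trans (proj₂ (∈-range⁻ a∈)) (ℕₚ.≤-reflexive (ℕₚ.+-suc c m))))
    (All.lookup a≥ x∈)

-- The word with the ascent exchanged has a descent at i, so `∂ i` of its expansion is the expansion
-- of the word with this descent undone, which is `w` again.
schubertFuel≈F : ∀ n f w → w ↭ range 1 n → asc w < f → schubertFuel f n w ≈ F n n 1 w
schubertFuel≈F n (suc f) w p (s≤s lt) with firstAscent w | ascentView w
... | nothing | none l = ≈-sym (≈-trans (≡⇒≈ (cong (F n n 1) (decreasing n 1 w l p)))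
        (subst (λ N → F N n 1 (down 1 n) ≈ [ (downFrom n , pos 1) ]) (ℕₚ.+-identityʳ n)
          (≈-trans (F-down n 1 0) (≡⇒≈ (cong (λ α → [ (α , pos 1) ]) (++-identityʳ (downFrom n)))))))
... | just _ | some xs {a} {b} ys a<b = ≈-trans (≡⇒≈ (cong (λ v → ∂ i (schubertFuel f n v)) (swapAdj-at xs a b ys)))
        (≈-trans (∂-cong i (schubertFuel≈F n f w′ p′ (ℕₚ.≤-trans (ℕₚ.≤-reflexive (asc-swap xs ys a<b)) lt)))
        (≈-trans (∂-F n n 1 i w′ i<n) (≡⇒≈ (D-at xs ys (F n n 1) a<b))))
  where
  i : ℕ
  i = length xs
  w′ : List ℕ
  w′ = xs ++ b ∷ a ∷ ys
  p′ : w′ ↭ range 1 n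
  p′ = ↭-trans (++⁺ˡ xs (swap b a ↭refl)) p
  i<n : suc i < n
  i<n = subst (suc i <_) (trans (sym (length-++ xs)) (trans (↭-length p) (length-range 1 n)))
          (ℕₚ.≤-trans (ℕₚ.≤-reflexive (ℕₚ.+-comm 2 i)) (ℕₚ.+-monoʳ-≤ i (s≤s (s≤s z≤n))))

-- Pipe dreams give nonzero coefficients

adds : ℕ → List ℕ → List ℕ → List ℕ
adds k []          β = β
adds k (zero ∷ ε)  β = adds (suc k) ε β
adds k (suc _ ∷ ε) β = adds (suc k) ε (inc k β)

∈-pass : ∀ k {Φ w ε w′ β} → Pass (λ a b → b < a) w ε w′ → (β , pos 1) ∈ Φ w′ → (adds k ε β , pos 1) ∈ pass k Φ w
∈-pass k nil β∈ = β∈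
∈-pass k (keep p) β∈ = ∈-pass (suc k) p (∈-++⁺ˡ β∈)
∈-pass k {Φ} {β = β} (swap {b = b} {z = z} {a = a} p lt) β∈ = ∈-pass (suc k) p
  (∈-++⁺ʳ (Φ (a ∷ b ∷ z)) (∈-map⁺ _ (subst (λ x → (β , pos 1) ∈ (if x then Φ (b ∷ a ∷ z) else [])) (sym (<ᵇ-true lt)) β∈)))

inc-at : ∀ pre b β → inc (length pre) (pre ++ b ∷ β) ≡ pre ++ suc b ∷ β
inc-at []        b β = refl
inc-at (x ∷ pre) b β = cong (x ∷_) (inc-at pre b β)

adds-⊕ : ∀ {A : Set} {R : A → A → Set} {w ε w′} → Pass R w ε w′ → ∀ pre β → length w ≤ length β → adds (length pre) ε
  (pre ++ β) ≡ pre ++ (ε ⊕ β)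
adds-⊕ nil        pre β       le = refl
adds-⊕ (keep {ε = ε} p)   pre (b ∷ β) (s≤s le) =
  trans (cong₂ (λ k l → adds k ε l) (sym (trans (length-++ pre) (ℕₚ.+-comm (length pre) 1))) (sym (++-assoc pre [ b ] β)))
  (trans (adds-⊕ p (pre ++ [ b ]) β le) (++-assoc pre [ b ] (ε ⊕ β)))
adds-⊕ (swap {ε = ε} p _) pre (b ∷ β) (s≤s le) = trans (cong (adds (suc (length pre)) ε) (inc-at pre b β))
  (trans (cong₂ (λ k l → adds k ε l) (sym (trans (length-++ pre) (ℕₚ.+-comm (length pre) 1))) (sym (++-assoc pre [ suc b ] β)))
  (trans (adds-⊕ p (pre ++ [ suc b ]) β le) (++-assoc pre [ suc b ] (ε ⊕ β))))

length-⊕ : ∀ ε β → length (ε ⊕ β) ≡ length β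
length-⊕ []      β       = refl
length-⊕ (e ∷ ε) []      = refl
length-⊕ (e ∷ ε) (b ∷ β) = cong suc (length-⊕ ε β)

Before-range : ∀ {c m a b} → Before (range c m) a b → a < b
Before-range {m = suc m} (here b∈) = proj₁ (∈-range⁻ b∈)
Before-range {m = suc m} (there p) = Before-range p

Pipe⇒∈F : ∀ N m c {w α} → Pipe (range c m) w α → length w ≤ N → length α ≡ N → (α , pos 1) ∈ F N m c w
Pipe⇒∈F N zero    c (done M) le e = here (cong (λ k → replicate k 0 , pos 1) (trans (sym (length-replicate M)) e))
Pipe⇒∈F N (suc m) c {w} (col {ε = ε} {z′ = z′} {β = β} p s) le e =
  subst (λ α → (α , pos 1) ∈ F N (suc m) c w) (adds-⊕ p [] β (ℕₚ.≤-trans le (ℕₚ.≤-reflexive (sym lβ))))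
    (∈-pass 0 (Pass-map Before-range p) (subst (λ x → (β , pos 1) ∈ (if x then F N m (suc c) z′ else [])) (sym (≡ᵇ-refl c))
      (Pipe⇒∈F N m (suc c) s (ℕₚ.≤-trans (ℕₚ.n≤1+n _) (ℕₚ.≤-trans (ℕₚ.≤-reflexive (sym (Pass-length p))) le)) lβ)))
  where
  lβ : length β ≡ N
  lβ = trans (sym (length-⊕ ε β)) e

δ : List ℕ → List ℕ → ℤ
δ α β = if does (≡-dec ℕ._≟_ α β) then pos 1 else pos 0

coeff-pair : ∀ α f → coeff α f ≡ ⟨ f , δ α ⟩
coeff-pair α []            = refl
coeff-pair α ((β , c) ∷ f) = cong₂ ℤ._+_ lem (coeff-pair α f)
  where
  lem : (if does (≡-dec ℕ._≟_ α β) then c else pos 0) ≡ c ℤ.* δ α β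
  lem with does (≡-dec ℕ._≟_ α β)
  ... | true  = sym (ℤₚ.*-identityʳ c)
  ... | false = sym (ℤₚ.*-zeroʳ c)

coeff-Monic : ∀ {N} α {f} → Monic N f → ∃ λ k → coeff α f ≡ pos k
coeff-Monic α []                               = 0 , refl
coeff-Monic α (_∷_ {x = β , _} (_ , refl) ps) with does (≡-dec ℕ._≟_ α β) | coeff-Monic α ps
... | true  | k , e = suc k , cong (ℤ._+_ (pos 1)) e
... | false | k , e = k , cong (ℤ._+_ (pos 0)) e

coeff-Monic-∈ : ∀ {N α f} → Monic N f → (α , pos 1) ∈ f → coeff α f ≢ pos 0
coeff-Monic-∈ {α = α} (_∷_ {x = β , _} (_ , refl) ps) (here refl) rewrite dec-true (≡-dec ℕ._≟_ α α) refl with coeff-Monic α ps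
... | k , e = λ z → ℕₚ.1+n≢0 (ℤₚ.+-injective (trans (cong (ℤ._+_ (pos 1)) (sym e)) z))
coeff-Monic-∈ {α = α} (_∷_ {x = β , _} (_ , refl) ps) (there α∈) with does (≡-dec ℕ._≟_ α β) | coeff-Monic α ps |
  coeff-Monic-∈ ps α∈
... | true  | k , e | _  = λ z → ℕₚ.1+n≢0 (ℤₚ.+-injective (trans (cong (ℤ._+_ (pos 1)) (sym e)) z))
... | false | _     | ne = λ z → ne (trans (sym (ℤₚ.+-identityˡ _)) z)

coeff-∉ : ∀ α f → coeff α f ≢ pos 0 → α ∈ map proj₁ f
coeff-∉ α []            ne = ⊥-elim (ne refl)
coeff-∉ α ((β , c) ∷ f) ne with ≡-dec ℕ._≟_ α β
... | yes e = here e
... | no _  = there (coeff-∉ α f (λ z → ne (trans (ℤₚ.+-identityˡ _) z)))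

pigeonhole : ∀ {A : Set} {xs ys : List A} → Unique xs → (∀ {x} → x ∈ xs → x ∈ ys) → length xs ≤ length ys
pigeonhole [] h = z≤n
pigeonhole {xs = x ∷ xs} (n ∷ u) h with ∈-∃++ (h (here refl))
... | as , bs , refl = ℕₚ.≤-trans (s≤s (pigeonhole u h′))
  (ℕₚ.≤-reflexive (trans (cong suc (length-++ as)) (trans (sym (ℕₚ.+-suc (length as) (length bs))) (sym (length-++ as)))))
  where
  h′ : ∀ {y} → y ∈ xs → y ∈ as ++ bs
  h′ y∈ with ∈-++⁻ as (h (there y∈))
  ... | inj₁ y∈as         = ∈-++⁺ˡ y∈as
  ... | inj₂ (here refl)  = ⊥-elim (All.lookup n y∈ refl)
  ... | inj₂ (there y∈bs) = ∈-++⁺ʳ as y∈bs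

length-filterᵇ : ∀ {A : Set} (b : A → Bool) xs → length (filterᵇ b xs) ≡ countTrue b xs
length-filterᵇ b []       = refl
length-filterᵇ b (x ∷ xs) with b x
... | true  = cong suc (length-filterᵇ b xs)
... | false = length-filterᵇ b xs

numSupports-≥ : ∀ f {L} → Unique L → (∀ {α} → α ∈ L → coeff α f ≢ pos 0) → length L ≤ numSupports f
numSupports-≥ f u h = ℕₚ.≤-trans
  (pigeonhole u (λ {α} α∈ → ∈-filter⁺ (T? ∘ nonzero) (∈-deduplicate⁺ (≡-dec ℕ._≟_) (coeff-∉ α f (h α∈)))
    (Equivalence.from T-≡ (cong not (dec-false (coeff α f ℤ.≟ pos 0) (h α∈))))))
  (ℕₚ.≤-reflexive (length-filterᵇ nonzero (deduplicate (≡-dec ℕ._≟_) (map proj₁ f))))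
  where
  nonzero : List ℕ → Bool
  nonzero α = not (does (coeff α f ℤ.≟ pos 0))

-- Exponent vectors with at most two moved rows

move : ℕ → ℕ → Col → Col
move i j C r = if r ≡ᵇ i then true else if r ≡ᵇ j then false else C r

move-i : ∀ i j C → move i j C i ≡ true
move-i i j C rewrite ≡ᵇ-refl i = refl

move-j : ∀ {i j} C → j ≢ i → move i j C j ≡ false
move-j {i} {j} C ne rewrite ≡ᵇ-false ne | ≡ᵇ-refl j = refl

move-other : ∀ {i j r} C → r ≢ i → r ≢ j → move i j C r ≡ C r
move-other C ni nj rewrite ≡ᵇ-false ni | ≡ᵇ-false nj = refl

-- Between the new row i and the old row j the moved element counts as one unit of surplus, which is
-- repaid at row j.
Dom-raise : ∀ m {s x i j C D} → i < x → x ≤ j → j < x + m → C j ≡ true → Dom s x m C D → Dom (suc s) x m (move i j C) D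
Dom-raise zero    {x = x} i<x x≤j j< Cj d = ⊥-elim (ℕₚ.<⇒≱ j< (ℕₚ.≤-trans (ℕₚ.≤-reflexive (ℕₚ.+-identityʳ x)) x≤j))
Dom-raise (suc m) {s} {x} {i} {j} {C} {D} i<x x≤j j< Cj (s′ , e , d) with ℕₚ.m≤n⇒m<n∨m≡n x≤j
... | inj₁ x<j = suc s′ , trans (cong (λ b → suc s + bit b) (move-other C (ℕₚ.>⇒≢ i<x) (ℕₚ.<⇒≢ x<j)))
  (trans (cong suc e) (sym (ℕₚ.+-suc _ s′))) ,
      Dom-raise m (ℕₚ.m≤n⇒m≤1+n i<x) x<j (subst (j <_) (ℕₚ.+-suc x m) j<) Cj d
... | inj₂ refl = s′ , trans (cong (λ b → suc s + bit b) (move-j C (ℕₚ.>⇒≢ i<x)))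
  (trans (trans (sym (ℕₚ.+-suc s 0)) (cong (λ b → s + bit b) (sym Cj))) e) ,
      Dom-cong m (λ r x<r → sym (move-other C (ℕₚ.>⇒≢ (ℕₚ.<-trans i<x x<r)) (ℕₚ.>⇒≢ x<r))) (λ _ _ → refl) d

Dom-move : ∀ m {s x i j C D} → x ≤ i → i < j → j < x + m → C i ≡ false → C j ≡ true → Dom s x m C D → Dom s x m (move i j C) D
Dom-move zero    {x = x} x≤i i<j j< Ci Cj d =
  ⊥-elim (ℕₚ.<⇒≱ j< (ℕₚ.≤-trans (ℕₚ.≤-reflexive (ℕₚ.+-identityʳ x)) (ℕₚ.≤-trans x≤i (ℕₚ.<⇒≤ i<j))))
Dom-move (suc m) {s} {x} {i} {j} {C} {D} x≤i i<j j< Ci Cj (s′ , e , d) with ℕₚ.m≤n⇒m<n∨m≡n x≤i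
... | inj₁ x<i = s′ , trans (cong (λ b → s + bit b) (move-other C (ℕₚ.<⇒≢ x<i) (ℕₚ.<⇒≢ (ℕₚ.<-trans x<i i<j)))) e ,
      Dom-move m x<i i<j (subst (j <_) (ℕₚ.+-suc x m) j<) Ci Cj d
... | inj₂ refl = suc s′ , trans (cong (λ b → s + bit b) (move-i x j C))
  (trans (trans (ℕₚ.+-suc s 0) (cong suc (trans (cong (λ b → s + bit b) (sym Ci)) e))) (sym (ℕₚ.+-suc _ s′))) ,
      Dom-raise m ℕₚ.≤-refl i<j (subst (j <_) (ℕₚ.+-suc x m) j<) Cj d

Dom-refl : ∀ m {x C} → Dom 0 x m C C
Dom-refl zero    = refl
Dom-refl (suc m) {x} {C} = 0 , sym (ℕₚ.+-identityʳ (bit (C x))) , Dom-refl m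

χ : ℕ → ℕ → ℕ
χ r x = bit (r ≡ᵇ x)

χ-refl : ∀ x → χ x x ≡ 1
χ-refl x rewrite ≡ᵇ-refl x = refl

χ-≢ : ∀ {r x} → r ≢ x → χ r x ≡ 0
χ-≢ ne rewrite ≡ᵇ-false ne = refl

move-bit : ∀ {i j} C → i ≢ j → C i ≡ false → C j ≡ true → ∀ r → bit (move i j C r) + χ r j ≡ bit (C r) + χ r i
move-bit {i} {j} C i≢j Ci Cj r with r ≟ i | r ≟ j
... | yes refl | _ rewrite move-i r j C | χ-refl r | χ-≢ i≢j | Ci = refl
... | no r≢i | yes refl rewrite move-j C r≢i | χ-refl r | χ-≢ r≢i | Cj = refl
... | no r≢i | no r≢j rewrite move-other C r≢i r≢j | χ-≢ r≢i | χ-≢ r≢j = refl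

mv : Bool → ℕ → ℕ → Col → Col
mv b i j C = if b then move i j C else C

mv-bit : ∀ b {i j} C → (b ≡ true → i ≢ j × C i ≡ false × C j ≡ true) → ∀ r → bit (mv b i j C r) + bit b * χ r j ≡ bit
  (C r) + bit b * χ r i
mv-bit false C h r = refl
mv-bit true {i} {j} C h r with h refl
... | ne , Ci , Cj rewrite ℕₚ.+-identityʳ (χ r j) | ℕₚ.+-identityʳ (χ r i) = move-bit C ne Ci Cj r

cnt : (ℕ → Bool) → List ℕ → ℕ
cnt b []      = 0
cnt b (c ∷ u) = bit (b c) + cnt b u

cnt-mono : ∀ {b b′} u → (∀ c → b c ≡ true → b′ c ≡ true) → cnt b u ≤ cnt b′ u
cnt-mono []      h = z≤n
cnt-mono {b} {b′} (c ∷ u) h with b c in eq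
... | true  rewrite h c eq = s≤s (cnt-mono u h)
... | false = ℕₚ.≤-trans (cnt-mono u h) (ℕₚ.m≤n+m _ (bit (b′ c)))

cnt-strict : ∀ {b b′ q} {u} → (∀ c → b c ≡ true → b′ c ≡ true) → q ∈ u → b q ≡ false → b′ q ≡ true → cnt b u < cnt b′ u
cnt-strict {u = c ∷ u} h (here refl) bq b′q rewrite bq | b′q = s≤s (cnt-mono u h)
cnt-strict {b} {b′} {u = c ∷ u} h (there q∈) bq b′q with b c in eq
... | true  rewrite h c eq = s≤s (cnt-strict h q∈ bq b′q)
... | false = ℕₚ.≤-trans (cnt-strict h q∈ bq b′q) (ℕₚ.m≤n+m _ (bit (b′ c)))

cnt-pos : ∀ {b q} {u} → q ∈ u → b q ≡ true → 0 < cnt b u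
cnt-pos (here refl) bq rewrite bq = s≤s z≤n
cnt-pos {b} {u = c ∷ u} (there q∈) bq = ℕₚ.≤-trans (cnt-pos q∈ bq) (ℕₚ.m≤n+m _ (bit (b c)))

cnt-false : ∀ u → cnt (λ _ → false) u ≡ 0
cnt-false []      = refl
cnt-false (_ ∷ u) = cnt-false u

∧-true : ∀ {a b} → a ∧ b ≡ true → a ≡ true × b ≡ true
∧-true {true} {true} _ = refl , refl

not-true : ∀ {a} → not a ≡ true → a ≡ false
not-true {false} _ = refl

-- A move is made in all columns with property `P` up to `q`. When `q` itself has the property,
-- their number determines `q`, so a multiplicity can be named by a column.
upTo≤ : (ℕ → Bool) → ℕ → ℕ → Bool
upTo≤ P q c = P c ∧ (c <ᵇ suc q)

upTo≤-self : ∀ {P q} → P q ≡ true → upTo≤ P q q ≡ true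
upTo≤-self {P} {q} Pq rewrite Pq = <ᵇ-true {q} {suc q} ℕₚ.≤-refl

upTo≤-⇒ : ∀ {P q c} → upTo≤ P q c ≡ true → P c ≡ true
upTo≤-⇒ h = proj₁ (∧-true h)

cnt-upTo≤-< : ∀ {P q q′ u} → P q′ ≡ true → q′ ∈ u → q < q′ → cnt (upTo≤ P q) u < cnt (upTo≤ P q′) u
cnt-upTo≤-< {P} {q} {q′} Pq′ q′∈ q<q′ = cnt-strict mono q′∈ out (upTo≤-self {P} {q′} Pq′)
  where
  mono : ∀ c → upTo≤ P q c ≡ true → upTo≤ P q′ c ≡ true
  mono c h with ∧-true {P c} h
  ... | Pc , c≤q rewrite Pc = <ᵇ-true {c} {suc q′} (ℕₚ.≤-trans (<ᵇ⇒ {c} {suc q} c≤q) (ℕₚ.m≤n⇒m≤1+n q<q′))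
  out : upTo≤ P q q′ ≡ false
  out rewrite Pq′ = <ᵇ-false {q′} {suc q} (λ lt → ℕₚ.<⇒≱ q<q′ (ℕₚ.≤-pred lt))

cnt-upTo≤-injective : ∀ {P q q′ u} → P q ≡ true → P q′ ≡ true → q ∈ u → q′ ∈ u → cnt (upTo≤ P q) u ≡ cnt (upTo≤ P q′) u → q ≡ q′
cnt-upTo≤-injective {P} {q} {q′} Pq Pq′ q∈ q′∈ eq with ℕₚ.<-cmp q q′
... | tri< lt _ _ = ⊥-elim (ℕₚ.<-irrefl eq (cnt-upTo≤-< Pq′ q′∈ lt))
... | tri≈ _ e _  = e
... | tri> _ _ gt = ⊥-elim (ℕₚ.<-irrefl (sym eq) (cnt-upTo≤-< Pq q∈ gt))

-- q (and r) is the last column in which an element j (and l) is moved up to i (and k).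
data Conf : Set where
  none : Conf
  one  : (i j q : ℕ) → Conf
  two  : (i j k l q r : ℕ) → Conf

-- The difference of v and c is that of p and m, and a difference with one part zero can be written
-- in only one such way. The additive form avoids truncated subtraction.
split-signed : ∀ {v c p m p′ m′} → v + m ≡ c + p → v + m′ ≡ c + p′ → p ≡ 0 ⊎ m ≡ 0 → p′ ≡ 0 ⊎ m′ ≡ 0 → p ≡ p′ × m ≡ m′
split-signed {v} {c} {p} {m} {p′} {m′} h h′ d d′ = go d d′
  where
  key : p + m′ ≡ p′ + m
  key = ℕₚ.+-cancelˡ-≡ c _ _ (begin
    c + (p + m′)  ≡⟨ sym (ℕₚ.+-assoc c p m′) ⟩
    (c + p) + m′  ≡⟨ cong (_+ m′) (sym h) ⟩
    (v + m) + m′  ≡⟨ lem v m m′ ⟩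
    (v + m′) + m  ≡⟨ cong (_+ m) h′ ⟩
    (c + p′) + m  ≡⟨ ℕₚ.+-assoc c p′ m ⟩
    c + (p′ + m)  ∎)
    where
    open ≡-Reasoning
    lem : ∀ v m m′ → (v + m) + m′ ≡ (v + m′) + m
    lem = ℕ-Ring.solve-∀
  go : p ≡ 0 ⊎ m ≡ 0 → p′ ≡ 0 ⊎ m′ ≡ 0 → p ≡ p′ × m ≡ m′
  go (inj₁ refl) (inj₁ refl) = refl , sym key
  go (inj₁ refl) (inj₂ refl) = sym (ℕₚ.m+n≡0⇒m≡0 p′ (sym key)) , ℕₚ.m+n≡0⇒n≡0 p′ (sym key)
  go (inj₂ refl) (inj₁ refl) = ℕₚ.m+n≡0⇒m≡0 p key , sym (ℕₚ.m+n≡0⇒n≡0 p key)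
  go (inj₂ refl) (inj₂ refl) = trans (sym (ℕₚ.+-identityʳ p)) (trans key (ℕₚ.+-identityʳ p′)) , refl

-- The vectors code(w) + s(e_i − e_j) + t(e_k − e_l).  W is the one-line notation and u the inverse permutation, both 0-based in positions.
module Vectors (n : ℕ) (W : ℕ → ℕ) (u : List ℕ)
               (u⊆ : ∀ {c} → c ∈ u → c < n) (⊆u : ∀ {c} → c < n → c ∈ u)
               (sorted : AllPairs (λ a b → W a < W b) u) where

  Dw : ℕ → Col
  Dw c r = (r <ᵇ c) ∧ (W c <ᵇ W r)

  P : ℕ → ℕ → ℕ → Bool
  P i j c = Dw c j ∧ not (Dw c i)

  -- When both moves go to the same row i = k, a column containing l is reserved for the second one.
  P′ : ℕ → ℕ → ℕ → ℕ → ℕ → Bool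
  P′ i j k l c = P i j c ∧ not ((k ≡ᵇ i) ∧ Dw c l)

  gfill : (b₁ b₂ : ℕ → Bool) (i j k l : ℕ) → ℕ → Col
  gfill b₁ b₂ i j k l c = mv (b₂ c) k l (mv (b₁ c) i j (Dw c))

  items : (ℕ → Col) → List ℕ → List Item
  items C = map (λ c → c , C c)

  labels-items : ∀ C s → labels (items C s) ≡ s
  labels-items C s = trans (sym (map-∘ s)) (map-id s)

  -- `apart` concerns columns in which both moves are made: the first must leave the rows of the
  -- second untouched.
  record Legal (b₁ b₂ : ℕ → Bool) (i j k l : ℕ) : Set where
    field
      legal₁ : ∀ c → b₁ c ≡ true → i < j × j < n × P i j c ≡ true
      legal₂ : ∀ c → b₂ c ≡ true → k < l × l < n × P k l c ≡ true
      apart  : ∀ c → b₁ c ≡ true → b₂ c ≡ true → k ≢ i × k ≢ j × l ≢ i × l ≢ j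

  P⇒ : ∀ {i j c} → P i j c ≡ true → Dw c i ≡ false × Dw c j ≡ true
  P⇒ {i} {j} {c} h with ∧-true {Dw c j} h
  ... | a , b = not-true b , a

  module _ {b₁ b₂ : ℕ → Bool} {i j k l : ℕ} (L : Legal b₁ b₂ i j k l) where
    open Legal L

    inner-k : ∀ c → b₂ c ≡ true → mv (b₁ c) i j (Dw c) k ≡ Dw c k × mv (b₁ c) i j (Dw c) l ≡ Dw c l
    inner-k c h₂ with b₁ c in h₁
    ... | false = refl , refl
    ... | true  with apart c h₁ h₂
    ...   | ki , kj , li , lj = move-other (Dw c) ki kj , move-other (Dw c) li lj

    gfill-Dom : ∀ c → Dom 0 0 n (gfill b₁ b₂ i j k l c) (Dw c)
    gfill-Dom c = second (b₂ c) refl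
      where
      first : ∀ b → b₁ c ≡ b → Dom 0 0 n (mv b i j (Dw c)) (Dw c)
      first false h = Dom-refl n
      first true  h with legal₁ c h
      ... | i<j , j<n , p = Dom-move n z≤n i<j j<n (proj₁ (P⇒ p)) (proj₂ (P⇒ p)) (Dom-refl n)
      second : ∀ b → b₂ c ≡ b → Dom 0 0 n (mv b k l (mv (b₁ c) i j (Dw c))) (Dw c)
      second false h = first (b₁ c) refl
      second true  h with legal₂ c h
      ... | k<l , l<n , p = Dom-move n z≤n k<l l<n (trans (proj₁ (inner-k c h)) (proj₁ (P⇒ p)))
        (trans (proj₂ (inner-k c h)) (proj₂ (P⇒ p))) (first (b₁ c) refl)

    gfill-bit : ∀ c r → bit (gfill b₁ b₂ i j k l c r) + (bit (b₁ c) * χ r j + bit (b₂ c) * χ r l) ≡ bit (Dw c r) +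
      (bit (b₁ c) * χ r i + bit (b₂ c) * χ r k)
    gfill-bit c r = begin
      bit X₂ + (J + L′) ≡⟨ lem (bit X₂) J L′ ⟩
      (bit X₂ + L′) + J ≡⟨ cong (_+ J) (mv-bit (b₂ c) (mv (b₁ c) i j (Dw c)) h₂ r) ⟩
      (bit X₁ + K) + J  ≡⟨ lem′ (bit X₁) K J ⟩
      (bit X₁ + J) + K  ≡⟨ cong (_+ K) (mv-bit (b₁ c) (Dw c) h₁ r) ⟩
      (bit (Dw c r) + I) + K ≡⟨ ℕₚ.+-assoc (bit (Dw c r)) I K ⟩
      bit (Dw c r) + (I + K) ∎
      where
      open ≡-Reasoning
      X₁ X₂ : Bool
      X₁ = mv (b₁ c) i j (Dw c) r
      X₂ = gfill b₁ b₂ i j k l c r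
      I J K L′ : ℕ
      I = bit (b₁ c) * χ r i
      J = bit (b₁ c) * χ r j
      K = bit (b₂ c) * χ r k
      L′ = bit (b₂ c) * χ r l
      lem : ∀ x j l → x + (j + l) ≡ (x + l) + j
      lem = ℕ-Ring.solve-∀
      lem′ : ∀ x j l → (x + j) + l ≡ (x + l) + j
      lem′ = ℕ-Ring.solve-∀
      h₁ : b₁ c ≡ true → i ≢ j × Dw c i ≡ false × Dw c j ≡ true
      h₁ h with legal₁ c h
      ... | i<j , _ , p = ℕₚ.<⇒≢ i<j , P⇒ p
      h₂ : b₂ c ≡ true → k ≢ l × mv (b₁ c) i j (Dw c) k ≡ false × mv (b₁ c) i j (Dw c) l ≡ true
      h₂ h with legal₂ c h
      ... | k<l , _ , p = ℕₚ.<⇒≢ k<l , trans (proj₁ (inner-k c h)) (proj₁ (P⇒ p)) , trans (proj₂ (inner-k c h)) (proj₂ (P⇒ p))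

    tot-gfill : ∀ s r → tot (items (gfill b₁ b₂ i j k l) s) r + (cnt b₁ s * χ r j + cnt b₂ s * χ r l) ≡ tot (items Dw s) r +
      (cnt b₁ s * χ r i + cnt b₂ s * χ r k)
    tot-gfill []      r = refl
    tot-gfill (c ∷ s) r = begin
      (x + tx) + ((a + ca) * χ r j + (b + cb) * χ r l) ≡⟨ lem x tx a ca b cb (χ r j) (χ r l) ⟩
      (x + (a * χ r j + b * χ r l)) + (tx + (ca * χ r j + cb * χ r l)) ≡⟨ cong₂ _+_ (gfill-bit c r) (tot-gfill s r) ⟩
      (y + (a * χ r i + b * χ r k)) + (ty + (ca * χ r i + cb * χ r k)) ≡⟨ sym (lem y ty a ca b cb (χ r i) (χ r k)) ⟩
      (y + ty) + ((a + ca) * χ r i + (b + cb) * χ r k) ∎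
      where
      open ≡-Reasoning
      x y a b tx ty ca cb : ℕ
      x = bit (gfill b₁ b₂ i j k l c r)
      y = bit (Dw c r)
      a = bit (b₁ c)
      b = bit (b₂ c)
      tx = tot (items (gfill b₁ b₂ i j k l) s) r
      ty = tot (items Dw s) r
      ca = cnt b₁ s
      cb = cnt b₂ s
      lem : ∀ x tx a ca b cb p q → (x + tx) + ((a + ca) * p + (b + cb) * q) ≡ (x + (a * p + b * q)) + (tx + (ca * p + cb * q))
      lem = ℕ-Ring.solve-∀

  -- The hypothesis on positions is the invariant for tails of `u`: whatever has left the list has
  -- smaller value than everything in it. Hence the Rothe condition on values turns into membership
  -- in the tail.
  Adm-items : ∀ {C} s → AllPairs (λ a b → W a < W b) s → All (_< n) s → (∀ r → r < n → r ∈ s ⊎ All (λ c → W r < W c) s) →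
              (∀ c → Dom 0 0 n (C c) (Dw c)) → Adm (λ _ → 0) 0 n (items C s)
  Adm-items []      ap l h d = tt
  Adm-items {C} (c ∷ s) (lt ∷ ap) (c<n ∷ l) h d = Dom-cong n (λ _ _ → refl) (λ r _ → same r) (d c) , Adm-items s ap l h′ d
    where
    h′ : ∀ r → r < n → r ∈ s ⊎ All (λ c → W r < W c) s
    h′ r r<n with h r r<n
    ... | inj₁ (here refl) = inj₂ lt
    ... | inj₁ (there r∈)  = inj₁ r∈
    ... | inj₂ (_ ∷ a)     = inj₂ a
    same : ∀ r → Dw c r ≡ diag c (labels (items C s)) r
    same r rewrite labels-items C s with r <ᵇ c in r<c
    ... | false = refl
    ... | true with h r (ℕₚ.<-trans (<ᵇ⇒ r<c) c<n)
    ...   | inj₁ (here refl) = ⊥-elim (ℕₚ.<-irrefl refl (<ᵇ⇒ {r} {r} r<c))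
    ...   | inj₁ (there r∈)  = trans (<ᵇ-true (All.lookup lt r∈)) (sym (mem-true r∈))
    ...   | inj₂ (Wr<Wc ∷ a) = trans (<ᵇ-false {W c} {W r} (ℕₚ.<⇒≯ Wr<Wc))
      (sym (mem-false {r} {s} (λ r∈ → ℕₚ.<-irrefl refl (All.lookup a r∈))))

  -- An absent move is made in the empty set of columns, so that all three shapes are instances of
  -- `gfill`.
  fill : Conf → ℕ → Col
  fill none              = gfill (λ _ → false) (λ _ → false) 0 0 0 0
  fill (one i j q)       = gfill (upTo≤ (P i j) q) (λ _ → false) i j i j
  fill (two i j k l q r) = gfill (upTo≤ (P′ i j k l) q) (upTo≤ (P k l) r) i j k l

  vec : Conf → ℕ → ℕ
  vec x = tot (items (fill x) u)

  Valid : Conf → Set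
  Valid none              = ⊤
  Valid (one i j q)       = i < j × j < n × q < n × P i j q ≡ true
  Valid (two i j k l q r) = i < j × j < l × k < l × l < n × (k ≡ i ⊎ j < k) × (q < n × P′ i j k l q ≡ true) ×
    (r < n × P k l r ≡ true)

  plus minus : Conf → ℕ → ℕ
  plus none a = 0
  plus (one i j q) a = cnt (upTo≤ (P i j) q) u * χ a i
  plus (two i j k l q r) a = cnt (upTo≤ (P′ i j k l) q) u * χ a i + cnt (upTo≤ (P k l) r) u * χ a k
  minus none a = 0
  minus (one i j q) a = cnt (upTo≤ (P i j) q) u * χ a j
  minus (two i j k l q r) a = cnt (upTo≤ (P′ i j k l) q) u * χ a j + cnt (upTo≤ (P k l) r) u * χ a l

  legal-none : Legal (λ _ → false) (λ _ → false) 0 0 0 0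
  legal-none = record { legal₁ = λ _ () ; legal₂ = λ _ () ; apart = λ _ () }

  legal-one : ∀ i j q → i < j → j < n → Legal (upTo≤ (P i j) q) (λ _ → false) i j i j
  legal-one i j q i<j j<n = record { legal₁ = λ c h → i<j , j<n , upTo≤-⇒ {P i j} {q} {c} h ; legal₂ = λ _ () ; apart = λ _ _ () }

  legal-two : ∀ i j k l q r → i < j → j < l → k < l → l < n → k ≡ i ⊎ j < k → Legal (upTo≤ (P′ i j k l) q) (upTo≤ (P k l) r) i j k l
  legal-two i j k l q r i<j j<l k<l l<n d = record
    { legal₁ = λ c h → i<j , ℕₚ.<-trans j<l l<n , proj₁ (∧-true (upTo≤-⇒ {P′ i j k l} {q} {c} h))
    ; legal₂ = λ c h → k<l , l<n , upTo≤-⇒ {P k l} {r} {c} h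
    ; apart = λ c h h′ → ap c d (upTo≤-⇒ {P′ i j k l} {q} {c} h) (upTo≤-⇒ {P k l} {r} {c} h′) }
    where
    ap : ∀ c → k ≡ i ⊎ j < k → P′ i j k l c ≡ true → P k l c ≡ true → k ≢ i × k ≢ j × l ≢ i × l ≢ j
    ap c (inj₁ refl) h h′ with not-true (proj₂ (∧-true {P i j c} h)) | proj₁ (∧-true {Dw c l} h′)
    ... | x | y rewrite ≡ᵇ-refl i with trans (sym x) y
    ...   | ()
    ap c (inj₂ j<k) h h′ = ℕₚ.>⇒≢ (ℕₚ.<-trans i<j j<k) , ℕₚ.>⇒≢ j<k , ℕₚ.>⇒≢ (ℕₚ.<-trans i<j j<l) , ℕₚ.>⇒≢ j<l

  Adm-fill : ∀ x → Valid x → Adm (λ _ → 0) 0 n (items (fill x) u)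
  Adm-fill x v = Adm-items u sorted (All.tabulate u⊆) (λ r r<n → inj₁ (⊆u r<n)) (dom x v)
    where
    dom : ∀ x → Valid x → ∀ c → Dom 0 0 n (fill x c) (Dw c)
    dom none v = gfill-Dom legal-none
    dom (one i j q) (i<j , j<n , _) = gfill-Dom (legal-one i j q i<j j<n)
    dom (two i j k l q r) (i<j , j<l , k<l , l<n , d , _) = gfill-Dom (legal-two i j k l q r i<j j<l k<l l<n d)

  code : ℕ → ℕ
  code = tot (items Dw u)

  vec-balance : ∀ x → Valid x → ∀ a → vec x a + minus x a ≡ code a + plus x a
  vec-balance none v a = subst (λ z → vec none a + (z * χ a 0 + z * χ a 0) ≡ code a + (z * χ a 0 + z * χ a 0)) (cnt-false u)
    (tot-gfill legal-none u a)
  vec-balance (one i j q) (i<j , j<n , _) a = subst₂ (λ y z → vec (one i j q) a + y ≡ code a + z)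
    (drop (cnt (upTo≤ (P i j) q) u * χ a j) (χ a j)) (drop (cnt (upTo≤ (P i j) q) u * χ a i) (χ a i))
    (tot-gfill (legal-one i j q i<j j<n) u a)
    where
    drop : ∀ x y → x + cnt (λ _ → false) u * y ≡ x
    drop x y = trans (cong (λ z → x + z * y) (cnt-false u)) (ℕₚ.+-identityʳ x)
  vec-balance (two i j k l q r) (i<j , j<l , k<l , l<n , d , _) a = tot-gfill (legal-two i j k l q r i<j j<l k<l l<n d) u a

  χ-on : ∀ s x → s * χ x x ≡ s
  χ-on s x = trans (cong (s *_) (χ-refl x)) (ℕₚ.*-identityʳ s)

  χ-off : ∀ s {a x} → a ≢ x → s * χ a x ≡ 0
  χ-off s ne = trans (cong (s *_) (χ-≢ ne)) (ℕₚ.*-zeroʳ s)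

  χ-pos : ∀ s {a x} → 0 < s * χ a x → a ≡ x
  χ-pos s {a} {x} h with a ≟ x
  ... | yes p = p
  ... | no ne = ⊥-elim (ℕₚ.<-irrefl (sym (χ-off s ne)) h)

  χ-pos₂ : ∀ s t {a x y} → 0 < s * χ a x + t * χ a y → a ≡ x ⊎ a ≡ y
  χ-pos₂ s t {a} {x} {y} h with a ≟ x | a ≟ y
  ... | yes p | _     = inj₁ p
  ... | _     | yes p = inj₂ p
  ... | no p  | no q  = ⊥-elim (ℕₚ.<-irrefl (sym (cong₂ _+_ (χ-off s p) (χ-off t q))) h)

  Down Up : Conf → ℕ → Set
  Down none a              = ⊥
  Down (one i j q) a       = a ≡ j
  Down (two i j k l q r) a = a ≡ j ⊎ a ≡ l
  Up none a              = ⊥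
  Up (one i j q) a       = a ≡ i
  Up (two i j k l q r) a = a ≡ i ⊎ a ≡ k

  minus-support : ∀ x a → 0 < minus x a → Down x a
  minus-support none a ()
  minus-support (one i j q) a h       = χ-pos (cnt (upTo≤ (P i j) q) u) h
  minus-support (two i j k l q r) a h = χ-pos₂ (cnt (upTo≤ (P′ i j k l) q) u) (cnt (upTo≤ (P k l) r) u) h

  plus-support : ∀ x a → 0 < plus x a → Up x a
  plus-support none a ()
  plus-support (one i j q) a h       = χ-pos (cnt (upTo≤ (P i j) q) u) h
  plus-support (two i j k l q r) a h = χ-pos₂ (cnt (upTo≤ (P′ i j k l) q) u) (cnt (upTo≤ (P k l) r) u) h

  σ₁ : ℕ → ℕ → ℕ → ℕ
  σ₁ i j q = cnt (upTo≤ (P i j) q) u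

  σ₂ : ℕ → ℕ → ℕ → ℕ → ℕ → ℕ
  σ₂ i j k l q = cnt (upTo≤ (P′ i j k l) q) u

  disjoint : ∀ x → Valid x → ∀ a → plus x a ≡ 0 ⊎ minus x a ≡ 0
  disjoint none v a = inj₁ refl
  disjoint (one i j q) (i<j , _) a with a ≟ i
  ... | yes refl = inj₂ (χ-off (σ₁ i j q) (ℕₚ.<⇒≢ i<j))
  ... | no ne    = inj₁ (χ-off (σ₁ i j q) ne)
  disjoint (two i j k l q r) (i<j , j<l , k<l , _ , d , _) a with a ≟ i | a ≟ k
  ... | yes refl | _ = inj₂ (cong₂ _+_ (χ-off (σ₂ i j k l q) (ℕₚ.<⇒≢ i<j)) (χ-off (σ₁ k l r) (ℕₚ.<⇒≢ (ℕₚ.<-trans i<j j<l))))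
  ... | no _ | yes refl = inj₂ (cong₂ _+_ (χ-off (σ₂ i j k l q) (k≢j d)) (χ-off (σ₁ k l r) (ℕₚ.<⇒≢ k<l)))
    where
    k≢j : k ≡ i ⊎ j < k → k ≢ j
    k≢j (inj₁ refl) = ℕₚ.<⇒≢ i<j
    k≢j (inj₂ j<k)  = ℕₚ.>⇒≢ j<k
  ... | no i≢ | no k≢ = inj₁ (cong₂ _+_ (χ-off (σ₂ i j k l q) i≢) (χ-off (σ₁ k l r) k≢))

  σ₁-pos : ∀ i j q → q < n → P i j q ≡ true → 0 < σ₁ i j q
  σ₁-pos i j q q<n Pq = cnt-pos (⊆u q<n) (upTo≤-self {P i j} {q} Pq)

  σ₂-pos : ∀ i j k l q → q < n → P′ i j k l q ≡ true → 0 < σ₂ i j k l q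
  σ₂-pos i j k l q q<n Pq = cnt-pos (⊆u q<n) (upTo≤-self {P′ i j k l} {q} Pq)

  posˡ : ∀ s x → 0 < s → ∀ t → 0 < s * χ x x + t
  posˡ s x p t = ℕₚ.≤-trans (subst (0 <_) (sym (χ-on s x)) p) (ℕₚ.m≤m+n (s * χ x x) t)

  posʳ : ∀ s x → 0 < s → ∀ t → 0 < t + s * χ x x
  posʳ s x p t = ℕₚ.≤-trans (subst (0 <_) (sym (χ-on s x)) p) (ℕₚ.m≤n+m (s * χ x x) t)

  module Signs (i j k l q r : ℕ) (v : Valid (two i j k l q r)) where
    i<j : i < j
    i<j = proj₁ v
    j<l : j < l
    j<l = proj₁ (proj₂ v)
    k<l : k < l
    k<l = proj₁ (proj₂ (proj₂ v))
    l<n : l < n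
    l<n = proj₁ (proj₂ (proj₂ (proj₂ v)))
    j<n : j < n
    j<n = ℕₚ.<-trans j<l l<n
    i<n : i < n
    i<n = ℕₚ.<-trans i<j j<n
    k<n : k < n
    k<n = ℕₚ.<-trans k<l l<n
    q-ok : q < n × P′ i j k l q ≡ true
    q-ok = proj₁ (proj₂ (proj₂ (proj₂ (proj₂ (proj₂ v)))))
    r-ok : r < n × P k l r ≡ true
    r-ok = proj₂ (proj₂ (proj₂ (proj₂ (proj₂ (proj₂ v)))))
    i≤k : i ≤ k
    i≤k with proj₁ (proj₂ (proj₂ (proj₂ (proj₂ v))))
    ... | inj₁ refl = ℕₚ.≤-refl
    ... | inj₂ j<k  = ℕₚ.<⇒≤ (ℕₚ.<-trans i<j j<k)
    -j : 0 < minus (two i j k l q r) j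
    -j = posˡ (σ₂ i j k l q) j (σ₂-pos i j k l q (proj₁ q-ok) (proj₂ q-ok)) (σ₁ k l r * χ j l)
    +i : 0 < plus (two i j k l q r) i
    +i = posˡ (σ₂ i j k l q) i (σ₂-pos i j k l q (proj₁ q-ok) (proj₂ q-ok)) (σ₁ k l r * χ i k)
    -l : 0 < minus (two i j k l q r) l
    -l = posʳ (σ₁ k l r) l (σ₁-pos k l r (proj₁ r-ok) (proj₂ r-ok)) (σ₂ i j k l q * χ l j)
    +k : 0 < plus (two i j k l q r) k
    +k = posʳ (σ₁ k l r) k (σ₁-pos k l r (proj₁ r-ok) (proj₂ r-ok)) (σ₂ i j k l q * χ k i)
    at-j : minus (two i j k l q r) j ≡ σ₂ i j k l q
    at-j = trans (cong₂ _+_ (χ-on (σ₂ i j k l q) j) (χ-off (σ₁ k l r) (ℕₚ.<⇒≢ j<l))) (ℕₚ.+-identityʳ (σ₂ i j k l q))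
    at-l : minus (two i j k l q r) l ≡ σ₁ k l r
    at-l = cong₂ _+_ (χ-off (σ₂ i j k l q) (ℕₚ.>⇒≢ j<l)) (χ-on (σ₁ k l r) l)

  ∈-≤ : ∀ {i k x} → i ≤ k → x ≡ i ⊎ x ≡ k → i ≤ x × x ≤ k
  ∈-≤ i≤k (inj₁ refl) = ℕₚ.≤-refl , i≤k
  ∈-≤ i≤k (inj₂ refl) = i≤k , ℕₚ.≤-refl

  -- Raised and lowered rows are disjoint, so `plus` and `minus` can be recovered. Their supports
  -- give the rows, and i ≤ k and j < l assign the roles. The multiplicities are read from `minus`,
  -- where j and l stay apart even when i = k; they determine q and r.
  vec-injective : ∀ x y → Valid x → Valid y → (∀ a → a < n → vec x a ≡ vec y a) → x ≡ y
  vec-injective x y v v′ h = go x y v v′ (λ a a<n → proj₁ (both a a<n)) (λ a a<n → proj₂ (both a a<n))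
    where
    both : ∀ a → a < n → plus x a ≡ plus y a × minus x a ≡ minus y a
    both a a<n = split-signed (vec-balance x v a) (trans (cong (_+ minus y a) (h a a<n)) (vec-balance y v′ a))
      (disjoint x v a) (disjoint y v′ a)
    one≢two : ∀ i j q i′ j′ k l q′ r → Valid (two i′ j′ k l q′ r) → (∀ a → a < n → minus (one i j q) a ≡ minus
      (two i′ j′ k l q′ r) a) → ⊥
    one≢two i j q i′ j′ k l q′ r v m = ℕₚ.<⇒≢ j<l (trans (minus-support (one i j q) j′ (subst (0 <_) (sym (m j′ j<n)) -j))
                                                   (sym (minus-support (one i j q) l (subst (0 <_) (sym (m l l<n)) -l))))
      where open Signs i′ j′ k l q′ r v
    go : ∀ x y → Valid x → Valid y → (∀ a → a < n → plus x a ≡ plus y a) → (∀ a → a < n → minus x a ≡ minus y a) → x ≡ y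
    go none none v v′ p m = refl
    go none (one i j q) v (i<j , j<n , q<n , Pq) p m = ⊥-elim (ℕₚ.<-irrefl (trans (m j j<n) (χ-on (σ₁ i j q) j))
      (σ₁-pos i j q q<n Pq))
    go (one i j q) none (i<j , j<n , q<n , Pq) v p m = ⊥-elim (ℕₚ.<-irrefl (trans (sym (m j j<n)) (χ-on (σ₁ i j q) j))
      (σ₁-pos i j q q<n Pq))
    go none (two i j k l q r) v v′ p m = ⊥-elim (ℕₚ.<-irrefl (m j j<n) -j)
      where open Signs i j k l q r v′
    go (two i j k l q r) none v v′ p m = ⊥-elim (ℕₚ.<-irrefl (sym (m j j<n)) -j)
      where open Signs i j k l q r v
    go (one i j q) (one i′ j′ q′) (i<j , j<n , q<n , Pq) (i′<j′ , j′<n , q′<n , Pq′) p m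
      with minus-support (one i′ j′ q′) j (subst (0 <_) (trans (sym (χ-on (σ₁ i j q) j)) (m j j<n)) (σ₁-pos i j q q<n Pq))
         | plus-support (one i′ j′ q′) i (subst (0 <_) (trans (sym (χ-on (σ₁ i j q) i)) (p i (ℕₚ.<-trans i<j j<n)))
           (σ₁-pos i j q q<n Pq))
    ... | refl | refl = cong (one i j) (cnt-upTo≤-injective {P i j} Pq Pq′ (⊆u q<n) (⊆u q′<n)
      (trans (sym (χ-on (σ₁ i j q) j)) (trans (m j j<n) (χ-on (σ₁ i j q′) j))))
    go (one i j q) (two i′ j′ k l q′ r) v v′ p m = ⊥-elim (one≢two i j q i′ j′ k l q′ r v′ m)
    go (two i′ j′ k l q′ r) (one i j q) v v′ p m = ⊥-elim (one≢two i j q i′ j′ k l q′ r v (λ a a<n → sym (m a a<n)))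
    go x@(two i j k l q r) y@(two i′ j′ k′ l′ q′ r′) v v′ p m = finish i≡ j≡ k≡ l≡
      where
      module A = Signs i j k l q r v
      module B = Signs i′ j′ k′ l′ q′ r′ v′
      j∈ = ∈-≤ (ℕₚ.<⇒≤ B.j<l) (minus-support y j (subst (0 <_) (m j A.j<n) A.-j))
      l∈ = ∈-≤ (ℕₚ.<⇒≤ B.j<l) (minus-support y l (subst (0 <_) (m l A.l<n) A.-l))
      j′∈ = ∈-≤ (ℕₚ.<⇒≤ A.j<l) (minus-support x j′ (subst (0 <_) (sym (m j′ B.j<n)) B.-j))
      l′∈ = ∈-≤ (ℕₚ.<⇒≤ A.j<l) (minus-support x l′ (subst (0 <_) (sym (m l′ B.l<n)) B.-l))
      i∈ = ∈-≤ B.i≤k (plus-support y i (subst (0 <_) (p i A.i<n) A.+i))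
      k∈ = ∈-≤ B.i≤k (plus-support y k (subst (0 <_) (p k A.k<n) A.+k))
      i′∈ = ∈-≤ A.i≤k (plus-support x i′ (subst (0 <_) (sym (p i′ B.i<n)) B.+i))
      k′∈ = ∈-≤ A.i≤k (plus-support x k′ (subst (0 <_) (sym (p k′ B.k<n)) B.+k))
      i≡ : i ≡ i′
      i≡ = ℕₚ.≤-antisym (proj₁ i′∈) (proj₁ i∈)
      k≡ : k ≡ k′
      k≡ = ℕₚ.≤-antisym (proj₂ k∈) (proj₂ k′∈)
      j≡ : j ≡ j′
      j≡ = ℕₚ.≤-antisym (proj₁ j′∈) (proj₁ j∈)
      l≡ : l ≡ l′
      l≡ = ℕₚ.≤-antisym (proj₂ l∈) (proj₂ l′∈)
      finish : i ≡ i′ → j ≡ j′ → k ≡ k′ → l ≡ l′ → two i j k l q r ≡ two i′ j′ k′ l′ q′ r′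
      finish refl refl refl refl = cong₂ (two i j k l)
        (cnt-upTo≤-injective {P′ i j k l} (proj₂ A.q-ok) (proj₂ B.q-ok) (⊆u (proj₁ A.q-ok)) (⊆u (proj₁ B.q-ok))
          (trans (sym A.at-j) (trans (m j A.j<n) B.at-j)))
        (cnt-upTo≤-injective {P k l} (proj₂ A.r-ok) (proj₂ B.r-ok) (⊆u (proj₁ A.r-ok)) (⊆u (proj₁ B.r-ok))
          (trans (sym A.at-l) (trans (m l A.l<n) B.at-l)))

-- Increasing lists of positions and their tags

range-sorted : ∀ g m → AllPairs _<_ (range g m)
range-sorted g zero    = []
range-sorted g (suc m) = All.tabulate (λ r∈ → proj₁ (∈-range⁻ r∈)) ∷ range-sorted (suc g) m

choose-All : ∀ {Q : ℕ → Set} k {xs} → AllPairs _<_ xs → All Q xs → All (λ ys → AllPairs _<_ ys × All Q ys × length ys ≡ k)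
  (choose k xs)
choose-All zero    _        _        = ([] , [] , refl) ∷ []
choose-All (suc k) []       []       = []
choose-All {Q} (suc k) (x< ∷ ap) (q ∷ qs) = All.++⁺
  (All.map⁺ (All.map (λ (a , h , l) → All.map proj₁ h ∷ a , q ∷ All.map proj₂ h , cong suc l)
    (choose-All k ap (All.zip (x< , qs)))))
  (choose-All (suc k) ap qs)

choose-Unique : ∀ k {xs} → AllPairs _<_ xs → Unique (choose k xs)
choose-Unique zero    _  = [] ∷ []
choose-Unique (suc k) [] = []
choose-Unique (suc k) {x ∷ xs} (x< ∷ ap) = Unique.++⁺ (Unique.map⁺ ∷-injectiveʳ (choose-Unique k ap))
  (choose-Unique (suc k) ap) disj
  where
  disj : ∀ {v} → v ∈ map (x ∷_) (choose k xs) × v ∈ choose (suc k) xs → ⊥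
  disj (v∈ , v∈′) with ∈-map⁻ (x ∷_) v∈
  ... | ys , _ , refl with All.lookup (choose-All (suc k) ap x<) v∈′
  ...   | _ , x<x ∷ _ , _ = ℕₚ.<-irrefl refl x<x

choose-map : ∀ (f : ℕ → ℕ) k xs → choose k (map f xs) ≡ map (map f) (choose k xs)
choose-map f zero    xs       = refl
choose-map f (suc k) []       = refl
choose-map f (suc k) (x ∷ xs) = trans (cong₂ (λ a b → map (f x ∷_) a ++ b) (choose-map f k xs) (choose-map f (suc k) xs))
  (trans (cong (_++ map (map f) (choose (suc k) xs)) (trans (sym (map-∘ (choose k xs))) (map-∘ (choose k xs))))
    (sym (map-++ (map f) (map (x ∷_) (choose k xs)) (choose (suc k) xs))))

-- pA stands for the six patterns i j q k r with values i < q < j and i < r < k, pC and pD for 15342 and 15324;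
-- in p3k, p3l, p3r the elements j and l move to i and k, and q is k, l or r.
data Tag : Set where
  ∅ p132 p1432 pA pC pD p3k p3l p3r : Tag

tags : List Tag
tags = ∅ ∷ p132 ∷ p1432 ∷ pA ∷ pC ∷ pD ∷ p3k ∷ p3l ∷ p3r ∷ []

tags-Unique : Unique tags
tags-Unique = ((λ ()) ∷ (λ ()) ∷ (λ ()) ∷ (λ ()) ∷ (λ ()) ∷ (λ ()) ∷ (λ ()) ∷ (λ ()) ∷ []) ∷
  ((λ ()) ∷ (λ ()) ∷ (λ ()) ∷ (λ ()) ∷ (λ ()) ∷ (λ ()) ∷ (λ ()) ∷ []) ∷
  ((λ ()) ∷ (λ ()) ∷ (λ ()) ∷ (λ ()) ∷ (λ ()) ∷ (λ ()) ∷ []) ∷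
  ((λ ()) ∷ (λ ()) ∷ (λ ()) ∷ (λ ()) ∷ (λ ()) ∷ []) ∷
  ((λ ()) ∷ (λ ()) ∷ (λ ()) ∷ (λ ()) ∷ []) ∷
  ((λ ()) ∷ (λ ()) ∷ (λ ()) ∷ []) ∷ ((λ ()) ∷ (λ ()) ∷ []) ∷ ((λ ()) ∷ []) ∷ [] ∷ []

size : Tag → ℕ
size ∅     = 0
size p132  = 3
size p1432 = 4
size _     = 5

conf : Tag → List ℕ → Conf
conf p132  (i ∷ j ∷ q ∷ [])         = one i j q
conf p1432 (i ∷ j ∷ k ∷ r ∷ [])     = two i j i k k r
conf pA    (i ∷ j ∷ q ∷ k ∷ r ∷ []) = two i j i k q r
conf pC    (i ∷ j ∷ k ∷ q ∷ r ∷ []) = two i j i k q r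
conf pD    (i ∷ j ∷ k ∷ r ∷ q ∷ []) = two i j i k q r
conf p3k   (i ∷ j ∷ k ∷ l ∷ r ∷ []) = two i j k l k r
conf p3l   (i ∷ j ∷ k ∷ l ∷ r ∷ []) = two i j k l l r
conf p3r   (i ∷ j ∷ k ∷ l ∷ r ∷ []) = two i j k l r r
conf _     _                        = none

-- m < x < M for distinct values, given m < x and M < x as Booleans.
between : (m<x M<x : Bool) → Bool
between m<x M<x = m<x ∧ not M<x

-- When both moves go to row i, column q must not contain the lowered row of the second move, called
-- k here. In `p1432` and `pA` this holds because q does not lie to the right of k; in `pC` and `pD`
-- the value at q exceeds that at k.
cond : Tag → List ℕ → Bool
cond ∅     []                       = true
cond p132  (i ∷ j ∷ q ∷ [])         = between (i <ᵇ q) (j <ᵇ q)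
cond p1432 (i ∷ j ∷ k ∷ r ∷ [])     = between (i <ᵇ r) (k <ᵇ r) ∧ between (i <ᵇ k) (j <ᵇ k)
cond pA    (i ∷ j ∷ q ∷ k ∷ r ∷ []) = between (i <ᵇ q) (j <ᵇ q) ∧ between (i <ᵇ r) (k <ᵇ r)
cond pC    (i ∷ j ∷ k ∷ q ∷ r ∷ []) = between (i <ᵇ r) (k <ᵇ r) ∧ (between (k <ᵇ q) (j <ᵇ q) ∧ (i <ᵇ q))
cond pD    (i ∷ j ∷ k ∷ r ∷ q ∷ []) = between (i <ᵇ r) (k <ᵇ r) ∧ (between (k <ᵇ q) (j <ᵇ q) ∧ (i <ᵇ q))
cond p3k   (i ∷ j ∷ k ∷ l ∷ r ∷ []) = between (i <ᵇ k) (j <ᵇ k) ∧ between (k <ᵇ r) (l <ᵇ r)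
cond p3l   (i ∷ j ∷ k ∷ l ∷ r ∷ []) = between (i <ᵇ l) (j <ᵇ l) ∧ between (k <ᵇ r) (l <ᵇ r)
cond p3r   (i ∷ j ∷ k ∷ l ∷ r ∷ []) = between (i <ᵇ r) (j <ᵇ r) ∧ between (k <ᵇ r) (l <ᵇ r)
cond _     _                        = false

-- A left inverse of `conf` on increasing lists. Equality of k and i separates the two kinds of
-- double move; within each kind the place of q among the other positions reveals the tag.
decode : Conf → Tag × List ℕ
decode none              = ∅ , []
decode (one i j q)       = p132 , i ∷ j ∷ q ∷ []
decode (two i j k l q r) =
  if k ≡ᵇ i
  then (if q <ᵇ l then (pA , i ∷ j ∷ q ∷ l ∷ r ∷ [])
        else if q ≡ᵇ l then (p1432 , i ∷ j ∷ l ∷ r ∷ [])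
        else if q <ᵇ r then (pC , i ∷ j ∷ l ∷ q ∷ r ∷ [])
        else (pD , i ∷ j ∷ l ∷ r ∷ q ∷ []))
  else (if q ≡ᵇ k then (p3k , i ∷ j ∷ k ∷ l ∷ r ∷ [])
        else if q ≡ᵇ l then (p3l , i ∷ j ∷ k ∷ l ∷ r ∷ [])
        else (p3r , i ∷ j ∷ k ∷ l ∷ r ∷ []))

decode-conf : ∀ t xs → AllPairs _<_ xs → length xs ≡ size t → decode (conf t xs) ≡ (t , xs)
decode-conf ∅     [] _ _ = refl
decode-conf p132  (i ∷ j ∷ q ∷ []) _ _ = refl
decode-conf p1432 (i ∷ j ∷ k ∷ r ∷ []) _ _ rewrite ≡ᵇ-refl i | <ᵇ-false {k} {k} (ℕₚ.<-irrefl refl) | ≡ᵇ-refl k = refl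
decode-conf pA    (i ∷ j ∷ q ∷ k ∷ r ∷ []) (_ ∷ _ ∷ (q<k ∷ _) ∷ _) _ rewrite ≡ᵇ-refl i | <ᵇ-true q<k = refl
decode-conf pC    (i ∷ j ∷ k ∷ q ∷ r ∷ []) (_ ∷ _ ∷ (k<q ∷ _) ∷ (q<r ∷ _) ∷ _) _
  rewrite ≡ᵇ-refl i | <ᵇ-false {q} {k} (ℕₚ.<⇒≯ k<q) | ≡ᵇ-false (ℕₚ.>⇒≢ k<q) | <ᵇ-true q<r = refl
decode-conf pD    (i ∷ j ∷ k ∷ r ∷ q ∷ []) (_ ∷ _ ∷ (_ ∷ k<q ∷ _) ∷ (r<q ∷ _) ∷ _) _
  rewrite ≡ᵇ-refl i | <ᵇ-false {q} {k} (ℕₚ.<⇒≯ k<q) | ≡ᵇ-false (ℕₚ.>⇒≢ k<q) | <ᵇ-false {q} {r} (ℕₚ.<⇒≯ r<q) = refl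
decode-conf p3k   (i ∷ j ∷ k ∷ l ∷ r ∷ []) ((_ ∷ i<k ∷ _) ∷ _) _ rewrite ≡ᵇ-false (ℕₚ.>⇒≢ i<k) | ≡ᵇ-refl k = refl
decode-conf p3l   (i ∷ j ∷ k ∷ l ∷ r ∷ []) ((_ ∷ i<k ∷ _) ∷ _ ∷ (k<l ∷ _) ∷ _) _ rewrite ≡ᵇ-false (ℕₚ.>⇒≢ i<k) | ≡ᵇ-false
  (ℕₚ.>⇒≢ k<l) | ≡ᵇ-refl l = refl
decode-conf p3r   (i ∷ j ∷ k ∷ l ∷ r ∷ []) ((_ ∷ i<k ∷ _) ∷ _ ∷ (_ ∷ k<r ∷ _) ∷ (l<r ∷ _) ∷ _) _
  rewrite ≡ᵇ-false (ℕₚ.>⇒≢ i<k) | ≡ᵇ-false (ℕₚ.>⇒≢ k<r) | ≡ᵇ-false (ℕₚ.>⇒≢ l<r) = refl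

-- Exponent vectors indexed by occurrences

module Occurrences (n : ℕ) (W : ℕ → ℕ) (W-injective : ∀ {a b} → a < n → b < n → W a ≡ W b → a ≡ b) (u : List ℕ)
                   (u⊆ : ∀ {c} → c ∈ u → c < n) (⊆u : ∀ {c} → c < n → c ∈ u)
                   (sorted : AllPairs (λ a b → W a < W b) u) where
  open Vectors n W u u⊆ ⊆u sorted

  Occurs : Tag × List ℕ → Set
  Occurs (t , xs) = AllPairs _<_ xs × All (_< n) xs × length xs ≡ size t × cond t (map W xs) ≡ true

  D-in : ∀ {a c} → a < c → c < n → (W a <ᵇ W c) ≡ false → Dw c a ≡ true
  D-in {a} {c} a<c c<n h rewrite <ᵇ-true a<c = <ᵇ-true (ℕₚ.≤∧≢⇒< (ℕₚ.≮⇒≥ {W a} {W c} (λ lt → f≢t (trans (sym h) (<ᵇ-true lt))))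
                                    (λ e → ℕₚ.<-irrefl (sym (W-injective c<n (ℕₚ.<-trans a<c c<n) e)) a<c))
    where
    f≢t : false ≢ true
    f≢t ()

  D-out : ∀ {a c} → (W a <ᵇ W c) ≡ true → Dw c a ≡ false
  D-out {a} {c} h rewrite <ᵇ-false {W c} {W a} (ℕₚ.<⇒≯ (<ᵇ⇒ {W a} {W c} h)) with a <ᵇ c
  ... | true  = refl
  ... | false = refl

  D-late : ∀ {a c} → c ≤ a → Dw c a ≡ false
  D-late {a} {c} c≤a rewrite <ᵇ-false {a} {c} (ℕₚ.≤⇒≯ c≤a) = refl

  P-between : ∀ {i j q} → j < q → q < n → between (W i <ᵇ W q) (W j <ᵇ W q) ≡ true → P i j q ≡ true
  P-between {i} {j} {q} j<q q<n h with ∧-true {W i <ᵇ W q} h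
  ... | i<q , nj rewrite D-in j<q q<n (not-true nj) | D-out {i} {q} i<q = refl

  P′-out : ∀ {i j k l q} → P i j q ≡ true → Dw q l ≡ false → P′ i j k l q ≡ true
  P′-out {i} {j} {k} h d rewrite h | d with k ≡ᵇ i
  ... | true  = refl
  ... | false = refl

  P′-≢ : ∀ {i j k l q} → P i j q ≡ true → i < k → P′ i j k l q ≡ true
  P′-≢ h i<k rewrite h | ≡ᵇ-false (ℕₚ.>⇒≢ i<k) = refl

  occurs-Valid : ∀ t xs → Occurs (t , xs) → Valid (conf t xs)
  occurs-Valid ∅ [] _ = tt
  occurs-Valid p132 (i ∷ j ∷ q ∷ []) ((i<j ∷ _ ∷ []) ∷ (j<q ∷ []) ∷ _ , (_ ∷ j<n ∷ q<n ∷ []) , _ , h) =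
    i<j , j<n , q<n , P-between j<q q<n h
  occurs-Valid p1432 (i ∷ j ∷ k ∷ r ∷ []) ((i<j ∷ i<k ∷ _) ∷ (j<k ∷ _) ∷ (k<r ∷ []) ∷ _ , (_ ∷ j<n ∷ k<n ∷ r<n ∷ []) , _ , h)
    with ∧-true {between (W i <ᵇ W r) (W k <ᵇ W r)} h
  ... | h₁ , h₂ = i<j , j<k , i<k , k<n , inj₁ refl , (k<n , P′-out {i} {j} {i} (P-between j<k k<n h₂)
    (D-late {k} {k} ℕₚ.≤-refl)) , (r<n , P-between k<r r<n h₁)
  occurs-Valid pA (i ∷ j ∷ q ∷ k ∷ r ∷ []) ((i<j ∷ i<q ∷ i<k ∷ _) ∷ (j<q ∷ j<k ∷ _) ∷ (q<k ∷ _) ∷ (k<r ∷ []) ∷ _ ,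
    (_ ∷ _ ∷ q<n ∷ k<n ∷ r<n ∷ []) , _ , h) with ∧-true {between (W i <ᵇ W q) (W j <ᵇ W q)} h
  ... | h₁ , h₂ = i<j , j<k , i<k , k<n , inj₁ refl , (q<n , P′-out {i} {j} {i} (P-between j<q q<n h₁)
    (D-late {k} {q} (ℕₚ.<⇒≤ q<k))) , (r<n , P-between k<r r<n h₂)
  occurs-Valid pC (i ∷ j ∷ k ∷ q ∷ r ∷ []) ((i<j ∷ i<k ∷ _) ∷ (j<k ∷ j<q ∷ _) ∷ (k<q ∷ k<r ∷ []) ∷ _ ,
    (_ ∷ _ ∷ k<n ∷ q<n ∷ r<n ∷ []) , _ , h) with ∧-true {between (W i <ᵇ W r) (W k <ᵇ W r)} h
  ... | h₁ , h₂ with ∧-true {between (W k <ᵇ W q) (W j <ᵇ W q)} h₂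
  ...   | h₃ , h₄ = i<j , j<k , i<k , k<n , inj₁ refl ,
    (q<n , P′-out {i} {j} {i} (P-between j<q q<n (cong₂ _∧_ h₄ (proj₂ (∧-true {W k <ᵇ W q} h₃))))
    (D-out {k} {q} (proj₁ (∧-true {W k <ᵇ W q} h₃)))) , (r<n , P-between k<r r<n h₁)
  occurs-Valid pD (i ∷ j ∷ k ∷ r ∷ q ∷ []) ((i<j ∷ i<k ∷ _) ∷ (j<k ∷ _ ∷ j<q ∷ _) ∷ (k<r ∷ k<q ∷ []) ∷ _ ,
    (_ ∷ _ ∷ k<n ∷ r<n ∷ q<n ∷ []) , _ , h) with ∧-true {between (W i <ᵇ W r) (W k <ᵇ W r)} h
  ... | h₁ , h₂ with ∧-true {between (W k <ᵇ W q) (W j <ᵇ W q)} h₂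
  ...   | h₃ , h₄ = i<j , j<k , i<k , k<n , inj₁ refl ,
    (q<n , P′-out {i} {j} {i} (P-between j<q q<n (cong₂ _∧_ h₄ (proj₂ (∧-true {W k <ᵇ W q} h₃))))
    (D-out {k} {q} (proj₁ (∧-true {W k <ᵇ W q} h₃)))) , (r<n , P-between k<r r<n h₁)
  occurs-Valid p3k (i ∷ j ∷ k ∷ l ∷ r ∷ []) ((i<j ∷ i<k ∷ _) ∷ (j<k ∷ j<l ∷ _) ∷ (k<l ∷ k<r ∷ []) ∷ (l<r ∷ []) ∷ _ ,
    (_ ∷ _ ∷ k<n ∷ l<n ∷ r<n ∷ []) , _ , h) with ∧-true {between (W i <ᵇ W k) (W j <ᵇ W k)} h
  ... | h₁ , h₂ = i<j , j<l , k<l , l<n , inj₂ j<k , (k<n , P′-≢ {i} {j} {k} (P-between j<k k<n h₁) i<k) ,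
    (r<n , P-between l<r r<n h₂)
  occurs-Valid p3l (i ∷ j ∷ k ∷ l ∷ r ∷ []) ((i<j ∷ i<k ∷ _) ∷ (j<k ∷ j<l ∷ _) ∷ (k<l ∷ k<r ∷ []) ∷ (l<r ∷ []) ∷ _ ,
    (_ ∷ _ ∷ k<n ∷ l<n ∷ r<n ∷ []) , _ , h) with ∧-true {between (W i <ᵇ W l) (W j <ᵇ W l)} h
  ... | h₁ , h₂ = i<j , j<l , k<l , l<n , inj₂ j<k , (l<n , P′-≢ {i} {j} {k} (P-between j<l l<n h₁) i<k) ,
    (r<n , P-between l<r r<n h₂)
  occurs-Valid p3r (i ∷ j ∷ k ∷ l ∷ r ∷ []) ((i<j ∷ i<k ∷ _) ∷ (j<k ∷ j<l ∷ j<r ∷ []) ∷ (k<l ∷ k<r ∷ []) ∷ (l<r ∷ []) ∷ _ ,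
    (_ ∷ _ ∷ k<n ∷ l<n ∷ r<n ∷ []) , _ , h) with ∧-true {between (W i <ᵇ W r) (W j <ᵇ W r)} h
  ... | h₁ , h₂ = i<j , j<l , k<l , l<n , inj₂ j<k , (r<n , P′-≢ {i} {j} {k} (P-between j<r r<n h₁) i<k) ,
    (r<n , P-between l<r r<n h₂)

  positions : List ℕ
  positions = range 0 n

  occurrences : Tag → List (Tag × List ℕ)
  occurrences t = map (t ,_) (filterᵇ (cond t ∘ map W) (choose (size t) positions))

  occurrences-Occurs : ∀ t → All Occurs (occurrences t)
  occurrences-Occurs t = All.map⁺ (All.map (λ ((a , b , c) , d) → a , b , c , Equivalence.to T-≡ d) 
    (All.zip (All.filter⁺ c? valid , All.all-filter c? (choose (size t) positions))))
    where
    c? = T? ∘ cond t ∘ map W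
    valid = choose-All (size t) (range-sorted 0 n) (All.tabulate (λ r∈ → proj₂ (∈-range⁻ r∈)))

  occurrences-Unique : ∀ t → Unique (occurrences t)
  occurrences-Unique t = Unique.map⁺ (cong proj₂) (Unique.filter⁺ (T? ∘ cond t ∘ map W) (choose-Unique (size t) (range-sorted 0 n)))

  all-Occurs : ∀ ts → All Occurs (concatMap occurrences ts)
  all-Occurs []       = []
  all-Occurs (t ∷ ts) = All.++⁺ (occurrences-Occurs t) (all-Occurs ts)

  tagged : ∀ ts {x} → x ∈ concatMap occurrences ts → proj₁ x ∈ ts
  tagged (t ∷ ts) x∈ with ∈-++⁻ (occurrences t) x∈
  ... | inj₂ x∈′ = there (tagged ts x∈′)
  ... | inj₁ x∈′ with ∈-map⁻ (t ,_) x∈′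
  ...   | _ , _ , refl = here refl

  all-Unique : ∀ {ts} → Unique ts → Unique (concatMap occurrences ts)
  all-Unique [] = []
  all-Unique {t ∷ ts} (n ∷ u) = Unique.++⁺ (occurrences-Unique t) (all-Unique u) disj
    where
    disj : ∀ {x} → x ∈ occurrences t × x ∈ concatMap occurrences ts → ⊥
    disj (x∈ , x∈′) with ∈-map⁻ (t ,_) x∈
    ... | _ , _ , refl = All.lookup n (tagged ts x∈′) refl

  length-occurrences : ∀ ts → length (concatMap occurrences ts) ≡ sum
    (map (λ t → countTrue (cond t ∘ map W) (choose (size t) positions)) ts)
  length-occurrences []       = refl
  length-occurrences (t ∷ ts) = trans (length-++ (occurrences t))
    (cong₂ _+_ (trans (length-map (t ,_) (filterᵇ (cond t ∘ map W) (choose (size t) positions)))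
    (length-filterᵇ (cond t ∘ map W) (choose (size t) positions))) (length-occurrences ts))

  vector : Tag × List ℕ → List ℕ
  vector (t , xs) = map (vec (conf t xs)) positions

  map-range-injective : ∀ {φ ψ : ℕ → ℕ} {g} m → map φ (range g m) ≡ map ψ (range g m) → ∀ {a} → a ∈ range g m → φ a ≡ ψ a
  map-range-injective (suc m) h (here refl) = ∷-injectiveˡ h
  map-range-injective (suc m) h (there a∈)  = map-range-injective m (∷-injectiveʳ h) a∈

  vector-injective : ∀ {x y} → Occurs x → Occurs y → vector x ≡ vector y → x ≡ y
  vector-injective {t , xs} {t′ , ys} o@(a , _ , l , _) o′@(a′ , _ , l′ , _) h = trans (sym (decode-conf t xs a l))
    (trans (cong decode
    (vec-injective (conf t xs) (conf t′ ys) (occurs-Valid t xs o) (occurs-Valid t′ ys o′)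
      (λ a a<n → map-range-injective n h (∈-range⁺ n z≤n a<n)))) (decode-conf t′ ys a′ l′))

  vectors : List (List ℕ)
  vectors = map vector (concatMap occurrences tags)

  vectors-Unique : Unique vectors
  vectors-Unique = AllPairs.map⁺ (distinct (all-Occurs tags) (all-Unique tags-Unique))
    where
    distinct : ∀ {xs} → All Occurs xs → Unique xs → AllPairs (λ x y → vector x ≢ vector y) xs
    distinct []       []       = []
    distinct (o ∷ os) (n ∷ us) = All.zipWith (λ (o′ , ne) e → ne (vector-injective o o′ e)) (os , n) ∷ distinct os us

  vectors-length : ∀ {α} → α ∈ vectors → length α ≡ n
  vectors-length = All.lookup (All.map⁺ (All.tabulate {xs = concatMap occurrences tags}
    (λ {x} _ → trans (length-map (vec (conf (proj₁ x) (proj₂ x))) positions) (length-range 0 n))))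

  vectors-Pipe : ∀ {α} → α ∈ vectors → Pipe u positions α
  vectors-Pipe α∈ with ∈-map⁻ vector α∈
  ... | (t , xs) , x∈ , refl = subst (λ l → Pipe l positions (vector (t , xs))) (labels-items C u)
      (fillings-Pipe n 0 (items C u) (subst Unique (sym (labels-items C u)) u-Unique)
        (λ q∈ → ∈-range⁺ n z≤n (u⊆ (subst (_ ∈_) (labels-items C u) q∈))) (λ q∈ → subst (_ ∈_) (sym (labels-items C u))
          (⊆u (proj₂ (∈-range⁻ q∈))))
        (Adm-fill (conf t xs) (occurs-Valid t xs (All.lookup (all-Occurs tags) x∈))))
    where
    C : ℕ → Col
    C = fill (conf t xs)
    u-Unique : Unique u
    u-Unique = AllPairs.map (λ lt e → ℕₚ.<-irrefl (cong W e) lt) sorted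

-- Counting pattern occurrences

BoolFun : ℕ → Set
BoolFun zero    = Bool
BoolFun (suc k) = Bool → BoolFun k

-- Whether a word meets a pattern or a condition depends only on pairwise comparisons, so the
-- inequalities between counts are decided by evaluation over all truth values.
allTrue : ∀ k → BoolFun k → Bool
allTrue zero    b = b
allTrue (suc k) f = allTrue k (f true) ∧ allTrue k (f false)

AlwaysTrue : ∀ k → BoolFun k → Set
AlwaysTrue zero    b = b ≡ true
AlwaysTrue (suc k) f = ∀ b → AlwaysTrue k (f b)

allTrue-sound : ∀ k f → allTrue k f ≡ true → AlwaysTrue k f
allTrue-sound zero    b h = h
allTrue-sound (suc k) f h true  = allTrue-sound k (f true) (proj₁ (∧-true h))
allTrue-sound (suc k) f h false = allTrue-sound k (f false) (proj₂ (∧-true {allTrue k (f true)} h))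

eq : Bool → Bool → Bool
eq a b = does (a Bool.≟ b)

-- The unfolding of `sameOrder` on five letters with the ten comparisons abstracted, written so that
-- it agrees with `sameOrder` by computation.
so5 : ℕ → ℕ → ℕ → ℕ → ℕ → BoolFun 10
so5 u₁ u₂ u₃ u₄ u₅ ab ac ad ae bc bd be cd ce de =
  (eq (u₁ <ᵇ u₂) ab ∧ eq (u₁ <ᵇ u₃) ac ∧ eq (u₁ <ᵇ u₄) ad ∧ eq (u₁ <ᵇ u₅) ae ∧ true) ∧
  (eq (u₂ <ᵇ u₃) bc ∧ eq (u₂ <ᵇ u₄) bd ∧ eq (u₂ <ᵇ u₅) be ∧ true) ∧
  (eq (u₃ <ᵇ u₄) cd ∧ eq (u₃ <ᵇ u₅) ce ∧ true) ∧
  (eq (u₄ <ᵇ u₅) de ∧ true) ∧ true ∧ true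

patterns5 conds5 : List ℕ → ℕ
patterns5 v = bit (sameOrder (1 ∷ 3 ∷ 2 ∷ 5 ∷ 4 ∷ []) v) + (3 * bit (sameOrder (1 ∷ 4 ∷ 2 ∷ 5 ∷ 3 ∷ []) v) +
  (bit (sameOrder (1 ∷ 4 ∷ 3 ∷ 5 ∷ 2 ∷ []) v)
  + (4 * bit (sameOrder (1 ∷ 5 ∷ 2 ∷ 4 ∷ 3 ∷ []) v) + (bit (sameOrder (1 ∷ 5 ∷ 3 ∷ 2 ∷ 4 ∷ []) v) +
    (2 * bit (sameOrder (1 ∷ 5 ∷ 3 ∷ 4 ∷ 2 ∷ []) v)
  + (bit (sameOrder (1 ∷ 5 ∷ 4 ∷ 3 ∷ 2 ∷ []) v) + (bit (sameOrder (2 ∷ 4 ∷ 1 ∷ 5 ∷ 3 ∷ []) v) +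
    (2 * bit (sameOrder (2 ∷ 5 ∷ 1 ∷ 4 ∷ 3 ∷ []) v)
  + bit (sameOrder (3 ∷ 5 ∷ 1 ∷ 4 ∷ 2 ∷ []) v)))))))))
conds5 v = bit (cond pA v) + (bit (cond pC v) + (bit (cond pD v) + (bit (cond p3k v) + (bit (cond p3l v) + bit (cond p3r v)))))

patternsB condsB : ∀ (ab ac ad ae bc bd be cd ce de : Bool) → ℕ
patternsB ab ac ad ae bc bd be cd ce de = bit (f (so5 1 3 2 5 4)) + (3 * bit (f (so5 1 4 2 5 3)) + (bit (f (so5 1 4 3 5 2))
  + (4 * bit (f (so5 1 5 2 4 3)) + (bit (f (so5 1 5 3 2 4)) + (2 * bit (f (so5 1 5 3 4 2))
  + (bit (f (so5 1 5 4 3 2)) + (bit (f (so5 2 4 1 5 3)) + (2 * bit (f (so5 2 5 1 4 3)) + bit (f (so5 3 5 1 4 2))))))))))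
  where
  f : BoolFun 10 → Bool
  f g = g ab ac ad ae bc bd be cd ce de
condsB ab ac ad ae bc bd be cd ce de =
  bit (between ac bc ∧ between ae de) + (bit (between ae ce ∧ (between cd bd ∧ ad)) + (bit (between ad cd ∧ (between ce be ∧ ae))
  + (bit (between ac bc ∧ between ce de) + (bit (between ad bd ∧ between ce de) + bit (between ae be ∧ between ce de)))))

-- Each pattern satisfies at least as many conditions as its coefficient says: 15243 meets `pA`,
-- `p3k`, `p3l` and `p3r`, and 14253 meets `pA`, `p3k` and `p3r`. The inequality is strict for
-- 13254, which meets both `pA` and `p3k`.
patterns5≤conds5 : ∀ v → length v ≡ 5 → patterns5 v ≤ conds5 v
patterns5≤conds5 (a ∷ b ∷ c ∷ d ∷ e ∷ []) _ = ℕₚ.≤ᵇ⇒≤ _ _ (subst T (sym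
  (allTrue-sound 10 (λ ab ac ad ae bc bd be cd ce de → patternsB ab ac ad ae bc bd be cd ce de ≤ᵇ condsB ab ac ad ae bc bd be
    cd ce de) refl
    (a <ᵇ b) (a <ᵇ c) (a <ᵇ d) (a <ᵇ e) (b <ᵇ c) (b <ᵇ d) (b <ᵇ e) (c <ᵇ d) (c <ᵇ e) (d <ᵇ e))) tt)

pattern132≤ : ∀ v → length v ≡ 3 → bit (sameOrder (1 ∷ 3 ∷ 2 ∷ []) v) ≤ bit (cond p132 v)
pattern132≤ (a ∷ b ∷ c ∷ []) _ = ℕₚ.≤ᵇ⇒≤ _ _ (subst T (sym
  (allTrue-sound 3 (λ ab ac bc → bit ((eq true ab ∧ eq true ac ∧ true) ∧ (eq false bc ∧ true) ∧ true ∧ true) ≤ᵇ bit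
    (between ac bc)) refl (a <ᵇ b) (a <ᵇ c) (b <ᵇ c))) tt)

pattern1432≤ : ∀ v → length v ≡ 4 → bit (sameOrder (1 ∷ 4 ∷ 3 ∷ 2 ∷ []) v) ≤ bit (cond p1432 v)
pattern1432≤ (a ∷ b ∷ c ∷ d ∷ []) _ = ℕₚ.≤ᵇ⇒≤ _ _ (subst T (sym
  (allTrue-sound 6 (λ ab ac ad bc bd cd → bit ((eq true ab ∧ eq true ac ∧ eq true ad ∧ true) ∧
    (eq false bc ∧ eq false bd ∧ true) ∧ (eq false cd ∧ true) ∧ true ∧ true) ≤ᵇ bit (between ad cd ∧ between ac bc)) refl
    (a <ᵇ b) (a <ᵇ c) (a <ᵇ d) (b <ᵇ c) (b <ᵇ d) (c <ᵇ d))) tt)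

Sum : ∀ {A : Set} → (A → ℕ) → List A → ℕ
Sum f xs = sum (map f xs)

Sum-+ : ∀ {A : Set} (f g : A → ℕ) xs → Sum f xs + Sum g xs ≡ Sum (λ x → f x + g x) xs
Sum-+ f g []       = refl
Sum-+ f g (x ∷ xs) = trans (lem (f x) (Sum f xs) (g x) (Sum g xs)) (cong (f x + g x +_) (Sum-+ f g xs))
  where
  lem : ∀ a b c d → (a + b) + (c + d) ≡ (a + c) + (b + d)
  lem = ℕ-Ring.solve-∀

Sum-* : ∀ {A : Set} c (f : A → ℕ) xs → c * Sum f xs ≡ Sum (λ x → c * f x) xs
Sum-* c f []       = ℕₚ.*-zeroʳ c
Sum-* c f (x ∷ xs) = trans (ℕₚ.*-distribˡ-+ c (f x) (Sum f xs)) (cong (c * f x +_) (Sum-* c f xs))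

Sum-mono : ∀ {A : Set} {f g : A → ℕ} {xs} → All (λ x → f x ≤ g x) xs → Sum f xs ≤ Sum g xs
Sum-mono []       = z≤n
Sum-mono (h ∷ hs) = ℕₚ.+-mono-≤ h (Sum-mono hs)

countTrue-Sum : ∀ {A : Set} (b : A → Bool) xs → countTrue b xs ≡ Sum (bit ∘ b) xs
countTrue-Sum b []       = refl
countTrue-Sum b (x ∷ xs) with b x
... | true  = cong suc (countTrue-Sum b xs)
... | false = countTrue-Sum b xs

patternSum : ∀ xs → let c = λ u → Sum (bit ∘ sameOrder u) xs in
  c (1 ∷ 3 ∷ 2 ∷ 5 ∷ 4 ∷ []) + (3 * c (1 ∷ 4 ∷ 2 ∷ 5 ∷ 3 ∷ []) + (c (1 ∷ 4 ∷ 3 ∷ 5 ∷ 2 ∷ [])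
  + (4 * c (1 ∷ 5 ∷ 2 ∷ 4 ∷ 3 ∷ []) + (c (1 ∷ 5 ∷ 3 ∷ 2 ∷ 4 ∷ []) + (2 * c (1 ∷ 5 ∷ 3 ∷ 4 ∷ 2 ∷ [])
  + (c (1 ∷ 5 ∷ 4 ∷ 3 ∷ 2 ∷ []) + (c (2 ∷ 4 ∷ 1 ∷ 5 ∷ 3 ∷ []) + (2 * c (2 ∷ 5 ∷ 1 ∷ 4 ∷ 3 ∷ [])
  + c (3 ∷ 5 ∷ 1 ∷ 4 ∷ 2 ∷ []))))))))) ≡ Sum patterns5 xs
patternSum xs = plus¹ (plus³ 3 (plus¹ (plus³ 4 (plus¹ (plus³ 2 (plus¹ (plus¹ (plus³ 2 refl))))))))
  where
  plus¹ : ∀ {f g : List ℕ → ℕ} {s} → s ≡ Sum g xs → Sum f xs + s ≡ Sum (λ x → f x + g x) xs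
  plus¹ {f} {g} refl = Sum-+ f g xs
  plus³ : ∀ k {f g : List ℕ → ℕ} {s} → s ≡ Sum g xs → k * Sum f xs + s ≡ Sum (λ x → k * f x + g x) xs
  plus³ k {f} {g} refl = trans (cong (_+ Sum g xs) (Sum-* k f xs)) (Sum-+ (λ x → k * f x) g xs)

condSum : ∀ xs → let c = λ t → Sum (bit ∘ cond t) xs in c pA + (c pC + (c pD + (c p3k + (c p3l + c p3r)))) ≡ Sum conds5 xs
condSum xs = plus¹ (plus¹ (plus¹ (plus¹ (plus¹ refl))))
  where
  plus¹ : ∀ {f g : List ℕ → ℕ} {s} → s ≡ Sum g xs → Sum f xs + s ≡ Sum (λ x → f x + g x) xs
  plus¹ {f} {g} refl = Sum-+ f g xs

-- The inverse permutation and the final count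

Unique⇒↭ : ∀ {A : Set} {xs ys : List A} → Unique xs → (∀ {x} → x ∈ xs → x ∈ ys) → length ys ≤ length xs → xs ↭ ys
Unique⇒↭ {ys = []}    []      h le = ↭-refl
Unique⇒↭ {ys = _ ∷ _} []      h ()
Unique⇒↭ {xs = x ∷ xs} (n ∷ u) h le with ∈-∃++ (h (here refl))
... | as , bs , refl = ↭-trans (prep x (Unique⇒↭ u h′ le′)) (↭-sym (shift x as bs))
  where
  h′ : ∀ {y} → y ∈ xs → y ∈ as ++ bs
  h′ y∈ with ∈-++⁻ as (h (there y∈))
  ... | inj₁ y∈as         = ∈-++⁺ˡ y∈as
  ... | inj₂ (here refl)  = ⊥-elim (All.lookup n y∈ refl)
  ... | inj₂ (there y∈bs) = ∈-++⁺ʳ as y∈bs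
  le′ : length (as ++ bs) ≤ length xs
  le′ = ℕₚ.≤-pred (ℕₚ.≤-trans (ℕₚ.≤-reflexive
    (sym (trans (length-++ as) (trans (ℕₚ.+-suc (length as) (length bs)) (cong suc (sym (length-++ as))))))) le)

map-get-range : ∀ l g (φ : ℕ → ℕ) → (∀ a → φ (g + a) ≡ get l a) → map φ (range g (length l)) ≡ l
map-get-range []      g φ h = refl
map-get-range (x ∷ l) g φ h = cong₂ _∷_ (trans (cong φ (sym (ℕₚ.+-identityʳ g))) (h 0))
  (map-get-range l (suc g) φ (λ a → trans (cong φ (sym (ℕₚ.+-suc g a))) (h (suc a))))

Unique-map⁻ : ∀ {A B : Set} (f : A → B) {xs a b} → Unique (map f xs) → a ∈ xs → b ∈ xs → f a ≡ f b → a ≡ b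
Unique-map⁻ f (n ∷ u) (here refl) (here refl) e = refl
Unique-map⁻ f (n ∷ u) (here refl) (there b∈)  e = ⊥-elim (All.lookup n (∈-map⁺ f b∈) e)
Unique-map⁻ f (n ∷ u) (there a∈)  (here refl) e = ⊥-elim (All.lookup n (∈-map⁺ f a∈) (sym e))
Unique-map⁻ f (n ∷ u) (there a∈)  (there b∈)  e = Unique-map⁻ f u a∈ b∈ e

module Proof (n : ℕ) (w : Permutation′ n) where

  wl : List ℕ
  wl = oneLine w

  wl-length : length wl ≡ n
  wl-length = length-tabulate _

  wl-Unique : Unique wl
  wl-Unique = Unique.tabulate⁺ (λ e → perm-injective (Finₚ.toℕ-injective (ℕₚ.suc-injective e)))
    where
    perm-injective : ∀ {i j} → w ⟨$⟩ʳ i ≡ w ⟨$⟩ʳ j → i ≡ j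
    perm-injective e = trans (sym (inverseˡ w)) (trans (cong (w ⟨$⟩ˡ_) e) (inverseˡ w))

  wl↭ : wl ↭ range 1 n
  wl↭ = Unique⇒↭ wl-Unique wl⊆ (ℕₚ.≤-reflexive (trans (length-range 1 n) (sym wl-length)))
    where
    wl⊆ : ∀ {x} → x ∈ wl → x ∈ range 1 n
    wl⊆ x∈ with ∈-tabulate⁻ x∈
    ... | i , refl = ∈-range⁺ n (s≤s z≤n) (s≤s (Finₚ.toℕ<n (w ⟨$⟩ʳ i)))

  W : ℕ → ℕ
  W = get wl

  map-W : map W (range 0 n) ≡ wl
  map-W = subst (λ k → map W (range 0 k) ≡ wl) wl-length (map-get-range wl 0 W (λ _ → refl))

  -- Pulling the rearrangement of the values back along `W` lists the positions by increasing value,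
  -- which is the inverse permutation.
  inverse : ∃ λ u → range 1 n ≡ map W u × range 0 n ↭ u
  inverse = ↭-map-inv W (subst (_↭ range 1 n) (sym map-W) wl↭)

  u : List ℕ
  u = proj₁ inverse

  map-W-u : map W u ≡ range 1 n
  map-W-u = sym (proj₁ (proj₂ inverse))

  W-injective : ∀ {a b} → a < n → b < n → W a ≡ W b → a ≡ b
  W-injective a<n b<n = Unique-map⁻ W (subst Unique (sym map-W) wl-Unique) (∈-range⁺ n z≤n a<n) (∈-range⁺ n z≤n b<n)

  open Occurrences n W W-injective u
    (λ c∈ → proj₂ (∈-range⁻ (∈-resp-↭ (↭-sym (proj₂ (proj₂ inverse))) c∈)))
    (λ c<n → ∈-resp-↭ (proj₂ (proj₂ inverse)) (∈-range⁺ n z≤n c<n))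
    (AllPairs.map⁻ (subst (AllPairs _<_) (sym map-W-u) (range-sorted 1 n)))

  coeff-vectors : ∀ {α} → α ∈ vectors → coeff α (Schubert w) ≢ pos 0
  coeff-vectors {α} α∈ z = coeff-Monic-∈ (F-Monic n n 1 wl) (Pipe⇒∈F n n 1 pipe (ℕₚ.≤-reflexive wl-length) (vectors-length α∈))
    (trans (coeff-pair α (F n n 1 wl)) (trans (sym (schubertFuel≈F n (suc (n * n)) wl wl↭ (s≤s fuel) .at (δ α)))
      (trans (sym (coeff-pair α (Schubert w))) z)))
    where
    -- Renaming positions to values turns `u` into the natural order and the interval of positions
    -- into the one-line notation.
    pipe : Pipe (range 1 n) wl α
    pipe = subst₂ (λ o z → Pipe o z α) map-W-u map-W (Pipe-map W (vectors-Pipe α∈))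
    fuel : asc wl ≤ n * n
    fuel = subst (λ k → asc wl ≤ k * k) wl-length (asc-≤ wl)

  θ-≥ : length vectors ≤ θ w
  θ-≥ = numSupports-≥ (Schubert w) vectors-Unique coeff-vectors

  chosen : ℕ → List (List ℕ)
  chosen k = map (map W) (choose k positions)

  chosen-length : ∀ k → All (λ v → length v ≡ k) (chosen k)
  chosen-length k = All.map⁺ (All.map (λ {ys} (_ , _ , l) → trans (length-map W ys) l)
    (choose-All {λ _ → ⊤} k (range-sorted 0 n) (All.tabulate (λ _ → tt))))

  p-Sum : ∀ v → p v w ≡ Sum (bit ∘ sameOrder v) (chosen (length v))
  p-Sum v = trans (cong (λ l → countTrue (sameOrder v) (choose (length v) l)) (sym map-W))
    (trans (cong (countTrue (sameOrder v)) (choose-map W (length v) positions)) (countTrue-Sum (sameOrder v) (chosen (length v))))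

  cond-Sum : ∀ t → countTrue (cond t ∘ map W) (choose (size t) positions) ≡ Sum (bit ∘ cond t) (chosen (size t))
  cond-Sum t = trans (countTrue-Sum (cond t ∘ map W) (choose (size t) positions)) (cong sum (map-∘ (choose (size t) positions)))

  patterns≤vectors : 1 + (Sum (bit ∘ sameOrder (1 ∷ 3 ∷ 2 ∷ [])) (chosen 3) + (Sum (bit ∘ sameOrder (1 ∷ 4 ∷ 3 ∷ 2 ∷ []))
    (chosen 4) + Sum patterns5 (chosen 5))) ≤ length vectors
  patterns≤vectors = begin
    1 + (Sum (bit ∘ sameOrder (1 ∷ 3 ∷ 2 ∷ [])) (chosen 3) + (Sum (bit ∘ sameOrder (1 ∷ 4 ∷ 3 ∷ 2 ∷ [])) (chosen 4) + Sum
      patterns5 (chosen 5)))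
      ≤⟨ s≤s (ℕₚ.+-mono-≤ (Sum-mono (All.map (λ {v} → pattern132≤ v) (chosen-length 3)))
           (ℕₚ.+-mono-≤ (Sum-mono (All.map (λ {v} → pattern1432≤ v) (chosen-length 4)))
             (Sum-mono (All.map (λ {v} → patterns5≤conds5 v) (chosen-length 5))))) ⟩
    1 + (Sum (bit ∘ cond p132) (chosen 3) + (Sum (bit ∘ cond p1432) (chosen 4) + Sum conds5 (chosen 5)))
      ≡⟨ cong (λ s → 1 + (S p132 + (S p1432 + s))) (sym (condSum (chosen 5))) ⟩
    1 + (S p132 + (S p1432 + (S pA + (S pC + (S pD + (S p3k + (S p3l + S p3r)))))))
      ≡⟨ cong (λ s → 1 + (S p132 + (S p1432 + (S pA + (S pC + (S pD + (S p3k + (S p3l + s)))))))) (sym (ℕₚ.+-identityʳ (S p3r))) ⟩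
    -- The summand 1 is the term of the tag `∅`, whose only occurrence is the empty list.
    sum (map (λ t → S t) tags)
      ≡⟨ cong sum (map-cong (λ t → sym (cond-Sum t)) tags) ⟩
    sum (map (λ t → countTrue (cond t ∘ map W) (choose (size t) positions)) tags)
      ≡⟨ sym (length-occurrences tags) ⟩
    length (concatMap occurrences tags)
      ≡⟨ sym (length-map vector (concatMap occurrences tags)) ⟩
    length vectors ∎
    where
    open ℕₚ.≤-Reasoning
    S : Tag → ℕ
    S t = Sum (bit ∘ cond t) (chosen (size t))

theorem1p1 : (n : ℕ) → 1 ≤ n → (w : Permutation′ n) →
    1 + p (1 ∷ 3 ∷ 2 ∷ []) w + p (1 ∷ 4 ∷ 3 ∷ 2 ∷ []) w + p (1 ∷ 3 ∷ 2 ∷ 5 ∷ 4 ∷ []) w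
    + 3 * p (1 ∷ 4 ∷ 2 ∷ 5 ∷ 3 ∷ []) w + p (1 ∷ 4 ∷ 3 ∷ 5 ∷ 2 ∷ []) w
    + 4 * p (1 ∷ 5 ∷ 2 ∷ 4 ∷ 3 ∷ []) w + p (1 ∷ 5 ∷ 3 ∷ 2 ∷ 4 ∷ []) w
    + 2 * p (1 ∷ 5 ∷ 3 ∷ 4 ∷ 2 ∷ []) w + p (1 ∷ 5 ∷ 4 ∷ 3 ∷ 2 ∷ []) w
    + p (2 ∷ 4 ∷ 1 ∷ 5 ∷ 3 ∷ []) w + 2 * p (2 ∷ 5 ∷ 1 ∷ 4 ∷ 3 ∷ []) w
    + p (3 ∷ 5 ∷ 1 ∷ 4 ∷ 2 ∷ []) w
    ≤ θ w
theorem1p1 n _ w = ℕₚ.≤-trans (ℕₚ.≤-reflexive (trans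
    (reassociate (p (1 ∷ 3 ∷ 2 ∷ []) w) (p (1 ∷ 4 ∷ 3 ∷ 2 ∷ []) w) (p (1 ∷ 3 ∷ 2 ∷ 5 ∷ 4 ∷ []) w) (p (1 ∷ 4 ∷ 2 ∷ 5 ∷ 3 ∷ []) w)
      (p (1 ∷ 4 ∷ 3 ∷ 5 ∷ 2 ∷ []) w) (p (1 ∷ 5 ∷ 2 ∷ 4 ∷ 3 ∷ []) w) (p (1 ∷ 5 ∷ 3 ∷ 2 ∷ 4 ∷ []) w) (p (1 ∷ 5 ∷ 3 ∷ 4 ∷ 2 ∷ []) w)
      (p (1 ∷ 5 ∷ 4 ∷ 3 ∷ 2 ∷ []) w) (p (2 ∷ 4 ∷ 1 ∷ 5 ∷ 3 ∷ []) w) (p (2 ∷ 5 ∷ 1 ∷ 4 ∷ 3 ∷ []) w) (p (3 ∷ 5 ∷ 1 ∷ 4 ∷ 2 ∷ []) w))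
    sums)) (ℕₚ.≤-trans patterns≤vectors θ-≥)
  where
  open Proof n w
  reassociate : ∀ a b c d e f g h i j k l →
    1 + a + b + c + 3 * d + e + 4 * f + g + 2 * h + i + j + 2 * k + l ≡
    1 + (a + (b + (c + (3 * d + (e + (4 * f + (g + (2 * h + (i + (j + (2 * k + l)))))))))))
  reassociate = ℕ-Ring.solve-∀
  five : ∀ {a a′ b b′ c c′ d d′ e e′ f f′ g g′ h h′ i i′ j j′ : ℕ} → a ≡ a′ → b ≡ b′ → c ≡ c′ → d ≡ d′ → e ≡ e′ → f ≡ f′ → g ≡
    g′ → h ≡ h′ → i ≡ i′ → j ≡ j′ →
    a + (3 * b + (c + (4 * d + (e + (2 * f + (g + (h + (2 * i + j)))))))) ≡ a′ +
      (3 * b′ + (c′ + (4 * d′ + (e′ + (2 * f′ + (g′ + (h′ + (2 * i′ + j′))))))))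
  five refl refl refl refl refl refl refl refl refl refl = refl
  sums : 1 + (p (1 ∷ 3 ∷ 2 ∷ []) w + (p (1 ∷ 4 ∷ 3 ∷ 2 ∷ []) w + (p (1 ∷ 3 ∷ 2 ∷ 5 ∷ 4 ∷ []) w + (3 * p (1 ∷ 4 ∷ 2 ∷ 5 ∷ 3 ∷ []) w
         + (p (1 ∷ 4 ∷ 3 ∷ 5 ∷ 2 ∷ []) w +
           (4 * p (1 ∷ 5 ∷ 2 ∷ 4 ∷ 3 ∷ []) w + (p (1 ∷ 5 ∷ 3 ∷ 2 ∷ 4 ∷ []) w + (2 * p (1 ∷ 5 ∷ 3 ∷ 4 ∷ 2 ∷ []) w
         + (p (1 ∷ 5 ∷ 4 ∷ 3 ∷ 2 ∷ []) w +
           (p (2 ∷ 4 ∷ 1 ∷ 5 ∷ 3 ∷ []) w + (2 * p (2 ∷ 5 ∷ 1 ∷ 4 ∷ 3 ∷ []) w + p (3 ∷ 5 ∷ 1 ∷ 4 ∷ 2 ∷ []) w)))))))))))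
         ≡ 1 + (Sum (bit ∘ sameOrder (1 ∷ 3 ∷ 2 ∷ [])) (chosen 3) + (Sum (bit ∘ sameOrder (1 ∷ 4 ∷ 3 ∷ 2 ∷ [])) (chosen 4) +
           Sum patterns5 (chosen 5)))
  sums = cong suc (cong₂ _+_ (p-Sum (1 ∷ 3 ∷ 2 ∷ [])) (cong₂ _+_ (p-Sum (1 ∷ 4 ∷ 3 ∷ 2 ∷ [])) (trans
    (five (p-Sum (1 ∷ 3 ∷ 2 ∷ 5 ∷ 4 ∷ [])) (p-Sum (1 ∷ 4 ∷ 2 ∷ 5 ∷ 3 ∷ [])) (p-Sum (1 ∷ 4 ∷ 3 ∷ 5 ∷ 2 ∷ []))
      (p-Sum (1 ∷ 5 ∷ 2 ∷ 4 ∷ 3 ∷ []))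
      (p-Sum (1 ∷ 5 ∷ 3 ∷ 2 ∷ 4 ∷ [])) (p-Sum (1 ∷ 5 ∷ 3 ∷ 4 ∷ 2 ∷ [])) (p-Sum (1 ∷ 5 ∷ 4 ∷ 3 ∷ 2 ∷ []))
        (p-Sum (2 ∷ 4 ∷ 1 ∷ 5 ∷ 3 ∷ []))
      (p-Sum (2 ∷ 5 ∷ 1 ∷ 4 ∷ 3 ∷ [])) (p-Sum (3 ∷ 5 ∷ 1 ∷ 4 ∷ 2 ∷ [])))
    (patternSum (chosen 5)))))
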